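{- Let $\Omega$ be a biased expansion of a finite $2$-connected graph $\Delta$ with at least four nodes. If every expansion minor of $\Omega$ of order four is a group expansion, then $\Omega$ is a group expansion.
   Context: A biased graph is a graph with a set of circles, called balanced, such that no theta subgraph contains exactly two balanced circles. A biased expansion of $\Delta$ is a biased graph $\Omega$ with surjective $p:\|\Omega\|\to\Delta$, identity on nodes, no balanced digon in any fiber, and the circle lifting property (for every circle $e_1\cdots e_l$ of $\Delta$ and any $\tilde e_i\in p^{ -1}(e_i)$, $i<l$, exactly one $\tilde e_l\in p^{ -1}(e_l)$ makes $\tilde e_1\cdots\tilde e_l$ balanced). For a group $G$, $\langle G\Delta\rangle$ has an edge $ge$ for each $g\in G$, $e\in E(\Delta)$, of gain $g$ along a fixed orientation of $e$, and a circle is balanced iff its gain product is $1$; a group expansion is a biased expansion isomorphic (compatibly with projection) to some $\langle G\Delta'\rangle$ of its base graph $\Delta'$. Expansion minor: choose a partition $E(\Delta)=S\cup T\cup D$ (parts possibly empty) and a balanced lift $\tilde T$ of $T$ (one edge of $\Omega$ over each edge of $T$, containing no unbalanced circle); delete $p^{ -1}(D)$, contract $\tilde T$ (identify endpoints of its edges and delete them), delete the remaining edges of $p^{ -1}(T)$ (now loops), and delete any subset of isolated nodes. A circle $\tilde C$ of the result is balanced iff there is a balanced circle $\tilde D$ of $\Omega$ with $\tilde D\subseteq\tilde C\cup\tilde T$ and $\tilde D\setminus\tilde T=\tilde C$; the projection is the restriction of $p$, making the result a biased expansion of the corresponding minor of $\Delta$. Its order is its number of nodes. -}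

module Defs where

open import Level using (0ℓ)
open import Data.Nat using (ℕ; _≤_)
open import Data.Fin using (Fin)
open import Data.Fin.Subset using (Subset; ∣_∣) renaming (_∈_ to _∈ₛ_)
open import Data.Product using (Σ; Σ-syntax; ∃; _×_; _,_; proj₁; proj₂)
open import Data.Sum using (_⊎_; inj₁; inj₂)
open import Data.Empty using (⊥)
open import Data.List using (List; []; _∷_; _++_; _∷ʳ_; map; reverse; length; drop)
open import Data.List.Membership.Propositional using (_∈_; _∉_)
open import Data.List.Relation.Unary.All using (All)
open import Data.List.Relation.Unary.Unique.Propositional using (Unique)
open import Data.List.Relation.Binary.Permutation.Propositional using (_↭_)
open import Relation.Nullary using (¬_)
open import Relation.Binary.PropositionalEquality using (_≡_; _≢_)
open import Function.Bundles using (_⇔_)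
open import Algebra.Bundles using (Group)

-- Graphs.  A (multi)graph with node type V and edge type E is given by
-- the endpoints of each edge.  The ordered pair is only an encoding
-- (it fixes a reference orientation of each edge); incidence is
-- symmetric (see Joins).  Loops and parallel edges are allowed.

Graph : Set → Set → Set
Graph V E = E → V × V

Disjoint : {A : Set} → List A → List A → Set
Disjoint xs ys = ∀ {x} → x ∈ xs → x ∈ ys → ⊥

module _ {V E : Set} (g : Graph V E) where

  Joins : E → V → V → Set
  Joins e u w = g e ≡ (u , w) ⊎ g e ≡ (w , u)

  data Walk : V → V → Set where
    []   : ∀ {v} → Walk v v
    step : ∀ {u w v} (e : E) → Joins e u w → Walk w v → Walk u v

  edges : ∀ {u v} → Walk u v → List E
  edges []             = []
  edges (step e _ W)   = e ∷ edges W

  verts : ∀ {u v} → Walk u v → List V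
  verts []                 = []
  verts {u} (step _ _ W)   = u ∷ verts W

  allVerts : ∀ {u v} → Walk u v → List V
  allVerts {v = v} W = verts W ∷ʳ v

  inner : ∀ {u v} → Walk u v → List V
  inner W = drop 1 (verts W)

  IsPath : ∀ {u v} → Walk u v → Set
  IsPath W = Unique (allVerts W)

  -- a circle: a nonempty closed walk with no repeated node and no
  -- repeated edge (loops are circles of length 1, digons of length 2)
  record Circle : Set where
    field
      base     : V
      walk     : Walk base base
      nonempty : 1 ≤ length (edges walk)
      uniqV    : Unique (verts walk)
      uniqE    : Unique (edges walk)

  circEdges : Circle → List E
  circEdges C = edges (Circle.walk C)

  -- B is a set of circles (given by its characteristic predicate on
  -- edge sequences; only its values on circles matter) satisfying the
  -- theta property.
  record IsBiased (B : List E → Set) : Set where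
    field
      invariant : (C C′ : Circle) → circEdges C ↭ circEdges C′ →
                  B (circEdges C) → B (circEdges C′)
      theta : ∀ {u v} → u ≢ v → (P₁ P₂ P₃ : Walk u v) →
              IsPath P₁ → IsPath P₂ → IsPath P₃ →
              Disjoint (inner P₁) (inner P₂) →
              Disjoint (inner P₁) (inner P₃) →
              Disjoint (inner P₂) (inner P₃) →
              Disjoint (edges P₁) (edges P₂) →
              Disjoint (edges P₁) (edges P₃) →
              Disjoint (edges P₂) (edges P₃) →
              B (edges P₁ ++ reverse (edges P₂)) →
              B (edges P₁ ++ reverse (edges P₃)) →
              B (edges P₂ ++ reverse (edges P₃))

  module _ (G : Group 0ℓ 0ℓ) (φ : E → Group.Carrier G) where
    open Group G
    gain : ∀ {u v} → Walk u v → Carrier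
    gain []                   = ε
    gain (step e (inj₁ _) W)  = φ e ∙ gain W
    gain (step e (inj₂ _) W)  = (φ e ⁻¹) ∙ gain W

  -- 2-connected: connected, and deleting any node leaves it connected
  -- (the condition on the number of nodes is imposed separately)
  record TwoConnected : Set where
    field
      connected : ∀ u v → Walk u v
      noCut     : ∀ x u v → u ≢ x → v ≢ x →
                  Σ (Walk u v) (λ W → x ∉ allVerts W)

-- Biased expansions.  Ω has the same nodes as Δ, edge type E and
-- projection p : E → F; the endpoints of an edge of Ω are those of its
-- image (p is the identity on nodes).

liftG : {V E F : Set} → Graph V F → (E → F) → Graph V E
liftG g p e = g (p e)

module _ {V F E : Set} (Δ : Graph V F) (p : E → F) (B : List E → Set) where

  record IsBiasedExpansion : Set where
    field
      biased   : IsBiased (liftG Δ p) B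
      surj     : ∀ f → ∃ λ e → p e ≡ f
      noDigon  : (C : Circle (liftG Δ p)) → ∀ e e′ →
                 circEdges (liftG Δ p) C ≡ e ∷ e′ ∷ [] → p e ≡ p e′ →
                 ¬ B (e ∷ e′ ∷ [])
      lifting  : (C : Circle Δ) (fs : List F) (f : F) →
                 circEdges Δ C ≡ fs ∷ʳ f →
                 (ls : List E) → map p ls ≡ fs →
                 Σ E λ x → (p x ≡ f × B (ls ∷ʳ x)) ×
                           (∀ y → p y ≡ f → B (ls ∷ʳ y) → y ≡ x)

  -- Ω ≅ ⟨GΔ⟩ over Δ: e ↦ (φ e , p e) is a bijection E → G × F
  -- (G taken up to its equality ≈), and balance corresponds to gain ε.
  record GroupExpansionVia (G : Group 0ℓ 0ℓ) (φ : E → Group.Carrier G) : Set where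
    open Group G
    field
      inj     : ∀ e e′ → p e ≡ p e′ → φ e ≈ φ e′ → e ≡ e′
      onto    : ∀ (x : Carrier) (f : F) → Σ E λ e → p e ≡ f × φ e ≈ x
      balance : (C : Circle (liftG Δ p)) →
                B (circEdges (liftG Δ p) C) ⇔
                (gain (liftG Δ p) G φ (Circle.walk C) ≈ ε)

  IsGroupExpansion : Set₁
  IsGroupExpansion =
    Σ[ G ∈ Group 0ℓ 0ℓ ] Σ[ φ ∈ (E → Group.Carrier G) ] GroupExpansionVia G φ

data Part : Set where
  inS inT inD : Part

module _ {n m : ℕ} {E : Set} (Δ : Graph (Fin n) (Fin m)) (p : E → Fin m)
         (B : List E → Set) where

  -- the data determining an expansion minor:
  --   partition E(Δ) = S ∪ T ∪ D, a lift τ (used on T) which is balanced,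
  --   a labelling c of the nodes of the contraction by Fin k (c u ≡ c v
  --   iff u, v are joined by a walk of T-edges), and the set K of nodes
  --   kept (all nodes incident to S-edges must be kept).
  record ExpMinor : Set where
    field
      part    : Fin m → Part
      τ       : Fin m → E
      section : ∀ f → p (τ f) ≡ f

    InT : E → Set
    InT e = part (p e) ≡ inT × τ (p e) ≡ e

    field
      balancedLift : (C : Circle (liftG Δ p)) →
                     All InT (circEdges (liftG Δ p) C) → B (circEdges (liftG Δ p) C)
      k         : ℕ
      c         : Fin n → Fin k
      classSurj : ∀ i → ∃ λ u → c u ≡ i
      classSpec : ∀ u v → (c u ≡ c v) ⇔
                  Σ (Walk Δ u v) (λ W → All (λ f → part f ≡ inT) (edges Δ W))
      K         : Subset k
      keepS     : ∀ f → part f ≡ inS →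
                  (c (proj₁ (Δ f)) ∈ₛ K) × (c (proj₂ (Δ f)) ∈ₛ K)

    MV : Set
    MV = Σ (Fin k) (λ i → i ∈ₛ K)

    MF : Set
    MF = Σ (Fin m) (λ f → part f ≡ inS)

    ME : Set
    ME = Σ E (λ e → part (p e) ≡ inS)

    mBase : Graph MV MF
    mBase (f , s) = (c (proj₁ (Δ f)) , proj₁ (keepS f s)) ,
                    (c (proj₂ (Δ f)) , proj₂ (keepS f s))

    mProj : ME → MF
    mProj (e , s) = p e , s

    mBal : List ME → Set
    mBal L = Σ (Circle (liftG Δ p)) λ D →
               B (circEdges (liftG Δ p) D) ×
               (∀ e → e ∈ circEdges (liftG Δ p) D → e ∈ map proj₁ L ⊎ InT e) ×
               (∀ e → (e ∈ circEdges (liftG Δ p) D × ¬ InT e) ⇔ e ∈ map proj₁ L)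

    order : ℕ
    order = ∣ K ∣

-- Choose a circle of length at least four.  Its minors of order four are four-term group equations,
-- obtained by fixing the lifts of all other edges; comparing them shows that the many-variable
-- quasigroup of the circle is an iterated product in a single group G, with a G-valued gain on each fibre.
-- The gains are then extended along an ear decomposition.  An ear from a to b is attached to a
-- 2-connected subgraph H, in which a and b are joined by two disjoint paths Q₀ and Q₁.  The theta
-- property for ear, Q₀ and Q₁ shows that balance of ear ∪ Q₀ depends on the lift of Q₀ only through its
-- gain, and the minors of order four of that circle then provide gains on the ear.  Every other circle
-- through the ear is reached from ear ∪ Q₀ by exchanging segments of its path in H one at a time, again
-- by the theta property.  Since prescribed gains are met by exactly one lift, it always suffices to prove
-- that balanced circles have trivial gain.

module Submission where

open import Defs
open import Level using (0ℓ)
open import Data.Bool using (Bool; true; false; not)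
open import Data.Nat using (ℕ; zero; suc; _+_; _≤_; _<_; z≤n; s≤s)
open import Data.Nat.Properties using (≤-refl; ≤-trans; +-mono-≤; m≤n+m; <⇒≱; +-suc)
open import Data.Unit using (⊤; tt)
open import Data.Empty using (⊥; ⊥-elim)
open import Data.Product using (Σ; ∃; _×_; _,_; proj₁; proj₂)
import Data.Product.Properties as Productₚ
open import Data.Sum using (_⊎_; inj₁; inj₂; swap)
open import Data.Fin using (Fin; zero; suc)
open import Data.Fin.Properties using (_≟_; any?; injective⇒≤)
open import Data.Fin.Subset using (Subset; ∣_∣; ⁅_⁆; _∪_) renaming (_∈_ to _∈ₛ_; _∉_ to _∉ₛ_; ⊥ to ∅)
open import Data.Fin.Subset.Properties
  using (x∈⁅x⁆; x∈⁅y⁆⇒x≡y; x∈p∪q⁺; x∈p∪q⁻; ∪-identityˡ; ∉⊥; ∣⊥∣≡0)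
open import Data.Vec as Vec using ()
open import Data.Vec.Properties.WithK using ([]=-irrelevant)
open import Data.List
  using (List; []; _∷_; [_]; _++_; _∷ʳ_; map; reverse; length; drop; lookup; allFin)
open import Data.List.Properties
  using (++-assoc; ++-identityʳ; map-++; map-id; length-map; length-++; reverse-++; unfold-reverse;
         reverse-involutive; reverse-map; ∷-injective)
open import Data.List.Membership.Propositional using (_∈_; _∉_; find; lose)
open import Data.List.Membership.Propositional.Properties
  using (∈-++⁺ˡ; ∈-++⁺ʳ; ∈-++⁻; ∈-map⁺; ∈-map⁻; ∈-∃++; ∈-allFin)
open import Data.List.Relation.Unary.Any as Any using (here; there)
open import Data.List.Relation.Unary.Any.Properties using (reverse⁻; lookup-index)
open import Data.List.Relation.Unary.All as All using (All; []; _∷_)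
import Data.List.Relation.Unary.All.Properties as Allₚ
open import Data.List.Relation.Unary.AllPairs using ([]; _∷_)
open import Data.List.Relation.Unary.Unique.Propositional using (Unique)
import Data.List.Relation.Unary.Unique.Propositional.Properties as Uniqueₚ
open import Data.List.Relation.Binary.Permutation.Propositional
  using (_↭_; prep; ↭-sym; ↭-trans; ↭-reflexive; ↭⇒↭ₛ)
open import Data.List.Relation.Binary.Permutation.Propositional.Properties
  using (∷↭∷ʳ; ↭-reverse; ++-comm; ++⁺ˡ; shift; ∈-resp-↭)
import Data.List.Relation.Binary.Permutation.Setoid.Properties as Permₛ
open import Relation.Nullary using (¬_; Dec; yes; no)
open import Relation.Nullary.Decidable using (¬?; _⊎-dec_)
open import Relation.Binary using (DecidableEquality)
open import Relation.Binary.PropositionalEquality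
  using (_≡_; _≢_; refl; sym; trans; cong; cong₂; subst; setoid; module ≡-Reasoning)
open import Relation.Binary.PropositionalEquality.WithK using (≡-irrelevant)
import Relation.Binary.Reasoning.Setoid as SetoidReasoning
open import Function.Base using (_∘_; id)
open import Function.Bundles using (_⇔_; mk⇔; module Equivalence)
open import Algebra.Bundles using (Group)
import Algebra.Properties.Group as GroupProperties

-- Walks, paths and circles

-- No relation is given between the groups of different minors, and none of them is ever mapped to
-- another. A minor only decides which pairs of lifts over two edges may replace each other in
-- balanced circles. This is a condition on lifts alone, so it can be compared between minors, and
-- with a group that is already fixed; that group is the one of a single minor of the initial
-- circle. To carry its multiplication past a new edge, two edges with known gains have to survive
-- in one minor together with the new edge and the last edge of the circle. Hence the initial circle
-- needs four edges, and `Q₀` is chosen with at least two. Two lifts of `Q₀` share their inner nodes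
-- and so form no theta graph with the ear; a lift of `Q₁` is the intermediary. Two kinds of circles
-- escape the ears: loops, whose fibres must first be matched with the group, and digons inside one
-- fibre, which do not project to circles of the base.

module _ {A : Set} where

  ∉⇒All≢ : ∀ {x : A} {xs} → x ∉ xs → All (x ≢_) xs
  ∉⇒All≢ = Allₚ.¬Any⇒All¬ _

  All≢⇒∉ : ∀ {x : A} {xs} → All (x ≢_) xs → x ∉ xs
  All≢⇒∉ px i = All.lookup px i refl

  unique-++⁻ : ∀ (xs : List A) {ys} → Unique (xs ++ ys) →
               Unique xs × Unique ys × Disjoint xs ys
  unique-++⁻ [] u = [] , u , λ ()
  unique-++⁻ (x ∷ xs) (px ∷ u) with unique-++⁻ xs u
  ... | ux , uy , d = (Allₚ.++⁻ˡ xs px ∷ ux) , uy ,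
    λ { (here refl) y → All≢⇒∉ (Allₚ.++⁻ʳ xs px) y ; (there i) y → d i y }

  unique-↭ : ∀ {xs ys : List A} → xs ↭ ys → Unique xs → Unique ys
  unique-↭ p = Permₛ.Unique-resp-↭ (setoid A) (↭⇒↭ₛ p)

module Walks {V E : Set} (g : Graph V E) where

  ed : ∀ {u v} → Walk g u v → List E
  ed = edges g

  vs : ∀ {u v} → Walk g u v → List V
  vs = allVerts g

  infixr 5 _⋯_
  _⋯_ : ∀ {u v w} → Walk g u v → Walk g v w → Walk g u w
  []         ⋯ X = X
  step e j W ⋯ X = step e j (W ⋯ X)

  rev : ∀ {u v} → Walk g u v → Walk g v u
  rev []           = []
  rev (step e j W) = rev W ⋯ step e (swap j) []

  ⋯-assoc : ∀ {u v w x} (W : Walk g u v) (X : Walk g v w) (Y : Walk g w x) →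
            (W ⋯ X) ⋯ Y ≡ W ⋯ (X ⋯ Y)
  ⋯-assoc []           X Y = refl
  ⋯-assoc (step e j W) X Y = cong (step e j) (⋯-assoc W X Y)

  ed-⋯ : ∀ {u v w} (W : Walk g u v) (X : Walk g v w) → ed (W ⋯ X) ≡ ed W ++ ed X
  ed-⋯ []           X = refl
  ed-⋯ (step e j W) X = cong (e ∷_) (ed-⋯ W X)

  vs-⋯ : ∀ {u v w} (W : Walk g u v) (X : Walk g v w) → vs (W ⋯ X) ≡ verts g W ++ vs X
  vs-⋯ []               X = refl
  vs-⋯ {u} (step e j W) X = cong (u ∷_) (vs-⋯ W X)

  ed-rev : ∀ {u v} (W : Walk g u v) → ed (rev W) ≡ reverse (ed W)
  ed-rev []           = refl
  ed-rev (step e j W) = trans (ed-⋯ (rev W) _)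
    (trans (cong (_++ [ e ]) (ed-rev W)) (sym (unfold-reverse e (ed W))))

  vs-rev : ∀ {u v} (W : Walk g u v) → vs (rev W) ≡ reverse (vs W)
  vs-rev []                   = refl
  vs-rev {u} (step {w = w} e j W) = begin
    vs (rev W ⋯ step e (swap j) [])         ≡⟨ vs-⋯ (rev W) _ ⟩
    verts g (rev W) ++ (w ∷ u ∷ [])         ≡⟨ ++-assoc (verts g (rev W)) [ w ] [ u ] ⟨
    vs (rev W) ++ [ u ]                     ≡⟨ cong (_++ [ u ]) (vs-rev W) ⟩
    reverse (vs W) ++ [ u ]                 ≡⟨ unfold-reverse u (vs W) ⟨
    reverse (u ∷ vs W)                      ∎
    where open ≡-Reasoning

  start∈ : ∀ {u v} (W : Walk g u v) → u ∈ vs W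
  start∈ []           = here refl
  start∈ (step e j W) = here refl

  end∈ : ∀ {u v} (W : Walk g u v) → v ∈ vs W
  end∈ W = ∈-++⁺ʳ (verts g W) (here refl)

  verts⊆vs : ∀ {u v x} (W : Walk g u v) → x ∈ verts g W → x ∈ vs W
  verts⊆vs W = ∈-++⁺ˡ

  vs⁻ : ∀ {u v x} (W : Walk g u v) → x ∈ vs W → x ∈ verts g W ⊎ x ≡ v
  vs⁻ W i with ∈-++⁻ (verts g W) i
  ... | inj₁ k           = inj₁ k
  ... | inj₂ (here refl) = inj₂ refl

  module _ {u v w : V} (W : Walk g u v) (X : Walk g v w) where

    ∈ed-⋯ˡ : ∀ {e} → e ∈ ed W → e ∈ ed (W ⋯ X)
    ∈ed-⋯ˡ i = subst (_ ∈_) (sym (ed-⋯ W X)) (∈-++⁺ˡ i)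

    ∈ed-⋯ʳ : ∀ {e} → e ∈ ed X → e ∈ ed (W ⋯ X)
    ∈ed-⋯ʳ i = subst (_ ∈_) (sym (ed-⋯ W X)) (∈-++⁺ʳ (ed W) i)

    ∈ed-⋯⁻ : ∀ {e} → e ∈ ed (W ⋯ X) → e ∈ ed W ⊎ e ∈ ed X
    ∈ed-⋯⁻ i = ∈-++⁻ (ed W) (subst (_ ∈_) (ed-⋯ W X) i)

    ∈vs-⋯ʳ : ∀ {x} → x ∈ vs X → x ∈ vs (W ⋯ X)
    ∈vs-⋯ʳ i = subst (_ ∈_) (sym (vs-⋯ W X)) (∈-++⁺ʳ (verts g W) i)

    ∈vs-⋯ˡ : ∀ {x} → x ∈ vs W → x ∈ vs (W ⋯ X)
    ∈vs-⋯ˡ i with vs⁻ W i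
    ... | inj₁ k    = subst (_ ∈_) (sym (vs-⋯ W X)) (∈-++⁺ˡ k)
    ... | inj₂ refl = ∈vs-⋯ʳ (start∈ X)

    ∈vs-⋯⁻ : ∀ {x} → x ∈ vs (W ⋯ X) → x ∈ vs W ⊎ x ∈ vs X
    ∈vs-⋯⁻ i with ∈-++⁻ (verts g W) (subst (_ ∈_) (vs-⋯ W X) i)
    ... | inj₁ k = inj₁ (verts⊆vs W k)
    ... | inj₂ k = inj₂ k

  ∈vs-rev : ∀ {u v x} (W : Walk g u v) → x ∈ vs (rev W) → x ∈ vs W
  ∈vs-rev W i = reverse⁻ (subst (_ ∈_) (vs-rev W) i)

  ∈ed-rev : ∀ {u v x} (W : Walk g u v) → x ∈ ed (rev W) → x ∈ ed W
  ∈ed-rev W i = reverse⁻ (subst (_ ∈_) (ed-rev W) i)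

  joins-unique : ∀ {e u w x y} → Joins g e u w → Joins g e x y →
                 (u ≡ x × w ≡ y) ⊎ (u ≡ y × w ≡ x)
  joins-unique (inj₁ p) (inj₁ q) with refl ← trans (sym p) q = inj₁ (refl , refl)
  joins-unique (inj₁ p) (inj₂ q) with refl ← trans (sym p) q = inj₂ (refl , refl)
  joins-unique (inj₂ p) (inj₁ q) with refl ← trans (sym p) q = inj₂ (refl , refl)
  joins-unique (inj₂ p) (inj₂ q) with refl ← trans (sym p) q = inj₁ (refl , refl)

  ends∈ : ∀ {u v e x y} (W : Walk g u v) → e ∈ ed W → Joins g e x y → x ∈ vs W × y ∈ vs W
  ends∈ (step e j W) (here refl) k with joins-unique j k
  ... | inj₁ (refl , refl) = here refl , there (start∈ W)
  ... | inj₂ (refl , refl) = there (start∈ W) , here refl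
  ends∈ (step e j W) (there i) k with ends∈ W i k
  ... | a , b = there a , there b

  path-⋯⁻ : ∀ {u v w} (W : Walk g u v) (X : Walk g v w) → IsPath g (W ⋯ X) →
            IsPath g W × IsPath g X × (∀ {x} → x ∈ vs W → x ∈ vs X → x ≡ v)
  path-⋯⁻ [] X p = ([] ∷ []) , p , λ { (here q) _ → q }
  path-⋯⁻ (step e j W) X (q ∷ p) with path-⋯⁻ W X p
  ... | pW , pX , d =
    (∉⇒All≢ (λ i → All≢⇒∉ q (∈vs-⋯ˡ W X i)) ∷ pW) , pX ,
    λ { (here refl) k → ⊥-elim (All≢⇒∉ q (∈vs-⋯ʳ W X k)) ; (there i) k → d i k }

  path-⋯⁺ : ∀ {u v w} (W : Walk g u v) (X : Walk g v w) → IsPath g W → IsPath g X →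
            (∀ {x} → x ∈ vs W → x ∈ vs X → x ≡ v) → IsPath g (W ⋯ X)
  path-⋯⁺ [] X pW pX d = pX
  path-⋯⁺ (step e j W) X (q ∷ pW) pX d =
    ∉⇒All≢ (λ i → new (∈vs-⋯⁻ W X i)) ∷ path-⋯⁺ W X pW pX (λ i → d (there i))
    where
    new : _ ∈ vs W ⊎ _ ∈ vs X → ⊥
    new (inj₁ i) = All≢⇒∉ q i
    new (inj₂ i) with refl ← d (here refl) i = All≢⇒∉ q (end∈ W)

  path-rev : ∀ {u v} (W : Walk g u v) → IsPath g W → IsPath g (rev W)
  path-rev W p = subst Unique (sym (vs-rev W)) (unique-↭ (↭-sym (↭-reverse (vs W))) p)

  MeetAtEnds : ∀ {u v} → Walk g u v → Walk g u v → Set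
  MeetAtEnds {u} {v} P Q = ∀ {x} → x ∈ vs P → x ∈ vs Q → x ≡ u ⊎ x ≡ v

  path-head∉ : ∀ {e u w v} {j : Joins g e u w} {W : Walk g w v} →
               IsPath g (step e j W) → e ∉ ed W
  path-head∉ {j = j} {W} (q ∷ p) i = All≢⇒∉ q (proj₁ (ends∈ W i j))

  path-step-≢ : ∀ {e u w v} {j : Joins g e u w} {W : Walk g w v} →
                IsPath g (step e j W) → u ≢ w
  path-step-≢ {W = W} (q ∷ p) refl = All≢⇒∉ q (start∈ W)

  path-edges : ∀ {u v} (W : Walk g u v) → IsPath g W → Unique (ed W)
  path-edges [] p = []
  path-edges (step e j W) (q ∷ p) =
    ∉⇒All≢ (path-head∉ {j = j} {W = W} (q ∷ p)) ∷ path-edges W p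

  path-∉verts : ∀ {u v} (W : Walk g u v) → IsPath g W → v ∉ verts g W
  path-∉verts W p i = proj₂ (proj₂ (unique-++⁻ (verts g W) p)) i (here refl)

  path-closed : ∀ {u} (W : Walk g u u) → IsPath g W → W ≡ []
  path-closed [] p = refl
  path-closed (step e j W) (q ∷ p) = ⊥-elim (All≢⇒∉ q (end∈ W))

  path-chord : ∀ {u v e} (W : Walk g u v) → IsPath g W → u ≢ v → e ∈ ed W → Joins g e u v →
               ed W ≡ [ e ]
  path-chord (step e j W) (q ∷ p) u≢v (here refl) k with joins-unique j k
  ... | inj₁ (_ , refl) rewrite path-closed W p = refl
  ... | inj₂ (refl , _) = ⊥-elim (u≢v refl)
  path-chord (step e j W) (q ∷ p) u≢v (there i) k =
    ⊥-elim (All≢⇒∉ q (proj₁ (ends∈ W i k)))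

  path-noLoop : ∀ {u v e s} (W : Walk g u v) → IsPath g W → e ∈ ed W → Joins g e s s → ⊥
  path-noLoop (step e j W) (q ∷ p) (here refl) k with joins-unique j k
  ... | inj₁ (refl , refl) = All≢⇒∉ q (start∈ W)
  ... | inj₂ (refl , refl) = All≢⇒∉ q (start∈ W)
  path-noLoop (step e j W) (q ∷ p) (there i) k = path-noLoop W p i k

  -- Both ends of a shared edge are common nodes, so the edge joins `u` and `v`; a path that
  -- contains such an edge has no room for another.
  sharedEdge : ∀ {u v h} (P Q : Walk g u v) → u ≢ v → IsPath g P → IsPath g Q → MeetAtEnds P Q →
               h ∈ ed P → h ∈ ed Q → ed P ≡ [ h ] × ed Q ≡ [ h ]
  sharedEdge {u} {v} {h} P Q u≢v p q meet i k
    with meet (proj₁ (ends∈ P i (inj₁ refl))) (proj₁ (ends∈ Q k (inj₁ refl)))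
       | meet (proj₂ (ends∈ P i (inj₁ refl))) (proj₂ (ends∈ Q k (inj₁ refl)))
  ... | inj₁ r | inj₂ s = path-chord P p u≢v i (inj₁ (cong₂ _,_ r s)) , path-chord Q q u≢v k (inj₁ (cong₂ _,_ r s))
  ... | inj₂ r | inj₁ s = path-chord P p u≢v i (inj₂ (cong₂ _,_ r s)) , path-chord Q q u≢v k (inj₂ (cong₂ _,_ r s))
  ... | inj₁ r | inj₁ s = ⊥-elim (path-noLoop P p i (inj₁ (cong₂ _,_ r s)))
  ... | inj₂ r | inj₂ s = ⊥-elim (path-noLoop P p i (inj₁ (cong₂ _,_ r s)))

  path-ed-disjoint : ∀ {u v w} (W : Walk g u v) (X : Walk g v w) → IsPath g (W ⋯ X) → Disjoint (ed W) (ed X)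
  path-ed-disjoint W X p = proj₂ (proj₂ (unique-++⁻ (ed W) (subst Unique (ed-⋯ W X) (path-edges (W ⋯ X) p))))

  edgeFrom : ∀ {u v e} (W : Walk g u v) → e ∈ ed W → Σ V λ s → Σ V λ t → s ∈ verts g W × Joins g e s t
  edgeFrom (step e j W) (here refl) = _ , _ , here refl , j
  edgeFrom (step e j W) (there i) with edgeFrom W i
  ... | s , t , k , l = s , t , there k , l

  nonempty-length : ∀ {u v} (W : Walk g u v) → u ≢ v → 1 ≤ length (ed W)
  nonempty-length []           u≢v = ⊥-elim (u≢v refl)
  nonempty-length (step e j W) u≢v = s≤s z≤n

  length-⋯ : ∀ {u v w i k} (W : Walk g u v) (X : Walk g v w) → i ≤ length (ed W) → k ≤ length (ed X) →
             i + k ≤ length (ed (W ⋯ X))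
  length-⋯ W X a b = subst (_ ≤_) (sym (trans (cong length (ed-⋯ W X)) (length-++ (ed W)))) (+-mono-≤ a b)

  split : ∀ {u v x} (W : Walk g u v) → x ∈ vs W →
          Σ (Walk g u x) λ A → Σ (Walk g x v) λ B → W ≡ A ⋯ B
  split [] (here refl) = [] , [] , refl
  split (step e j W) (here refl) = [] , step e j W , refl
  split (step e j W) (there i) with split W i
  ... | A , B , q = step e j A , B , cong (step e j) q

  record SplitEdge {u v : V} (W : Walk g u v) (e : E) : Set where
    field
      {s t}  : V
      before : Walk g u s
      joins  : Joins g e s t
      after  : Walk g t v
      whole  : W ≡ before ⋯ step e joins after

  splitEdge : ∀ {u v e} (W : Walk g u v) → e ∈ ed W → SplitEdge W e
  splitEdge (step e j W) (here refl) = record { before = [] ; joins = j ; after = W ; whole = refl }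
  splitEdge (step e j W) (there i) = record
    { before = step e j (S.before) ; joins = S.joins ; after = S.after
    ; whole = cong (step e j) S.whole }
    where module S = SplitEdge (splitEdge W i)

  splitList : ∀ {u v} (W : Walk g u v) (xs : List E) {ys : List E} → ed W ≡ xs ++ ys →
              Σ V λ x → Σ (Walk g u x) λ A → Σ (Walk g x v) λ B →
              W ≡ A ⋯ B × ed A ≡ xs × ed B ≡ ys
  splitList W [] q = _ , [] , W , refl , refl , q
  splitList (step e j W) (x ∷ xs) q with ∷-injective q
  ... | refl , q′ with splitList W xs q′
  ... | _ , A , B , r , s , t = _ , step e j A , B , cong (step e j) r , cong (e ∷_) s , t

  firstHit : ∀ {P : V → Set} → (∀ x → Dec (P x)) → ∀ {u v} (W : Walk g u v) → P v →
             Σ V λ z → Σ (Walk g u z) λ A → Σ (Walk g z v) λ B →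
             W ≡ A ⋯ B × P z × (∀ {x} → x ∈ verts g A → ¬ P x)
  firstHit P? [] pv = _ , [] , [] , refl , pv , λ ()
  firstHit P? {u} (step e j W) pv with P? u
  ... | yes pu = _ , [] , step e j W , refl , pu , λ ()
  ... | no ¬pu with firstHit P? W pv
  ... | z , A , B , q , pz , d = z , step e j A , B , cong (step e j) q , pz ,
    λ { (here refl) → ¬pu ; (there i) → d i }

  module _ (_≟_ : DecidableEquality V) where
    open import Data.List.Membership.DecPropositional _≟_ using (_∈?_)

    toPath : ∀ {u v} (W : Walk g u v) → Σ (Walk g u v) λ P → IsPath g P ×
             (∀ {e} → e ∈ ed P → e ∈ ed W) × (∀ {x} → x ∈ vs P → x ∈ vs W)
    toPath [] = [] , ([] ∷ []) , id , id
    toPath {u} (step e j W) with toPath W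
    ... | P , p , s , t with u ∈? vs P
    ... | no u∉ = step e j P , (∉⇒All≢ u∉ ∷ p) ,
          (λ { (here q) → here q ; (there i) → there (s i) }) ,
          (λ { (here q) → here q ; (there i) → there (t i) })
    ... | yes u∈ with split P u∈
    ... | A , B , refl = B , proj₁ (proj₂ (path-⋯⁻ A B p)) ,
          (λ i → there (s (∈ed-⋯ʳ A B i))) , (λ i → there (t (∈vs-⋯ʳ A B i)))

  -- A circle is taken apart into its first step and the path that leads back.
  record IsCirc {u w : V} (f : E) (j : Joins g f u w) (Q : Walk g w u) : Set where
    constructor isCirc
    field
      path : IsPath g Q
      new  : f ∉ ed Q

  circle : ∀ {u w f} {j : Joins g f u w} {Q : Walk g w u} → IsCirc f j Q → Circle g
  circle {u} {w} {f} {j} {Q} (isCirc p n) = record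
    { base = u ; walk = step f j Q ; nonempty = s≤s z≤n
    ; uniqV = unique-↭ (↭-sym (∷↭∷ʳ u (verts g Q))) p
    ; uniqE = ∉⇒All≢ n ∷ path-edges Q p }

  uncircle : ∀ {u w f} {j : Joins g f u w} {Q : Walk g w u} →
             Unique (verts g (step f j Q)) → Unique (ed (step f j Q)) → IsCirc f j Q
  uncircle {u} {Q = Q} uv (q ∷ _) = isCirc (unique-↭ (∷↭∷ʳ u (verts g Q)) uv) (All≢⇒∉ q)

  rotate : ∀ {u w f s t f′} {j : Joins g f u w} {A : Walk g w s} {j′ : Joins g f′ s t}
           {B : Walk g t u} → IsCirc f j (A ⋯ step f′ j′ B) → IsCirc f′ j′ (B ⋯ step f j A)
  rotate {u} {f = f} {f′ = f′} {j} {A} {j′} {B} (isCirc p n) with path-⋯⁻ A (step f′ j′ B) p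
  ... | pA , (q ∷ pB) , d = isCirc
    (path-⋯⁺ B (step f j A) pB (∉⇒All≢ (λ i → AB i (end∈ B)) ∷ pA)
      (λ { i (here r) → r ; i (there k) → ⊥-elim (AB k i) }))
    (λ i → new′ (∈ed-⋯⁻ B (step f j A) i))
    where
    AB : ∀ {x} → x ∈ vs A → x ∈ vs B → ⊥
    AB a b with refl ← d a (there b) = All≢⇒∉ q b
    uE = unique-++⁻ (ed A) (subst Unique (ed-⋯ A (step f′ j′ B)) (path-edges _ p))
    new′ : f′ ∈ ed B ⊎ f′ ∈ f ∷ ed A → ⊥
    new′ (inj₁ i) = path-head∉ {j = j′} {W = B} (q ∷ pB) i
    new′ (inj₂ (here refl)) = n (∈ed-⋯ʳ A (step f′ j′ B) (here refl))
    new′ (inj₂ (there i)) = proj₂ (proj₂ uE) i (here refl)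

  reverseCirc : ∀ {u w f} {j : Joins g f u w} {Q : Walk g w u} → IsCirc f j Q →
                IsCirc f (swap j) (rev Q)
  reverseCirc {Q = Q} (isCirc p n) = isCirc (path-rev Q p) (n ∘ ∈ed-rev Q)

  -- Nodes and orientations are hidden because balance is a predicate on edge lists; a circle can
  -- then be rotated by rotating a list.
  record CircList (fs : List E) : Set where
    constructor circList
    field
      {u w}  : V
      {f}    : E
      {j}    : Joins g f u w
      {Q}    : Walk g w u
      circ   : IsCirc f j Q
      edges≡ : f ∷ ed Q ≡ fs

  circList-unique : ∀ {fs} → CircList fs → Unique fs
  circList-unique (circList c refl) = Circle.uniqE (circle c)

  circList-rotate : ∀ fs {hs} → CircList (fs ++ hs) → CircList (hs ++ fs)
  circList-rotate [] {hs} c = subst CircList (sym (++-identityʳ hs)) c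
  circList-rotate (f ∷ fs) {[]} c = subst CircList (cong (f ∷_) (++-identityʳ fs)) c
  circList-rotate (f ∷ fs) {h ∷ hs} (circList {f = f₁} {j = j} {Q} c q) with ∷-injective q
  ... | refl , q′ with splitList Q fs q′
  ... | _ , A , step h₁ k B , refl , refl , r with ∷-injective r
  ... | refl , refl = circList (rotate {A = A} {j′ = k} {B = B} c) (cong (h₁ ∷_) (ed-⋯ B (step f₁ j A)))

-- Lifts and gains

module _ {A B : Set} (p : A → B) where

  map-split : ∀ (xs : List A) as {bs} → map p xs ≡ as ++ bs →
              Σ (List A) λ ys → Σ (List A) λ zs → xs ≡ ys ++ zs × map p ys ≡ as × map p zs ≡ bs
  map-split xs [] q = [] , xs , refl , refl , q
  map-split (x ∷ xs) (a ∷ as) q with ∷-injective q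
  ... | refl , q′ with map-split xs as q′
  ... | ys , zs , refl , r , s = x ∷ ys , zs , refl , cong (p x ∷_) r , s

  map-++-≡ : ∀ {xs ys as bs} → map p xs ≡ as → map p ys ≡ bs → map p (xs ++ ys) ≡ as ++ bs
  map-++-≡ {xs} {ys} refl refl = map-++ p xs ys

  map-reverse-≡ : ∀ {xs as} → map p xs ≡ as → map p (reverse xs) ≡ reverse as
  map-reverse-≡ {xs} refl = reverse-map p xs

  map-∈ : ∀ {xs as x} → map p xs ≡ as → x ∈ xs → p x ∈ as
  map-∈ refl i = ∈-map⁺ p i

module Expansion {V F E : Set} {Δ : Graph V F} {p : E → F} {B : List E → Set}
                 (be : IsBiasedExpansion Δ p B) where
  open Walks Δ public
  open IsBiasedExpansion be
  open IsBiased biased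
  private
    Ω = liftG Δ p
    module W = Walks Ω

  τ₀ : F → E
  τ₀ f = proj₁ (surj f)

  map-τ₀ : ∀ fs → map p (map τ₀ fs) ≡ fs
  map-τ₀ []       = refl
  map-τ₀ (f ∷ fs) = cong₂ _∷_ (proj₂ (surj f)) (map-τ₀ fs)

  -- Lifts are handled as lists over the edges of a walk of `Δ`. A walk of `Ω` is rebuilt only where
  -- the axioms speak of circles or paths of `Ω`.
  lw : ∀ {u v} (W : Walk Δ u v) (xs : List E) → map p xs ≡ ed W → Walk Ω u v
  lw []           []       q = []
  lw (step f j W) (x ∷ xs) q =
    step x (subst (λ f → Joins Δ f _ _) (sym (proj₁ (∷-injective q))) j) (lw W xs (proj₂ (∷-injective q)))

  lw-ed : ∀ {u v} (W : Walk Δ u v) xs q → edges Ω (lw W xs q) ≡ xs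
  lw-ed []           []       q = refl
  lw-ed (step f j W) (x ∷ xs) q = cong (x ∷_) (lw-ed W xs _)

  lw-verts : ∀ {u v} (W : Walk Δ u v) xs q → verts Ω (lw W xs q) ≡ verts Δ W
  lw-verts []               []       q = refl
  lw-verts {u} (step f j W) (x ∷ xs) q = cong (u ∷_) (lw-verts W xs _)

  lw-path : ∀ {u v} (W : Walk Δ u v) xs q → IsPath Δ W → IsPath Ω (lw W xs q)
  lw-path {v = v} W xs q = subst (λ l → Unique (l ∷ʳ v)) (sym (lw-verts W xs q))

  liftCircle : ∀ {fs xs} → CircList fs → map p xs ≡ fs → Σ (Circle Ω) λ C → circEdges Ω C ≡ xs
  liftCircle {xs = x ∷ xs} (circList {f = f} {j} {Q} c refl) q =
    W.circle {j = j′} {Q = lw Q xs q₂} (W.isCirc (lw-path Q xs q₂ (IsCirc.path c)) new) , cong (x ∷_) (lw-ed Q xs q₂)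
    where
    q₁ = proj₁ (∷-injective q)
    q₂ = proj₂ (∷-injective q)
    j′ : Joins Ω x _ _
    j′ = subst (λ f → Joins Δ f _ _) (sym q₁) j
    new : x ∉ edges Ω (lw Q xs q₂)
    new i = IsCirc.new c (subst (_∈ ed Q) q₁ (map-∈ p q₂ (subst (x ∈_) (lw-ed Q xs q₂) i)))

  -- `B` is arbitrary on lists that are not circles, so both orders have to be certified before
  -- invariance applies.
  B-perm : ∀ {fs hs xs ys} → CircList fs → CircList hs → map p xs ≡ fs → map p ys ≡ hs →
           xs ↭ ys → B xs → B ys
  B-perm c d q r π b with liftCircle c q | liftCircle d r
  ... | C , refl | D , refl = invariant C D π b

  B-rotate : ∀ {fs hs xs ys} → CircList (fs ++ hs) → map p xs ≡ fs → map p ys ≡ hs →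
             B (xs ++ ys) → B (ys ++ xs)
  B-rotate {fs} {xs = xs} {ys} c q r =
    B-perm c (circList-rotate fs c) (map-++-≡ p q r) (map-++-≡ p r q) (++-comm xs ys)

  solveLast : ∀ {fs f ls} → CircList (fs ∷ʳ f) → map p ls ≡ fs →
              Σ E λ x → (p x ≡ f × B (ls ∷ʳ x)) × (∀ y → p y ≡ f → B (ls ∷ʳ y) → y ≡ x)
  solveLast {fs} {f} {ls} (circList c q) r = lifting (circle c) fs f q ls r

  solveFirst : ∀ {fs f ls} → CircList (f ∷ fs) → map p ls ≡ fs →
               Σ E λ x → (p x ≡ f × B (x ∷ ls)) × (∀ y → p y ≡ f → B (y ∷ ls) → y ≡ x)
  solveFirst {fs} {f} {ls} c r with solveLast (circList-rotate [ f ] c) r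
  ... | x , (px , b) , u = x , (px , B-rotate (circList-rotate [ f ] c) r (cong [_] px) b) ,
    λ y py b′ → u y py (B-rotate c (cong [_] py) r b′)

  inner⁻ : ∀ {u v x} (P : Walk Δ u v) → IsPath Δ P → x ∈ inner Δ P → x ∈ vs P × x ≢ u × x ≢ v
  inner⁻ (step f j P) (q ∷ pth) i = there (verts⊆vs P i) ,
    (λ { refl → All≢⇒∉ q (verts⊆vs P i) }) , (λ { refl → path-∉verts P pth i })

  theta-lifts : ∀ {u v} → u ≢ v → (P₁ P₂ P₃ : Walk Δ u v) →
    IsPath Δ P₁ → IsPath Δ P₂ → IsPath Δ P₃ →
    MeetAtEnds P₁ P₂ → MeetAtEnds P₁ P₃ → MeetAtEnds P₂ P₃ →
    Disjoint (ed P₁) (ed P₂) → Disjoint (ed P₁) (ed P₃) → Disjoint (ed P₂) (ed P₃) →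
    ∀ {xs ys zs} → map p xs ≡ ed P₁ → map p ys ≡ ed P₂ → map p zs ≡ ed P₃ →
    B (xs ++ reverse ys) → B (xs ++ reverse zs) → B (ys ++ reverse zs)
  theta-lifts {u} {v} u≢v P₁ P₂ P₃ p₁ p₂ p₃ m₁₂ m₁₃ m₂₃ d₁₂ d₁₃ d₂₃ {xs} {ys} {zs} q₁ q₂ q₃ b₁₂ b₁₃ =
    subst₂ (lw-ed P₂ ys q₂) (lw-ed P₃ zs q₃)
      (theta u≢v (lw P₁ xs q₁) (lw P₂ ys q₂) (lw P₃ zs q₃)
        (lw-path P₁ xs q₁ p₁) (lw-path P₂ ys q₂ p₂) (lw-path P₃ zs q₃ p₃)
        (inn q₁ q₂ p₁ p₂ m₁₂) (inn q₁ q₃ p₁ p₃ m₁₃) (inn q₂ q₃ p₂ p₃ m₂₃)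
        (edg q₁ q₂ d₁₂) (edg q₁ q₃ d₁₃) (edg q₂ q₃ d₂₃)
        (subst₂ (sym (lw-ed P₁ xs q₁)) (sym (lw-ed P₂ ys q₂)) b₁₂)
        (subst₂ (sym (lw-ed P₁ xs q₁)) (sym (lw-ed P₃ zs q₃)) b₁₃))
    where
    subst₂ : ∀ {as bs cs ds} → as ≡ bs → cs ≡ ds → B (as ++ reverse cs) → B (bs ++ reverse ds)
    subst₂ refl refl b = b
    inn : ∀ {P Q : Walk Δ u v} {as bs} (q : map p as ≡ ed P) (r : map p bs ≡ ed Q) →
          IsPath Δ P → IsPath Δ Q → MeetAtEnds P Q →
          Disjoint (inner Ω (lw P as q)) (inner Ω (lw Q bs r))
    inn {P} {Q} {as} {bs} q r pP pQ meet i k with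
      inner⁻ P pP (subst (λ l → _ ∈ drop 1 l) (lw-verts P as q) i) |
      inner⁻ Q pQ (subst (λ l → _ ∈ drop 1 l) (lw-verts Q bs r) k)
    ... | iP , ≢u , ≢v | iQ , _ with meet iP iQ
    ... | inj₁ e = ≢u e
    ... | inj₂ e = ≢v e
    edg : ∀ {P Q : Walk Δ u v} {as bs} (q : map p as ≡ ed P) (r : map p bs ≡ ed Q) →
          Disjoint (ed P) (ed Q) → Disjoint (edges Ω (lw P as q)) (edges Ω (lw Q bs r))
    edg {P} {Q} {as} {bs} q r d i k =
      d (map-∈ p q (subst (_ ∈_) (lw-ed P as q) i)) (map-∈ p r (subst (_ ∈_) (lw-ed Q bs r) k))

  sign : ∀ {f u w} → Joins Δ f u w → Bool
  sign (inj₁ _) = true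
  sign (inj₂ _) = false

  sign-swap : ∀ {f u w} (j : Joins Δ f u w) → sign (swap j) ≡ not (sign j)
  sign-swap (inj₁ _) = refl
  sign-swap (inj₂ _) = refl

  -- One sign per edge instead of one per step. If no edge repeats, such signs exist, and an
  -- oriented gain becomes a plain product over the list of lifts (`gL-prod`).
  SignedBy : (F → Bool) → ∀ {u v} → Walk Δ u v → Set
  SignedBy s []           = ⊤
  SignedBy s (step f j W) = s f ≡ sign j × SignedBy s W

  SignedBy-⋯⁻ : ∀ {s u v w} (W : Walk Δ u v) {X : Walk Δ v w} → SignedBy s (W ⋯ X) →
                SignedBy s W × SignedBy s X
  SignedBy-⋯⁻ []           b       = tt , b
  SignedBy-⋯⁻ (step f j W) (b , s) with SignedBy-⋯⁻ W s
  ... | c , d = (b , c) , d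

  SignedBy-cong : ∀ {s s′ u v} (W : Walk Δ u v) → (∀ {f} → f ∈ ed W → s′ f ≡ s f) →
                  SignedBy s W → SignedBy s′ W
  SignedBy-cong []           q _       = tt
  SignedBy-cong (step f j W) q (b , s) = trans (q (here refl)) b , SignedBy-cong W (q ∘ there) s

  module _ (_≟_ : DecidableEquality F) where

    signs : ∀ {u v} → Walk Δ u v → F → Bool
    signs []           h = true
    signs (step f j W) h with f ≟ h
    ... | yes _ = sign j
    ... | no  _ = signs W h

    signs-signed : ∀ {u v} (W : Walk Δ u v) → Unique (ed W) → SignedBy (signs W) W
    signs-signed []           u       = tt
    signs-signed (step f j W) (a ∷ u) = first , SignedBy-cong W rest (signs-signed W u)
      where
      first : signs (step f j W) f ≡ sign j
      first with f ≟ f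
      ... | yes _ = refl
      ... | no ¬q = ⊥-elim (¬q refl)
      rest : ∀ {h} → h ∈ ed W → signs (step f j W) h ≡ signs W h
      rest {h} i with f ≟ h
      ... | yes refl = ⊥-elim (All≢⇒∉ a i)
      ... | no _     = refl

  proj : ∀ {u v} → Walk Ω u v → Walk Δ u v
  proj []           = []
  proj (step e j W) = step (p e) j (proj W)

  proj-ed : ∀ {u v} (W : Walk Ω u v) → map p (edges Ω W) ≡ ed (proj W)
  proj-ed []           = refl
  proj-ed (step e j W) = cong (p e ∷_) (proj-ed W)

  proj-verts : ∀ {u v} (W : Walk Ω u v) → verts Δ (proj W) ≡ verts Ω W
  proj-verts []               = refl
  proj-verts {u} (step e j W) = cong (u ∷_) (proj-verts W)

  module Gain (G : Group 0ℓ 0ℓ) where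
    open Group G public
      renaming (refl to ≈-refl; sym to ≈-sym; trans to ≈-trans; reflexive to ≈-reflexive; setoid to ≈-setoid)
    open GroupProperties G public using (⁻¹-involutive; ⁻¹-anti-homo-∙; ∙-cancelˡ; ∙-cancelʳ; ε⁻¹≈ε; inverseʳ-unique; inverseˡ-unique; ⁻¹-injective)

    act : Bool → Carrier → Carrier
    act true  x = x
    act false x = x ⁻¹

    act-cong : ∀ b {x y} → x ≈ y → act b x ≈ act b y
    act-cong true  q = q
    act-cong false q = ⁻¹-cong q

    act-injective : ∀ b {x y} → act b x ≈ act b y → x ≈ y
    act-injective true  q = q
    act-injective false q = ⁻¹-injective q

    act-involutive : ∀ b x → act b (act b x) ≈ x
    act-involutive true  x = ≈-refl
    act-involutive false x = ⁻¹-involutive x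

    act-not : ∀ b x → act (not b) x ≈ act b x ⁻¹
    act-not true  x = ≈-refl
    act-not false x = ≈-sym (⁻¹-involutive x)

    ε-rotate : ∀ {x y} → x ∙ y ≈ ε → y ∙ x ≈ ε
    ε-rotate {x} {y} q = ≈-trans (∙-congʳ (inverseʳ-unique x y q)) (inverseˡ x)

    -- The gain of the lift of a walk of Δ to the given edges (a junk value if there are too few of them).
    gL : (E → Carrier) → ∀ {u v} → Walk Δ u v → List E → Carrier
    gL φ []           xs       = ε
    gL φ (step f j W) []       = ε
    gL φ (step f j W) (x ∷ xs) = act (sign j) (φ x) ∙ gL φ W xs

    prod : (E → Carrier) → List E → Carrier
    prod γ []       = ε
    prod γ (x ∷ xs) = γ x ∙ prod γ xs

    prod-++ : ∀ γ xs ys → prod γ (xs ++ ys) ≈ prod γ xs ∙ prod γ ys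
    prod-++ γ []       ys = ≈-sym (identityˡ _)
    prod-++ γ (x ∷ xs) ys = ≈-trans (∙-congˡ (prod-++ γ xs ys)) (≈-sym (assoc _ _ _))

    prod-cong : ∀ {γ δ} xs → (∀ {x} → x ∈ xs → γ x ≈ δ x) → prod γ xs ≈ prod δ xs
    prod-cong []       q = ≈-refl
    prod-cong (x ∷ xs) q = ∙-cong (q (here refl)) (prod-cong xs (q ∘ there))

    gL-cong : ∀ {φ ψ u v} (W : Walk Δ u v) xs → (∀ {x} → x ∈ xs → φ x ≈ ψ x) → gL φ W xs ≈ gL ψ W xs
    gL-cong []           xs       q = ≈-refl
    gL-cong (step f j W) []       q = ≈-refl
    gL-cong (step f j W) (x ∷ xs) q = ∙-cong (act-cong (sign j) (q (here refl))) (gL-cong W xs (q ∘ there))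

    Onto Inj : (E → Carrier) → F → Set
    Onto φ f = ∀ g → Σ E λ x → p x ≡ f × φ x ≈ g
    Inj  φ f = ∀ {x y} → p x ≡ f → p y ≡ f → φ x ≈ φ y → x ≡ y

    Bij : (E → Carrier) → F → Set
    Bij φ f = Inj φ f × Onto φ f

    Bij-act : ∀ {φ f} b → Bij φ f → Bij (act b ∘ φ) f
    Bij-act b (i , o) = (λ q r s → i q r (act-injective b s)) ,
      λ g → proj₁ (o (act b g)) , proj₁ (proj₂ (o (act b g))) ,
        ≈-trans (act-cong b (proj₂ (proj₂ (o (act b g))))) (act-involutive b g)

    Bij-cong : ∀ {φ ψ f} → (∀ {x} → p x ≡ f → φ x ≈ ψ x) → Bij φ f → Bij ψ f
    Bij-cong q (i , o) = (λ r s t → i r s (≈-trans (q r) (≈-trans t (≈-sym (q s))))) ,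
      λ g → let (x , r , s) = o g in x , r , ≈-trans (≈-sym (q r)) s

    module _ (φ : E → Carrier) where

      gL-⋯ : ∀ {u v w} (W : Walk Δ u v) (X : Walk Δ v w) {xs ys} → map p xs ≡ ed W →
             gL φ (W ⋯ X) (xs ++ ys) ≈ gL φ W xs ∙ gL φ X ys
      gL-⋯ []           X {[]}     q = ≈-sym (identityˡ _)
      gL-⋯ (step f j W) X {x ∷ xs} q =
        ≈-trans (∙-congˡ (gL-⋯ W X (proj₂ (∷-injective q)))) (≈-sym (assoc _ _ _))

      gL-rev : ∀ {u v} (W : Walk Δ u v) {xs} → map p xs ≡ ed W →
               gL φ (rev W) (reverse xs) ≈ gL φ W xs ⁻¹
      gL-rev []           {[]}     q = ≈-sym ε⁻¹≈ε
      gL-rev (step f j W) {x ∷ xs} q = begin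
        gL φ (rev W ⋯ S) (reverse (x ∷ xs))         ≡⟨ cong (gL φ (rev W ⋯ S)) (unfold-reverse x xs) ⟩
        gL φ (rev W ⋯ S) (reverse xs ++ [ x ])      ≈⟨ gL-⋯ (rev W) S (trans (map-reverse-≡ p q′) (sym (ed-rev W))) ⟩
        gL φ (rev W) (reverse xs) ∙ gL φ S [ x ]    ≈⟨ ∙-cong (gL-rev W q′) (identityʳ _) ⟩
        gL φ W xs ⁻¹ ∙ act (sign (swap j)) (φ x)    ≡⟨ cong (λ b → gL φ W xs ⁻¹ ∙ act b (φ x)) (sign-swap j) ⟩
        gL φ W xs ⁻¹ ∙ act (not (sign j)) (φ x)     ≈⟨ ∙-congˡ (act-not (sign j) (φ x)) ⟩
        gL φ W xs ⁻¹ ∙ act (sign j) (φ x) ⁻¹        ≈⟨ ⁻¹-anti-homo-∙ _ _ ⟨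
        (act (sign j) (φ x) ∙ gL φ W xs) ⁻¹         ∎
        where
        open SetoidReasoning ≈-setoid
        q′ = proj₂ (∷-injective q)
        S = step f (swap j) []

      gL-proj : ∀ {u v} (W : Walk Ω u v) → gain Ω G φ W ≡ gL φ (proj W) (edges Ω W)
      gL-proj []                  = refl
      gL-proj (step e (inj₁ _) W) = cong (φ e ∙_) (gL-proj W)
      gL-proj (step e (inj₂ _) W) = cong (φ e ⁻¹ ∙_) (gL-proj W)

      -- Every step but the first gets an arbitrary lift, and the first one corrects the total; a
      -- nonempty walk is therefore required.
      liftOfGain : ∀ {u v} (W : Walk Δ u v) → u ≢ v → (∀ {f} → f ∈ ed W → Onto φ f) →
                   ∀ h → Σ (List E) λ xs → map p xs ≡ ed W × gL φ W xs ≈ h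
      liftOfGain []           u≢v o h = ⊥-elim (u≢v refl)
      liftOfGain (step f j W) u≢v o h with o (here refl) (act (sign j) (h ∙ t ⁻¹))
        where t = gL φ W (map τ₀ (ed W))
      ... | x , q , r = x ∷ map τ₀ (ed W) , cong₂ _∷_ q (map-τ₀ (ed W)) , (begin
        act (sign j) (φ x) ∙ t                        ≈⟨ ∙-congʳ (act-cong (sign j) r) ⟩
        act (sign j) (act (sign j) (h ∙ t ⁻¹)) ∙ t    ≈⟨ ∙-congʳ (act-involutive (sign j) _) ⟩
        (h ∙ t ⁻¹) ∙ t                                ≈⟨ assoc _ _ _ ⟩
        h ∙ (t ⁻¹ ∙ t)                                ≈⟨ ∙-congˡ (inverseˡ t) ⟩
        h ∙ ε                                         ≈⟨ identityʳ h ⟩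
        h                                             ∎)
        where
        open SetoidReasoning ≈-setoid
        t = gL φ W (map τ₀ (ed W))

    gL-prod : ∀ {s φ u v} (W : Walk Δ u v) {xs} → SignedBy s W → map p xs ≡ ed W →
              gL φ W xs ≈ prod (λ x → act (s (p x)) (φ x)) xs
    gL-prod []           {[]}     _       q = ≈-refl
    gL-prod (step f j W) {x ∷ xs} (b , s) q with ∷-injective q
    ... | refl , q′ = ∙-cong (≈-reflexive (cong (λ b → act b _) (sym b))) (gL-prod W s q′)

-- Minors of order four

-- Contracted classes arise as the fibres of a map to representatives, but a minor must number its
-- nodes by some `Fin k`: `c` is `r` followed by a numbering of its image.
record Factorization {n : ℕ} {A : Set} (r : Fin n → A) : Set where
  field
    k      : ℕ
    c      : Fin n → Fin k
    onto   : ∀ i → ∃ λ u → c u ≡ i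
    sound  : ∀ u v → c u ≡ c v → r u ≡ r v
    complete : ∀ u v → r u ≡ r v → c u ≡ c v

factorize : ∀ {n} {A : Set} → DecidableEquality A → (r : Fin n → A) → Factorization r
factorize {zero} _≟A_ r = record { k = 0 ; c = λ () ; onto = λ () ; sound = λ () ; complete = λ () }
factorize {suc n} {A} _≟A_ r = extend (any? (λ i → r zero ≟A r (suc i)))
  where
  open Factorization (factorize _≟A_ (r ∘ suc))
  extend : Dec (∃ λ i → r zero ≡ r (suc i)) → Factorization r
  extend (yes (i , q)) = record
    { k = k ; c = c′
    ; onto = λ l → suc (proj₁ (onto l)) , proj₂ (onto l)
    ; sound = λ { zero zero s → refl
                ; zero (suc v) s → trans q (sound i v s)
                ; (suc u) zero s → trans (sound u i s) (sym q)
                ; (suc u) (suc v) s → sound u v s }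
    ; complete = λ { zero zero s → refl
                   ; zero (suc v) s → complete i v (trans (sym q) s)
                   ; (suc u) zero s → complete u i (trans s q)
                   ; (suc u) (suc v) s → complete u v s } }
    where
    c′ : Fin (suc n) → Fin k
    c′ zero    = c i
    c′ (suc j) = c j
  extend (no ¬q) = record
    { k = suc k ; c = c′
    ; onto = λ { zero → zero , refl ; (suc l) → suc (proj₁ (onto l)) , cong suc (proj₂ (onto l)) }
    ; sound = λ { zero zero s → refl
                ; (suc u) (suc v) s → sound u v (suc-inj s) }
    ; complete = λ { zero zero s → refl
                   ; zero (suc v) s → ⊥-elim (¬q (v , s))
                   ; (suc u) zero s → ⊥-elim (¬q (u , sym s))
                   ; (suc u) (suc v) s → cong suc (complete u v s) } }
    where
    c′ : Fin (suc n) → Fin (suc k)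
    c′ zero    = zero
    c′ (suc j) = suc (c j)
    suc-inj : ∀ {i j : Fin k} → Fin.suc i ≡ suc j → i ≡ j
    suc-inj refl = refl

fromList : ∀ {n} → List (Fin n) → Subset n
fromList []       = ∅
fromList (x ∷ xs) = ⁅ x ⁆ ∪ fromList xs

∈-fromList⁺ : ∀ {n} {x : Fin n} xs → x ∈ xs → x ∈ₛ fromList xs
∈-fromList⁺ (x ∷ xs) (here refl) = x∈p∪q⁺ (inj₁ (x∈⁅x⁆ x))
∈-fromList⁺ (x ∷ xs) (there i)   = x∈p∪q⁺ (inj₂ (∈-fromList⁺ xs i))

∈-fromList⁻ : ∀ {n} {x : Fin n} xs → x ∈ₛ fromList xs → x ∈ xs
∈-fromList⁻ []       i = ⊥-elim (∉⊥ i)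
∈-fromList⁻ (y ∷ xs) i with x∈p∪q⁻ ⁅ y ⁆ (fromList xs) i
... | inj₁ k = here (x∈⁅y⁆⇒x≡y y k)
... | inj₂ k = there (∈-fromList⁻ xs k)

∣⁅x⁆∪p∣ : ∀ {n} (x : Fin n) (q : Subset n) → x ∉ₛ q → ∣ ⁅ x ⁆ ∪ q ∣ ≡ suc ∣ q ∣
∣⁅x⁆∪p∣ zero    (true  Vec.∷ q) x∉ = ⊥-elim (x∉ Vec.here)
∣⁅x⁆∪p∣ zero    (false Vec.∷ q) x∉ = cong suc (cong ∣_∣ (∪-identityˡ q))
∣⁅x⁆∪p∣ (suc x) (true  Vec.∷ q) x∉ = cong suc (∣⁅x⁆∪p∣ x q (x∉ ∘ Vec.there))
∣⁅x⁆∪p∣ (suc x) (false Vec.∷ q) x∉ = ∣⁅x⁆∪p∣ x q (x∉ ∘ Vec.there)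

∣fromList∣ : ∀ {n} {xs : List (Fin n)} → Unique xs → ∣ fromList xs ∣ ≡ length xs
∣fromList∣ {n} [] = ∣⊥∣≡0 n
∣fromList∣ {xs = x ∷ xs} (q ∷ u) =
  trans (∣⁅x⁆∪p∣ x (fromList xs) (λ i → All≢⇒∉ q (∈-fromList⁻ xs i))) (cong suc (∣fromList∣ u))

unique-map-injective : ∀ {A B : Set} {f : A → B} {xs : List A} → Unique (map f xs) →
                       ∀ {x y} → x ∈ xs → y ∈ xs → f x ≡ f y → x ≡ y
unique-map-injective (q ∷ u) (here refl) (here refl) r = refl
unique-map-injective {f = f} {_ ∷ xs} (q ∷ u) (here refl) (there k)   r = ⊥-elim (All≢⇒∉ q (subst (_∈ map f xs) (sym r) (∈-map⁺ f k)))
unique-map-injective {f = f} {_ ∷ xs} (q ∷ u) (there i)   (here refl) r = ⊥-elim (All≢⇒∉ q (subst (_∈ map f xs) r (∈-map⁺ f i)))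
unique-map-injective (q ∷ u) (there i)   (there k)   r = unique-map-injective u i k r

module _ {V E : Set} {g : Graph V E} (_≟_ : DecidableEquality E) where
  open Walks g
  open import Data.List.Membership.DecPropositional _≟_ using (_∈?_)

  walk-firstEdge : ∀ {u v} (W : Walk g u v) → u ≢ v → Σ E λ e → Σ V λ w → e ∈ ed W × Joins g e u w
  walk-firstEdge []           u≢v = ⊥-elim (u≢v refl)
  walk-firstEdge (step e j W) u≢v = e , _ , here refl , j

  -- If the circle uses the first edge of the path, the rest of the circle leaves `u` by an edge of
  -- the remaining path, which avoids `u`. Otherwise the circle lies in the remaining path.
  path-acyclic : ∀ {u v} (P : Walk g u v) → IsPath g P → ∀ {fs} → CircList fs →
                 (∀ {f} → f ∈ fs → f ∈ ed P) → ⊥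
  path-acyclic []           pth (circList c refl) s with s (here refl)
  ... | ()
  path-acyclic {u} (step {w = w} e j P) (q ∷ pth) {fs} c s with e ∈? fs
  ... | no e∉ = path-acyclic P pth c (λ i → tail i (s i))
    where
    tail : ∀ {f} → f ∈ fs → f ∈ e ∷ ed P → f ∈ ed P
    tail i (here refl) = ⊥-elim (e∉ i)
    tail i (there k)   = k
  ... | yes e∈ with ∈-∃++ e∈
  ... | xs , ys , refl with circList-rotate xs c
  ... | circList {u = a} {b} {j = k} {Q} (isCirc pQ e∉Q) r with ∷-injective r
  ... | refl , r′ = at-u (joins-unique k j)
    where
    inP : ∀ {f} → f ∈ ed Q → f ∈ ed P
    inP i with s (∈-resp-↭ (++-comm (e ∷ ys) xs) (there (subst (_ ∈_) r′ i)))
    ... | here refl = ⊥-elim (e∉Q i)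
    ... | there l   = l
    clash : ∀ {x y} (X : Walk g x y) → x ≡ u → x ≢ y → (∀ {f} → f ∈ ed X → f ∈ ed P) → ⊥
    clash X refl x≢y t with walk-firstEdge X x≢y
    ... | f , _ , f∈ , l = All≢⇒∉ q (proj₁ (ends∈ P (t f∈) l))
    u≢w : u ≢ w
    u≢w refl = All≢⇒∉ q (start∈ P)
    at-u : (a ≡ u × b ≡ w) ⊎ (a ≡ w × b ≡ u) → ⊥
    at-u (inj₁ (refl , refl)) = clash (rev Q) refl u≢w (inP ∘ ∈ed-rev Q)
    at-u (inj₂ (refl , refl)) = clash Q refl u≢w inP

_≟ₚ_ : DecidableEquality Part
inS ≟ₚ inS = yes refl
inS ≟ₚ inT = no λ ()
inS ≟ₚ inD = no λ ()
inT ≟ₚ inS = no λ ()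
inT ≟ₚ inT = yes refl
inT ≟ₚ inD = no λ ()
inD ≟ₚ inS = no λ ()
inD ≟ₚ inT = no λ ()
inD ≟ₚ inD = yes refl

module _ {n m : ℕ} {E : Set} {Δ : Graph (Fin n) (Fin m)} {p : E → Fin m} {B : List E → Set}
         (be : IsBiasedExpansion Δ p B) where
  open Expansion be
  open import Data.List.Membership.DecPropositional (_≟_ {n = m}) using (_∈?_)

  Order4 : Set₁
  Order4 = (M : ExpMinor Δ p B) → ExpMinor.order M ≡ 4 →
           IsGroupExpansion (ExpMinor.mBase M) (ExpMinor.mProj M) (ExpMinor.mBal M)

  -- A minor of order four, given by the contracted edges Ts with their lifts zs, the surviving
  -- edges Ss, a representative of each contracted class, and representatives of the kept classes.
  record MinorData : Set where
    field
      Ts Ss     : List (Fin m)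
      zs        : List E
      zs-over   : map p zs ≡ Ts
      Ts-unique : Unique Ts
      Ts-Ss     : Disjoint Ts Ss
      rep       : Fin n → Fin n
      rep-T     : ∀ {f} → f ∈ Ts → rep (proj₁ (Δ f)) ≡ rep (proj₂ (Δ f))
      toRep     : ∀ u → Σ (Walk Δ u (rep u)) λ W → ∀ {f} → f ∈ ed W → f ∈ Ts
      acyclic   : ∀ {fs} → CircList fs → (∀ {f} → f ∈ fs → f ∈ Ts) → ⊥
      kept      : List (Fin n)
      four      : length kept ≡ 4
      distinct  : Unique (map rep kept)
      S-kept    : ∀ {f} → f ∈ Ss → rep (proj₁ (Δ f)) ∈ map rep kept × rep (proj₂ (Δ f)) ∈ map rep kept

  module FromMinor (order4 : Order4) (D : MinorData) where
    open MinorData D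
    open Factorization (factorize _≟_ rep)

    part : Fin m → Part
    part f with f ∈? Ts
    ... | yes _ = inT
    ... | no _ with f ∈? Ss
    ...   | yes _ = inS
    ...   | no _  = inD

    part-T⁺ : ∀ {f} → f ∈ Ts → part f ≡ inT
    part-T⁺ {f} i with f ∈? Ts
    ... | yes _ = refl
    ... | no ¬i = ⊥-elim (¬i i)

    part-T⁻ : ∀ {f} → part f ≡ inT → f ∈ Ts
    part-T⁻ {f} q with f ∈? Ts
    ... | yes i = i
    ... | no _ with f ∈? Ss | q
    ...   | yes _ | ()
    ...   | no _  | ()

    part-S⁺ : ∀ {f} → f ∈ Ss → part f ≡ inS
    part-S⁺ {f} i with f ∈? Ts
    ... | yes k = ⊥-elim (Ts-Ss k i)
    ... | no _ with f ∈? Ss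
    ...   | yes _ = refl
    ...   | no ¬i = ⊥-elim (¬i i)

    part-S⁻ : ∀ {f} → part f ≡ inS → f ∈ Ss
    part-S⁻ {f} q with f ∈? Ts | q
    ... | yes _ | ()
    ... | no _ | q′ with f ∈? Ss | q′
    ...   | yes i | _ = i
    ...   | no _  | ()

    τ′ : ∀ f → Σ E λ e → p e ≡ f × (∀ {z} → z ∈ zs → p z ≡ f → e ≡ z)
    τ′ f with Any.any? (λ z → p z ≟ f) zs
    ... | yes a = let (z , i , q) = find a in z , q ,
          λ i′ q′ → unique-map-injective (subst Unique (sym zs-over) Ts-unique) i i′ (trans q (sym q′))
    -- A default lift: only edges of `Ts` are contracted.
    ... | no ¬a = τ₀ f , proj₂ (IsBiasedExpansion.surj be f) , λ i q → ⊥-elim (¬a (lose i q))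

    τ : Fin m → E
    τ f = proj₁ (τ′ f)

    τ-zs : ∀ {z} → z ∈ zs → part (p z) ≡ inT × τ (p z) ≡ z
    τ-zs i = part-T⁺ (map-∈ p zs-over i) , proj₂ (proj₂ (τ′ _)) i refl

    -- The edges are values of the section `τ`, so they project injectively, and the circle would
    -- project to a circle of `Δ` within `Ts`. The contracted lift is thus balanced vacuously.
    noCircle : (C : Circle (liftG Δ p)) →
               All (λ e → part (p e) ≡ inT × τ (p e) ≡ e) (circEdges (liftG Δ p) C) → ⊥
    noCircle record { walk = [] ; nonempty = () }
    noCircle record { walk = W@(step x j Q) ; uniqV = uV ; uniqE = uE } a =
      acyclic (circList (uncircle {j = j} {Q = proj Q} uV′ uE′) (sym (proj-ed W))) inTs
      where
      uV′ = subst Unique (sym (proj-verts W)) uV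
      τp : ∀ es → All (λ e → part (p e) ≡ inT × τ (p e) ≡ e) es → map τ (map p es) ≡ es
      τp []       []             = refl
      τp (e ∷ es) ((_ , q) ∷ qs) = cong₂ _∷_ q (τp es qs)
      uE′ = subst Unique (proj-ed W) (Uniqueₚ.map⁻ (subst Unique (sym (τp _ a)) uE))
      inTs : ∀ {f} → f ∈ map p (edges (liftG Δ p) W) → f ∈ Ts
      inTs i with ∈-map⁻ p i
      ... | e , k , refl = part-T⁻ (proj₁ (All.lookup a k))

    rep-walk : ∀ {u v} (W : Walk Δ u v) → All (λ f → part f ≡ inT) (ed W) → rep u ≡ rep v
    rep-walk []                  []       = refl
    rep-walk (step f (inj₁ q) W) (a ∷ as) =
      trans (subst (λ (x , y) → rep x ≡ rep y) q (rep-T (part-T⁻ a))) (rep-walk W as)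
    rep-walk (step f (inj₂ q) W) (a ∷ as) =
      trans (sym (subst (λ (x , y) → rep x ≡ rep y) q (rep-T (part-T⁻ a)))) (rep-walk W as)

    classWalk : ∀ u v → c u ≡ c v → Σ (Walk Δ u v) λ W → All (λ f → part f ≡ inT) (ed W)
    classWalk u v q with toRep u | toRep v | sound u v q
    ... | W , w | X , x | r = W ⋯ subst (λ a → Walk Δ a v) (sym r) (rev X) ,
      All.tabulate (λ i → part-T⁺ (inTs (∈ed-⋯⁻ W _ i)))
      where
      inX : ∀ {a f} (r : a ≡ rep v) → f ∈ ed (subst (λ a → Walk Δ a v) (sym r) (rev X)) → f ∈ Ts
      inX refl i = x (∈ed-rev X i)
      inTs : ∀ {f} → f ∈ ed W ⊎ f ∈ ed (subst (λ a → Walk Δ a v) (sym r) (rev X)) → f ∈ Ts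
      inTs (inj₁ i) = w i
      inTs (inj₂ i) = inX r i

    K : Subset k
    K = fromList (map c kept)

    ∈-kept : ∀ {x l} → rep x ∈ map rep l → c x ∈ map c l
    ∈-kept {l = y ∷ l} (here q)  = here (complete _ y q)
    ∈-kept {l = y ∷ l} (there i) = there (∈-kept i)

    classes-unique : ∀ l → Unique (map rep l) → Unique (map c l)
    classes-unique []      []      = []
    classes-unique (x ∷ l) (q ∷ u) = ∉⇒All≢ (λ i → All≢⇒∉ q (back l i)) ∷ classes-unique l u
      where
      back : ∀ l → c x ∈ map c l → rep x ∈ map rep l
      back (y ∷ l) (here r)  = here (sound x y r)
      back (y ∷ l) (there i) = there (back l i)

    minor : ExpMinor Δ p B
    minor = record
      { part = part ; τ = τ ; section = λ f → proj₁ (proj₂ (τ′ f))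
      ; balancedLift = λ C a → ⊥-elim (noCircle C a)
      ; k = k ; c = c ; classSurj = onto
      ; classSpec = λ u v → mk⇔ (classWalk u v) (λ (W , a) → complete u v (rep-walk W a))
      ; K = K
      ; keepS = λ f s → let (a , b) = S-kept (part-S⁻ s) in
          ∈-fromList⁺ (map c kept) (∈-kept a) , ∈-fromList⁺ (map c kept) (∈-kept b) }

    private
      module M = ExpMinor minor
      minorExpansion : IsGroupExpansion M.mBase M.mProj M.mBal
      minorExpansion = order4 minor (trans (∣fromList∣ (classes-unique kept distinct))
        (trans (length-map c kept) four))
      ψ = proj₁ (proj₂ minorExpansion)
      module Via = GroupExpansionVia (proj₂ (proj₂ minorExpansion))

    G : Group 0ℓ 0ℓ
    G = proj₁ minorExpansion

    open Gain G

    MF≡ : ∀ {f f′ : Fin m} {s : part f ≡ inS} {s′ : part f′ ≡ inS} → f ≡ f′ →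
          _≡_ {A = M.MF} (f , s) (f′ , s′)
    MF≡ {s = s} {s′} refl = cong (_ ,_) (≡-irrelevant s s′)

    MV≡ : ∀ {i i′} {s : i ∈ₛ K} {s′ : i′ ∈ₛ K} → i ≡ i′ → _≡_ {A = M.MV} (i , s) (i′ , s′)
    MV≡ {s = s} {s′} refl = cong (_ ,_) ([]=-irrelevant s s′)

    φ : E → Carrier
    φ x with part (p x) ≟ₚ inS
    ... | yes s = ψ (x , s)
    ... | no _  = ε

    φ-ψ : ∀ {x} (s : part (p x) ≡ inS) → φ x ≡ ψ (x , s)
    φ-ψ {x} s with part (p x) ≟ₚ inS
    ... | yes s′ = cong (λ s → ψ (x , s)) (≡-irrelevant s′ s)
    ... | no ¬s  = ⊥-elim (¬s s)

    φ-bij : ∀ {f} → f ∈ Ss → Bij φ f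
    φ-bij {f} i = inj , λ g → let ((e , s) , q , r) = Via.onto g (f , part-S⁺ i) in
      e , cong proj₁ q , ≈-trans (≈-reflexive (φ-ψ s)) r
      where
      inj : Inj φ f
      inj {x} {y} refl q r = cong proj₁ (Via.inj (x , part-S⁺ i) (y , s) (MF≡ (sym q))
        (≈-trans (≈-reflexive (sym (φ-ψ (part-S⁺ i)))) (≈-trans r (≈-reflexive (φ-ψ s)))))
        where
        s : part (p y) ≡ inS
        s = subst (λ f → part f ≡ inS) (sym q) (part-S⁺ i)

    -- The edge really joins `s` and `t`; the minor only sees their classes, which are those of the
    -- kept nodes `a` and `b`.
    record SEdge (x : E) (a b : Fin n) : Set where
      field
        {s t} : Fin n
        joins : Joins Δ (p x) s t
        mem   : p x ∈ Ss
        from  : rep s ≡ rep a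
        to    : rep t ≡ rep b
      value : Carrier
      value = act (sign joins) (φ x)
      me : M.ME
      me = x , part-S⁺ mem

    node : ∀ {a} → a ∈ kept → M.MV
    node i = c _ , ∈-fromList⁺ (map c kept) (∈-map⁺ c i)

    minorJoins : ∀ {x a b} (s : SEdge x a b) (i : a ∈ kept) (k : b ∈ kept) →
                 Joins (liftG M.mBase M.mProj) (SEdge.me s) (node i) (node k)
    minorJoins s i k with SEdge.joins s | complete _ _ (SEdge.from s) | complete _ _ (SEdge.to s)
    ... | inj₁ q | r | r′ = inj₁ (cong₂ _,_ (MV≡ (trans (cong (c ∘ proj₁) q) r)) (MV≡ (trans (cong (c ∘ proj₂) q) r′)))
    ... | inj₂ q | r | r′ = inj₂ (cong₂ _,_ (MV≡ (trans (cong (c ∘ proj₁) q) r′)) (MV≡ (trans (cong (c ∘ proj₂) q) r)))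

    gain-step : ∀ {x a b} (s : SEdge x a b) (i : a ∈ kept) (k : b ∈ kept) {v}
                (W : Walk (liftG M.mBase M.mProj) (node k) v) →
                gain _ G ψ (step (SEdge.me s) (minorJoins s i k) W) ≈ SEdge.value s ∙ gain _ G ψ W
    gain-step s i k W with SEdge.joins s | complete _ _ (SEdge.from s) | complete _ _ (SEdge.to s)
    ... | inj₁ q | r | r′ = ∙-congʳ (≈-reflexive (sym (φ-ψ _)))
    ... | inj₂ q | r | r′ = ∙-congʳ (⁻¹-cong (≈-reflexive (sym (φ-ψ _))))

    -- `D` is the witness that balance in the minor asks for. It enters through its set of edges
    -- only, so the order in which it runs through contracted and surviving edges is irrelevant.
    fourCycle : ∀ {a b d e w x y z} → a ∈ kept → b ∈ kept → d ∈ kept → e ∈ kept →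
      Unique (map rep (a ∷ b ∷ d ∷ e ∷ [])) → Unique (map p (w ∷ x ∷ y ∷ z ∷ [])) →
      (s₁ : SEdge w a b) (s₂ : SEdge x b d) (s₃ : SEdge y d e) (s₄ : SEdge z e a) →
      (D : Circle (liftG Δ p)) → B (circEdges (liftG Δ p) D) →
      (∀ {h} → h ∈ circEdges (liftG Δ p) D → h ∈ w ∷ x ∷ y ∷ z ∷ [] ⊎ h ∈ zs) →
      (∀ {h} → h ∈ w ∷ x ∷ y ∷ z ∷ [] → h ∈ circEdges (liftG Δ p) D) →
      SEdge.value s₁ ∙ (SEdge.value s₂ ∙ (SEdge.value s₃ ∙ SEdge.value s₄)) ≈ ε
    fourCycle {a} {b} {d} {e} {w} {x} {y} {z} a∈ b∈ d∈ e∈ uV uE s₁ s₂ s₃ s₄ D bal inside⊆ ⊆D =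
      ≈-trans (≈-sym (≈-trans (gain-step s₁ a∈ b∈ W₁) (∙-congˡ
                (≈-trans (gain-step s₂ b∈ d∈ W₂) (∙-congˡ
                (≈-trans (gain-step s₃ d∈ e∈ W₃) (∙-congˡ
                (≈-trans (gain-step s₄ e∈ a∈ []) (identityʳ _)))))))))
        (Equivalence.to (Via.balance C) (D , bal , D⊆ , λ h → mk⇔ (λ (i , ¬t) → onS h i ¬t) (fromS h)))
      where
      module S = SEdge
      me₁ = S.me s₁
      me₂ = S.me s₂
      me₃ = S.me s₃
      me₄ = S.me s₄
      W₃ : Walk (liftG M.mBase M.mProj) (node e∈) (node a∈)
      W₃ = step me₄ (minorJoins s₄ e∈ a∈) []
      W₂ : Walk (liftG M.mBase M.mProj) (node d∈) (node a∈)
      W₂ = step me₃ (minorJoins s₃ d∈ e∈) W₃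
      W₁ : Walk (liftG M.mBase M.mProj) (node b∈) (node a∈)
      W₁ = step me₂ (minorJoins s₂ b∈ d∈) W₂
      C : Circle (liftG M.mBase M.mProj)
      C = record
        { walk = step me₁ (minorJoins s₁ a∈ b∈) W₁
        ; nonempty = s≤s z≤n
        ; uniqV = Uniqueₚ.map⁻ {f = proj₁} (classes-unique (a ∷ b ∷ d ∷ e ∷ []) uV)
        ; uniqE = Uniqueₚ.map⁻ {f = proj₁} (Uniqueₚ.map⁻ {f = p} {xs = w ∷ x ∷ y ∷ z ∷ []} uE) }
      D⊆ : ∀ h → h ∈ circEdges (liftG Δ p) D → h ∈ w ∷ x ∷ y ∷ z ∷ [] ⊎ M.InT h
      D⊆ h i with inside⊆ i
      ... | inj₁ k = inj₁ k
      ... | inj₂ k = inj₂ (τ-zs k)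
      onS : ∀ h → h ∈ circEdges (liftG Δ p) D → ¬ M.InT h → h ∈ w ∷ x ∷ y ∷ z ∷ []
      onS h i ¬t with D⊆ h i
      ... | inj₁ k = k
      ... | inj₂ t = ⊥-elim (¬t t)
      inS-all : All (λ h → part (p h) ≡ inS) (w ∷ x ∷ y ∷ z ∷ [])
      inS-all = proj₂ me₁ ∷ proj₂ me₂ ∷ proj₂ me₃ ∷ proj₂ me₄ ∷ []
      S≢T : ∀ {q : Part} → q ≡ inS → q ≡ inT → ⊥
      S≢T refl ()
      fromS : ∀ h → h ∈ w ∷ x ∷ y ∷ z ∷ [] → h ∈ circEdges (liftG Δ p) D × ¬ M.InT h
      fromS h i = ⊆D i , λ (t , _) → S≢T (All.lookup inS-all i) t

-- Four-term equations on a circle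

-- Separates surviving from contracted edges. On base edges it makes `Ss` and `Ts` disjoint; on
-- lifts it gives the two inclusions required by `fourCycle`.
spread-↭ : ∀ {A : Set} {f a b d : A} (fs₁ fs₂ fs₃ : List A) →
           f ∷ fs₁ ++ a ∷ fs₂ ++ b ∷ fs₃ ++ [ d ] ↭ (f ∷ a ∷ b ∷ d ∷ []) ++ (fs₁ ++ fs₂ ++ fs₃)
spread-↭ {f = f} {a} {b} {d} fs₁ fs₂ fs₃ = prep f
  (↭-trans (shift a fs₁ _) (prep a
  (↭-trans (++⁺ˡ fs₁ (↭-trans (shift b fs₂ _) (prep b (↭-trans (++⁺ˡ fs₂ (++-comm fs₃ [ d ])) (shift d fs₂ fs₃)))))
  (↭-trans (shift b fs₁ _) (prep b (shift d fs₁ _))))))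

module _ {V E : Set} {g : Graph V E} where
  open Walks g

  path-step⁻ : ∀ {u s t v e} {j : Joins g e s t} (A : Walk g u s) (R : Walk g t v) →
               IsPath g (A ⋯ step e j R) → IsPath g A × IsPath g R × Disjoint (vs A) (vs R)
  path-step⁻ {e = e} {j} A R pth with path-⋯⁻ A (step e j R) pth
  ... | pA , (q ∷ pR) , d = pA , pR , disj
    where
    disj : Disjoint (vs A) (vs R)
    disj i k with refl ← d i (there k) = All≢⇒∉ q k

module FourTerm {n m : ℕ} {E : Set} {Δ : Graph (Fin n) (Fin m)} {p : E → Fin m} {B : List E → Set}
         (be : IsBiasedExpansion Δ p B) (order4 : Order4 be) where
  open Expansion be

  -- With the lifts of all but four edges of a circle fixed, balance is a four-term group equation.
  record FourTerms (f a b d : Fin m) (v₁ v₂ v₃ : List E) : Set₁ where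
    field
      G       : Group 0ℓ 0ℓ
    open Gain G public
    field
      α β γ δ : E → Carrier
      α-bij   : Bij α f
      β-bij   : Bij β a
      γ-bij   : Bij γ b
      δ-bij   : Bij δ d
      balance : ∀ {x y z w} → p x ≡ f → p y ≡ a → p z ≡ b → p w ≡ d →
                B (x ∷ v₁ ++ y ∷ v₂ ++ z ∷ v₃ ++ [ w ]) → α x ∙ (β y ∙ (γ z ∙ δ w)) ≈ ε

  -- Contracting `V₁`, `V₂` and `V₃` leaves a four-cycle on the classes of `u`, `w`, `t₁` and `t₂`.
  -- As `d` and `f` are the last and the first edge of the circle, nothing lies between them and `u`
  -- is a class by itself.
  module Segments {u w s₁ t₁ s₂ t₂ s₃ : Fin n} {f a b d : Fin m}
    (jf : Joins Δ f u w) (V₁ : Walk Δ w s₁) (ja : Joins Δ a s₁ t₁) (V₂ : Walk Δ t₁ s₂)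
    (jb : Joins Δ b s₂ t₂) (V₃ : Walk Δ t₂ s₃) (jd : Joins Δ d s₃ u)
    (v₁ v₂ v₃ : List E) (q₁ : map p v₁ ≡ ed V₁) (q₂ : map p v₂ ≡ ed V₂) (q₃ : map p v₃ ≡ ed V₃)
    where
    open import Data.List.Membership.DecPropositional (_≟_ {n = n}) using (_∈?_)

    R₃ = V₃ ⋯ step d jd []
    R₂ = V₂ ⋯ step b jb R₃
    Q  = V₁ ⋯ step a ja R₂

    Q-edges : f ∷ ed Q ≡ f ∷ ed V₁ ++ a ∷ ed V₂ ++ b ∷ ed V₃ ++ [ d ]
    Q-edges = cong (f ∷_) (trans (ed-⋯ V₁ (step a ja R₂)) (cong (λ l → ed V₁ ++ a ∷ l)
      (trans (ed-⋯ V₂ (step b jb R₃)) (cong (λ l → ed V₂ ++ b ∷ l) (ed-⋯ V₃ (step d jd []))))))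

    rep : Fin n → Fin n
    rep x with x ∈? vs V₁
    ... | yes _ = w
    ... | no _ with x ∈? vs V₂
    ...   | yes _ = t₁
    ...   | no _ with x ∈? vs V₃
    ...     | yes _ = t₂
    -- This covers `u` and the nodes off the circle; the latter stay single and are not kept.
    ...     | no _  = x

    module _ (C : IsCirc f jf Q) where

      pth₁ = path-step⁻ V₁ R₂ (IsCirc.path C)
      pth₂ = path-step⁻ V₂ R₃ (proj₁ (proj₂ pth₁))
      pth₃ = path-step⁻ V₃ [] (proj₁ (proj₂ pth₂))

      V₁-V₂ : Disjoint (vs V₁) (vs V₂)
      V₁-V₂ i k = proj₂ (proj₂ pth₁) i (∈vs-⋯ˡ V₂ (step b jb R₃) k)

      V₁-R₃ : Disjoint (vs V₁) (vs R₃)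
      V₁-R₃ i k = proj₂ (proj₂ pth₁) i (∈vs-⋯ʳ V₂ (step b jb R₃) (there k))

      V₁-V₃ : Disjoint (vs V₁) (vs V₃)
      V₁-V₃ i k = V₁-R₃ i (∈vs-⋯ˡ V₃ (step d jd []) k)

      V₂-V₃ : Disjoint (vs V₂) (vs V₃)
      V₂-V₃ i k = proj₂ (proj₂ pth₂) i (∈vs-⋯ˡ V₃ (step d jd []) k)

      u∉V₁ : u ∉ vs V₁
      u∉V₁ i = V₁-R₃ i (end∈ R₃)

      u∉V₂ : u ∉ vs V₂
      u∉V₂ i = proj₂ (proj₂ pth₂) i (end∈ R₃)

      u∉V₃ : u ∉ vs V₃
      u∉V₃ i = proj₂ (proj₂ pth₃) i (here refl)

      rep-V₁ : ∀ {x} → x ∈ vs V₁ → rep x ≡ w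
      rep-V₁ {x} i with x ∈? vs V₁
      ... | yes _ = refl
      ... | no ¬i = ⊥-elim (¬i i)

      rep-V₂ : ∀ {x} → x ∈ vs V₂ → rep x ≡ t₁
      rep-V₂ {x} i with x ∈? vs V₁
      ... | yes k = ⊥-elim (V₁-V₂ k i)
      ... | no _ with x ∈? vs V₂
      ...   | yes _ = refl
      ...   | no ¬i = ⊥-elim (¬i i)

      rep-V₃ : ∀ {x} → x ∈ vs V₃ → rep x ≡ t₂
      rep-V₃ {x} i with x ∈? vs V₁
      ... | yes k = ⊥-elim (V₁-V₃ k i)
      ... | no _ with x ∈? vs V₂
      ...   | yes k = ⊥-elim (V₂-V₃ k i)
      ...   | no _ with x ∈? vs V₃
      ...     | yes _ = refl
      ...     | no ¬i = ⊥-elim (¬i i)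

      rep-u : rep u ≡ u
      rep-u with u ∈? vs V₁
      ... | yes k = ⊥-elim (u∉V₁ k)
      ... | no _ with u ∈? vs V₂
      ...   | yes k = ⊥-elim (u∉V₂ k)
      ...   | no _ with u ∈? vs V₃
      ...     | yes k = ⊥-elim (u∉V₃ k)
      ...     | no _  = refl

      Ts : List (Fin m)
      Ts = ed V₁ ++ ed V₂ ++ ed V₃

      Ss : List (Fin m)
      Ss = f ∷ a ∷ b ∷ d ∷ []

      kept : List (Fin n)
      kept = u ∷ w ∷ t₁ ∷ t₂ ∷ []

      kept-reps : map rep kept ≡ kept
      kept-reps = cong₂ _∷_ rep-u (cong₂ _∷_ (rep-V₁ (start∈ V₁)) (cong₂ _∷_ (rep-V₂ (start∈ V₂))
        (cong₂ _∷_ (rep-V₃ (start∈ V₃)) refl)))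

      ends : ∀ {x y} {W : Walk Δ x y} {h} → h ∈ ed W → proj₁ (Δ h) ∈ vs W × proj₂ (Δ h) ∈ vs W
      ends {W = W} i = ends∈ W i (inj₁ refl)

      Ts⁻ : ∀ {h} → h ∈ Ts → h ∈ ed V₁ ⊎ h ∈ ed V₂ ⊎ h ∈ ed V₃
      Ts⁻ i with ∈-++⁻ (ed V₁) i
      ... | inj₁ k = inj₁ k
      ... | inj₂ k = inj₂ (∈-++⁻ (ed V₂) k)

      rep-T : ∀ {h} → h ∈ Ts → rep (proj₁ (Δ h)) ≡ rep (proj₂ (Δ h))
      rep-T i with Ts⁻ i
      ... | inj₁ k = trans (rep-V₁ (proj₁ (ends {W = V₁} k))) (sym (rep-V₁ (proj₂ (ends {W = V₁} k))))
      ... | inj₂ (inj₁ k) = trans (rep-V₂ (proj₁ (ends {W = V₂} k))) (sym (rep-V₂ (proj₂ (ends {W = V₂} k))))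
      ... | inj₂ (inj₂ k) = trans (rep-V₃ (proj₁ (ends {W = V₃} k))) (sym (rep-V₃ (proj₂ (ends {W = V₃} k))))

      back : ∀ {x s t} (W : Walk Δ s t) → x ∈ vs W → Σ (Walk Δ x s) λ X → ∀ {h} → h ∈ ed X → h ∈ ed W
      back W i with split W i
      ... | X , Y , refl = rev X , λ k → ∈ed-⋯ˡ X Y (∈ed-rev X k)

      toRep : ∀ x → Σ (Walk Δ x (rep x)) λ W → ∀ {h} → h ∈ ed W → h ∈ Ts
      toRep x with x ∈? vs V₁
      ... | yes i = proj₁ (back V₁ i) , λ k → ∈-++⁺ˡ (proj₂ (back V₁ i) k)
      ... | no _ with x ∈? vs V₂
      ...   | yes i = proj₁ (back V₂ i) , λ k → ∈-++⁺ʳ (ed V₁) (∈-++⁺ˡ (proj₂ (back V₂ i) k))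
      ...   | no _ with x ∈? vs V₃
      ...     | yes i = proj₁ (back V₃ i) , λ k → ∈-++⁺ʳ (ed V₁) (∈-++⁺ʳ (ed V₂) (proj₂ (back V₃ i) k))
      ...     | no _  = [] , λ ()

      edges-↭ : f ∷ ed Q ↭ Ss ++ Ts
      edges-↭ = ↭-trans (↭-reflexive Q-edges) (spread-↭ (ed V₁) (ed V₂) (ed V₃))

      edges-unique = unique-++⁻ Ss (unique-↭ edges-↭ (Circle.uniqE (circle C)))

      Ts⊆Q : ∀ {h} → h ∈ Ts → h ∈ ed Q
      Ts⊆Q i with ∈-resp-↭ (↭-sym edges-↭) (∈-++⁺ʳ Ss i)
      ... | here refl = ⊥-elim (proj₂ (proj₂ edges-unique) (here refl) i)
      ... | there k   = k

      kept-ends : ∀ {h s t} → Joins Δ h s t → rep s ∈ map rep kept → rep t ∈ map rep kept →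
                  rep (proj₁ (Δ h)) ∈ map rep kept × rep (proj₂ (Δ h)) ∈ map rep kept
      kept-ends (inj₁ r) i k rewrite r = i , k
      kept-ends (inj₂ r) i k rewrite r = k , i

      s₁~w : rep s₁ ≡ rep w
      s₁~w = trans (rep-V₁ (end∈ V₁)) (sym (rep-V₁ (start∈ V₁)))

      s₂~t₁ : rep s₂ ≡ rep t₁
      s₂~t₁ = trans (rep-V₂ (end∈ V₂)) (sym (rep-V₂ (start∈ V₂)))

      s₃~t₂ : rep s₃ ≡ rep t₂
      s₃~t₂ = trans (rep-V₃ (end∈ V₃)) (sym (rep-V₃ (start∈ V₃)))

      S-kept : ∀ {h} → h ∈ Ss → rep (proj₁ (Δ h)) ∈ map rep kept × rep (proj₂ (Δ h)) ∈ map rep kept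
      S-kept (here refl)                         = kept-ends jf (here refl) (there (here refl))
      S-kept (there (here refl))                 = kept-ends ja (there (here s₁~w)) (there (there (here refl)))
      S-kept (there (there (here refl)))         =
        kept-ends jb (there (there (here s₂~t₁))) (there (there (there (here refl))))
      S-kept (there (there (there (here refl)))) = kept-ends jd (there (there (there (here s₃~t₂)))) (here refl)

      minorData : MinorData be
      minorData = record
        { Ts = Ts ; Ss = Ss ; zs = v₁ ++ v₂ ++ v₃
        ; zs-over = map-++-≡ p q₁ (map-++-≡ p q₂ q₃)
        ; Ts-unique = proj₁ (proj₂ edges-unique)
        ; Ts-Ss = λ i k → proj₂ (proj₂ edges-unique) k i
        ; rep = rep ; rep-T = rep-T ; toRep = toRep
        ; acyclic = λ c s → path-acyclic _≟_ Q (IsCirc.path C) c (λ i → Ts⊆Q (s i))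
        ; kept = kept ; four = refl ; distinct = distinct ; S-kept = S-kept }
        where
        distinct : Unique (map rep kept)
        distinct = subst Unique (sym kept-reps) (
          ((λ { refl → u∉V₁ (start∈ V₁) }) ∷ (λ { refl → u∉V₂ (start∈ V₂) }) ∷
           (λ { refl → u∉V₃ (start∈ V₃) }) ∷ []) ∷
          ((λ { refl → V₁-V₂ (start∈ V₁) (start∈ V₂) }) ∷ (λ { refl → V₁-V₃ (start∈ V₁) (start∈ V₃) }) ∷ []) ∷
          ((λ { refl → V₂-V₃ (start∈ V₂) (start∈ V₃) }) ∷ []) ∷ [] ∷ [])

      private
        module M = FromMinor be order4 minorData

      open Gain M.G

      edge : ∀ {x h s t k l} (j : Joins Δ h s t) → p x ≡ h → h ∈ Ss → rep s ≡ rep k → rep t ≡ rep l →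
             Σ (M.SEdge x k l) λ e → M.SEdge.value e ≡ act (sign j) (M.φ x)
      edge j refl i q r = record { joins = j ; mem = i ; from = q ; to = r } , refl

      fourTerms : FourTerms f a b d v₁ v₂ v₃
      fourTerms = record
        { G = M.G
        ; α = act (sign jf) ∘ M.φ ; β = act (sign ja) ∘ M.φ ; γ = act (sign jb) ∘ M.φ ; δ = act (sign jd) ∘ M.φ
        ; α-bij = Bij-act (sign jf) (M.φ-bij (here refl))
        ; β-bij = Bij-act (sign ja) (M.φ-bij (there (here refl)))
        ; γ-bij = Bij-act (sign jb) (M.φ-bij (there (there (here refl))))
        ; δ-bij = Bij-act (sign jd) (M.φ-bij (there (there (there (here refl)))))
        ; balance = balance }
        where
        balance : ∀ {x y z w} → p x ≡ f → p y ≡ a → p z ≡ b → p w ≡ d →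
                  B (x ∷ v₁ ++ y ∷ v₂ ++ z ∷ v₃ ++ [ w ]) →
                  act (sign jf) (M.φ x) ∙ (act (sign ja) (M.φ y) ∙ (act (sign jb) (M.φ z) ∙ act (sign jd) (M.φ w))) ≈ ε
        balance {x} {y} {z} {e} qx qy qz qw bal =
          ≈-trans (≈-reflexive (sym (cong₂ _∙_ (proj₂ e₁) (cong₂ _∙_ (proj₂ e₂) (cong₂ _∙_ (proj₂ e₃) (proj₂ e₄))))))
          (M.fourCycle (here refl) (there (here refl)) (there (there (here refl))) (there (there (there (here refl))))
            (MinorData.distinct minorData) p-unique (proj₁ e₁) (proj₁ e₂) (proj₁ e₃) (proj₁ e₄)
            (proj₁ lifted) (subst B (sym (proj₂ lifted)) bal)
            (λ {h} i → ∈-++⁻ (x ∷ y ∷ z ∷ e ∷ [])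
              (∈-resp-↭ (spread-↭ v₁ v₂ v₃) (subst (h ∈_) (proj₂ lifted) i)))
            (λ {h} i → subst (h ∈_) (sym (proj₂ lifted)) (∈-resp-↭ (↭-sym (spread-↭ v₁ v₂ v₃)) (∈-++⁺ˡ i))))
          where
          e₁ = edge jf qx (here refl) refl refl
          e₂ = edge ja qy (there (here refl)) s₁~w refl
          e₃ = edge jb qz (there (there (here refl))) s₂~t₁ refl
          e₄ = edge jd qw (there (there (there (here refl)))) s₃~t₂ refl
          lifted = liftCircle (circList C Q-edges) (cong₂ _∷_ qx (map-++-≡ p q₁
            (cong₂ _∷_ qy (map-++-≡ p q₂ (cong₂ _∷_ qz (map-++-≡ p q₃ (cong [_] qw)))))))
          p-unique : Unique (map p (x ∷ y ∷ z ∷ e ∷ []))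
          p-unique = subst Unique (sym (cong₂ _∷_ qx (cong₂ _∷_ qy (cong₂ _∷_ qz (cong [_] qw))))) (proj₁ edges-unique)

  fourTerms : ∀ {f a b d} fs₁ fs₂ fs₃ → CircList (f ∷ fs₁ ++ a ∷ fs₂ ++ b ∷ fs₃ ++ [ d ]) →
              ∀ {v₁ v₂ v₃} → map p v₁ ≡ fs₁ → map p v₂ ≡ fs₂ → map p v₃ ≡ fs₃ →
              FourTerms f a b d v₁ v₂ v₃
  fourTerms fs₁ fs₂ fs₃ (circList {j = jf} {Q} C q) q₁ q₂ q₃ with ∷-injective q
  ... | refl , r with splitList Q fs₁ r
  ... | _ , V₁ , step a ja R₂ , refl , refl , r₂ with ∷-injective r₂
  ... | refl , r₂′ with splitList R₂ fs₂ r₂′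
  ... | _ , V₂ , step b jb R₃ , refl , refl , r₃ with ∷-injective r₃
  ... | refl , r₃′ with splitList R₃ fs₃ r₃′
  ... | _ , V₃ , step d jd [] , refl , refl , refl =
    Segments.fourTerms jf V₁ ja V₂ jb V₃ jd _ _ _ q₁ q₂ q₃ C

-- Gains on a circle

snocView : ∀ {A : Set} (x : A) xs → Σ (List A) λ ys → Σ A λ y → x ∷ xs ≡ ys ∷ʳ y
snocView x []       = [] , x , refl
snocView x (y ∷ xs) with snocView y xs
... | ys , z , q = x ∷ ys , z , cong (x ∷_) q

module CircleGains {n m : ℕ} {E : Set} {Δ : Graph (Fin n) (Fin m)} {p : E → Fin m} {B : List E → Set}
         (be : IsBiasedExpansion Δ p B) (order4 : Order4 be) where
  open Expansion be
  open FourTerm be order4 using (FourTerms; fourTerms)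

  module _ {f a b d : Fin m} {fs₁ fs₂ fs₃ : List (Fin m)}
           (C : CircList (f ∷ fs₁ ++ a ∷ fs₂ ++ b ∷ fs₃ ++ [ d ]))
           {v₁ v₂ v₃ : List E} (q₁ : map p v₁ ≡ fs₁) (q₂ : map p v₂ ≡ fs₂) (q₃ : map p v₃ ≡ fs₃)
           where

    assoc³ : ∀ {A : Set} {x y z w : A} (as bs cs : List A) →
             (x ∷ as ++ y ∷ bs ++ z ∷ cs) ++ [ w ] ≡ x ∷ as ++ y ∷ bs ++ z ∷ cs ++ [ w ]
    assoc³ {x = x} {y} {z} as bs cs = cong (x ∷_) (trans (++-assoc as _ _)
      (cong (λ l → as ++ y ∷ l) (++-assoc bs _ _)))

    solve₄ : ∀ {x y z} → p x ≡ f → p y ≡ a → p z ≡ b →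
             Σ E λ w → (p w ≡ d × B (x ∷ v₁ ++ y ∷ v₂ ++ z ∷ v₃ ++ [ w ])) ×
                       (∀ w′ → p w′ ≡ d → B (x ∷ v₁ ++ y ∷ v₂ ++ z ∷ v₃ ++ [ w′ ]) → w′ ≡ w)
    solve₄ {x} {y} {z} qx qy qz
      with solveLast (subst CircList (sym (assoc³ fs₁ fs₂ fs₃)) C)
             (cong₂ _∷_ qx (map-++-≡ p q₁ (cong₂ _∷_ qy (map-++-≡ p q₂ (cong₂ _∷_ qz q₃)))))
    ... | w , (qw , bal) , u = w , (qw , subst B (assoc³ v₁ v₂ v₃) bal) ,
      λ w′ qw′ bal′ → u w′ qw′ (subst B (sym (assoc³ v₁ v₂ v₃)) bal′)

    module Balance (ft : FourTerms f a b d v₁ v₂ v₃) where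
      open FourTerms ft

      -- `solve₄` yields some balanced `w₀`; cancellation and injectivity of `δ` identify it with
      -- `w`.
      balance⁻ : ∀ {x y z w} → p x ≡ f → p y ≡ a → p z ≡ b → p w ≡ d →
                 α x ∙ (β y ∙ (γ z ∙ δ w)) ≈ ε → B (x ∷ v₁ ++ y ∷ v₂ ++ z ∷ v₃ ++ [ w ])
      balance⁻ {x} {y} {z} {w} qx qy qz qw r with solve₄ qx qy qz
      ... | w₀ , (qw₀ , bal) , _ = subst (λ w → B (x ∷ v₁ ++ y ∷ v₂ ++ z ∷ v₃ ++ [ w ]))
        (proj₁ δ-bij qw₀ qw (∙-cancelˡ _ _ _ (∙-cancelˡ _ _ _ (∙-cancelˡ _ _ _
          (≈-trans (balance qx qy qz qw₀ bal) (≈-sym r)))))) bal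

      regroup : ∀ x y z w → α x ∙ (β y ∙ (γ z ∙ δ w)) ≈ (α x ∙ β y) ∙ (γ z ∙ δ w)
      regroup x y z w = ≈-sym (assoc _ _ _)

      -- With `pair-B` this makes the product over the first two edges a complete invariant of the
      -- pair: it is read off from one completion `z`, `w` and then applies to every other one.
      pair-≈ : ∀ {x y x′ y′ z w} → p x ≡ f → p y ≡ a → p x′ ≡ f → p y′ ≡ a → p z ≡ b → p w ≡ d →
               B (x ∷ v₁ ++ y ∷ v₂ ++ z ∷ v₃ ++ [ w ]) → B (x′ ∷ v₁ ++ y′ ∷ v₂ ++ z ∷ v₃ ++ [ w ]) →
               α x ∙ β y ≈ α x′ ∙ β y′
      pair-≈ qx qy qx′ qy′ qz qw bal bal′ = ∙-cancelʳ _ _ _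
        (≈-trans (≈-sym (regroup _ _ _ _)) (≈-trans (balance qx qy qz qw bal)
          (≈-trans (≈-sym (balance qx′ qy′ qz qw bal′)) (regroup _ _ _ _))))

      pair-B : ∀ {x y x′ y′ z w} → p x ≡ f → p y ≡ a → p x′ ≡ f → p y′ ≡ a → p z ≡ b → p w ≡ d →
               α x ∙ β y ≈ α x′ ∙ β y′ →
               B (x ∷ v₁ ++ y ∷ v₂ ++ z ∷ v₃ ++ [ w ]) → B (x′ ∷ v₁ ++ y′ ∷ v₂ ++ z ∷ v₃ ++ [ w ])
      pair-B qx qy qx′ qy′ qz qw r bal = balance⁻ qx′ qy′ qz qw
        (≈-trans (regroup _ _ _ _) (≈-trans (∙-congʳ (≈-sym r))
          (≈-trans (≈-sym (regroup _ _ _ _)) (balance qx qy qz qw bal))))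

  module Exchange {e₁ r l : Fin m} {ks : List (Fin m)} {os : List E} (q : map p os ≡ ks)
                  {x x′ y y′ : E} (qx : p x ≡ e₁) (qx′ : p x′ ≡ e₁) (qy : p y ≡ r) (qy′ : p y′ ≡ r) where

    Rel : List E → Set
    Rel zs = ∀ {w} → p w ≡ l → B (x ∷ os ++ y ∷ zs ++ [ w ]) → B (x′ ∷ os ++ y′ ∷ zs ++ [ w ])

    -- In the minor that keeps `e₁`, `r`, `h` and `l`, the exchange amounts to
    -- `α x ∙ β y ≈ α x′ ∙ β y′`, which does not mention the lift of `h`. In this way minors with
    -- different contracted lifts are compared.
    change : ∀ us vs {h} → CircList (e₁ ∷ ks ++ r ∷ us ++ h ∷ vs ++ [ l ]) → ∀ {uz vz z z′} →
             map p uz ≡ us → map p vz ≡ vs → p z ≡ h → p z′ ≡ h →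
             Rel (uz ++ z ∷ vz) → Rel (uz ++ z′ ∷ vz)
    change us vs C {uz} {vz} {z} {z′} qu qv qz qz′ rel {w} qw bal =
      subst (λ t → B (x′ ∷ os ++ y′ ∷ t)) (sym (++-assoc uz _ _))
        (pair-B qx qy qx′ qy′ qz′ qw same (subst (λ t → B (x ∷ os ++ y ∷ t)) (++-assoc uz _ _) bal))
      where
      open Balance C q qu qv (fourTerms ks us vs C q qu qv)
      sol = solve₄ C q qu qv qx qy qz
      open FourTerms (fourTerms ks us vs C q qu qv)
      same : α x ∙ β y ≈ α x′ ∙ β y′
      same = pair-≈ qx qy qx′ qy′ qz (proj₁ (proj₁ (proj₂ sol))) (proj₂ (proj₁ (proj₂ sol)))
        (subst (λ t → B (x′ ∷ os ++ y′ ∷ t)) (++-assoc uz _ _) (rel (proj₁ (proj₁ (proj₂ sol)))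
          (subst (λ t → B (x ∷ os ++ y ∷ t)) (sym (++-assoc uz _ _)) (proj₂ (proj₁ (proj₂ sol))))))

    changeAll : ∀ us vs → CircList (e₁ ∷ ks ++ r ∷ us ++ vs ++ [ l ]) → ∀ {uz vz vz′} →
                map p uz ≡ us → map p vz ≡ vs → map p vz′ ≡ vs → Rel (uz ++ vz) → Rel (uz ++ vz′)
    changeAll us []       C {uz} {[]} {[]} qu qv qv′ rel = rel
    changeAll us (h ∷ vs) C {uz} {z ∷ vz} {z′ ∷ vz′} qu qv qv′ rel =
      subst Rel (++-assoc uz [ z′ ] vz′)
        (changeAll (us ++ [ h ]) vs
          (subst (λ t → CircList (e₁ ∷ ks ++ r ∷ t)) (sym (++-assoc us [ h ] (vs ++ [ l ]))) C)
          (map-++-≡ p qu (cong [_] (proj₁ (∷-injective qv′))))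
          (proj₂ (∷-injective qv)) (proj₂ (∷-injective qv′))
          (subst Rel (sym (++-assoc uz [ z′ ] vz))
            (change us vs C qu (proj₂ (∷-injective qv)) (proj₁ (∷-injective qv)) (proj₁ (∷-injective qv′)) rel)))

  module _ (G : Group 0ℓ 0ℓ) where
    open Gain G

    update : (E → Carrier) → Fin m → (E → Carrier) → E → Carrier
    update γ r δ e with p e ≟ r
    ... | yes _ = δ e
    ... | no _  = γ e

    update-≡ : ∀ γ {r} δ {e} → p e ≡ r → update γ r δ e ≡ δ e
    update-≡ γ {r} δ {e} q with p e ≟ r
    ... | yes _ = refl
    ... | no ¬q = ⊥-elim (¬q q)

    update-≢ : ∀ γ {r} δ {e} → p e ≢ r → update γ r δ e ≡ γ e
    update-≢ γ {r} δ {e} ¬q with p e ≟ r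
    ... | yes q = ⊥-elim (¬q q)
    ... | no _  = refl

    prod-update : ∀ γ {r} δ {xs ks} → map p xs ≡ ks → r ∉ ks → prod (update γ r δ) xs ≈ prod γ xs
    prod-update γ {r} δ {xs} q r∉ = prod-cong xs
      (λ i → ≈-reflexive (update-≢ γ δ (λ { refl → r∉ (map-∈ p q i) })))

    -- In quasigroup terms: the operation of the circle depends on its arguments over `ks` only
    -- through their product.
    Gained : (E → Carrier) → List (Fin m) → List (Fin m) → Set
    Gained γ ks rs = ∀ {xs xs′ ys} → map p xs ≡ ks → map p xs′ ≡ ks → map p ys ≡ rs →
                     prod γ xs ≈ prod γ xs′ → B (xs ++ ys) → B (xs′ ++ ys)

    Determined : (E → Carrier) → List (Fin m) → Set
    Determined γ fs = ∀ {xs} → map p xs ≡ fs → B xs → prod γ xs ≈ ε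

    neutral : ∀ γ ks → (∀ {f} → f ∈ ks → Bij γ f) → Σ (List E) λ os → map p os ≡ ks × prod γ os ≈ ε
    neutral γ []       b = [] , refl , ≈-refl
    neutral γ (k ∷ ks) b with proj₂ (b (here refl)) ε | neutral γ ks (b ∘ there)
    ... | o , q , r | os , qs , rs = o ∷ os , cong₂ _∷_ q qs , ≈-trans (∙-cong r rs) (identityˡ ε)

    -- The lift `y` of `r` is moved to the base point `o`, at the price of a right factor at `e₁`.
    -- The lifts `os` in between have product `ε`, so the factor passes them without conjugation.
    record Translation (γ : E → Carrier) (e₁ : Fin m) (ks : List (Fin m)) (r l : Fin m) (rs : List (Fin m)) : Set where
      field
        γᵣ      : E → Carrier
        γᵣ-bij  : Bij γᵣ r
        o       : E
        o-over  : p o ≡ r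
        os      : List E
        os-over : map p os ≡ ks
        os-ε    : prod γ os ≈ ε
        exchange : ∀ {x x′ y} (qx : p x ≡ e₁) (qx′ : p x′ ≡ e₁) (qy : p y ≡ r) →
                   γ x′ ≈ γ x ∙ γᵣ y → ∀ {zs} → map p zs ≡ rs →
                   Exchange.Rel {l = l} os-over qx qx′ qy o-over zs

    module Extend {γ : E → Carrier} {e₁ r l : Fin m} {ks rs : List (Fin m)}
                  (C : CircList ((e₁ ∷ ks) ++ r ∷ rs ++ [ l ])) (bij : Bij γ e₁)
                  (gained : Gained γ (e₁ ∷ ks) (r ∷ rs ++ [ l ])) (T : Translation γ e₁ ks r l rs) where
      open Translation T

      γ′ : E → Carrier
      γ′ = update γ r γᵣ

      r∉ : r ∉ e₁ ∷ ks
      r∉ i = proj₂ (proj₂ (unique-++⁻ (e₁ ∷ ks) (circList-unique C))) i (here refl)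

      prod-γ′ : ∀ {xs y} → map p xs ≡ e₁ ∷ ks → p y ≡ r → prod γ′ (xs ++ [ y ]) ≈ prod γ xs ∙ γᵣ y
      prod-γ′ {xs} {y} q qy = ≈-trans (prod-++ γ′ xs [ y ])
        (∙-cong (prod-update γ γᵣ q r∉) (≈-trans (identityʳ _) (≈-reflexive (update-≡ γ γᵣ qy))))

      -- Each side determines its last lift uniquely, so the implication `exchange` can be reversed.
      backward : ∀ {x x′ y} (qx : p x ≡ e₁) (qx′ : p x′ ≡ e₁) (qy : p y ≡ r) → γ x′ ≈ γ x ∙ γᵣ y →
                 ∀ {zs} → map p zs ≡ rs → ∀ {w} → p w ≡ l →
                 B (x′ ∷ os ++ o ∷ zs ++ [ w ]) → B (x ∷ os ++ y ∷ zs ++ [ w ])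
      backward {x} {x′} {y} qx qx′ qy g {zs} qz {w} qw bal =
        subst (λ w → B (x ∷ os ++ y ∷ zs ++ [ w ])) w₀≡w (subst B (assoc² x y w₀) bal₀)
        where
        assoc² : ∀ {A : Set} (x y w : A) {as bs} → (x ∷ as ++ y ∷ bs) ++ [ w ] ≡ x ∷ as ++ y ∷ bs ++ [ w ]
        assoc² x y w {as} = cong (x ∷_) (++-assoc as _ _)
        C′ = subst CircList (sym (assoc² e₁ r l)) C
        sol = solveLast C′ (cong₂ _∷_ qx (map-++-≡ p os-over (cong₂ _∷_ qy qz)))
        sol′ = solveLast C′ (cong₂ _∷_ qx′ (map-++-≡ p os-over (cong₂ _∷_ o-over qz)))
        w₀ = proj₁ sol
        qw₀ = proj₁ (proj₁ (proj₂ sol))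
        bal₀ = proj₂ (proj₁ (proj₂ sol))
        w₀≡w : w₀ ≡ w
        w₀≡w = trans (proj₂ (proj₂ sol′) w₀ qw₀
            (subst B (sym (assoc² x′ o w₀)) (exchange qx qx′ qy g qz qw₀ (subst B (assoc² x y w₀) bal₀))))
          (sym (proj₂ (proj₂ sol′) w qw (subst B (sym (assoc² x′ o w)) bal)))

      -- Both lifts are brought to a normal form `x₂ , os , o` with the whole gain at `e₁`; equal
      -- products lead to the same `x₂`.
      extended : Gained γ′ ((e₁ ∷ ks) ++ [ r ]) (rs ++ [ l ])
      extended {xys} {xys′} {ys} q q′ qy g bal
        with map-split p xys (e₁ ∷ ks) q | map-split p xys′ (e₁ ∷ ks) q′ | map-split p ys rs qy
      ... | xs , (y ∷ []) , refl , qxs , qr | xs′ , (y′ ∷ []) , refl , qxs′ , qr′ | zs , (w ∷ []) , refl , qz , ql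
        = subst B (sym (++-assoc xs′ [ y′ ] _))
          (gained (cong₂ _∷_ qx₁′ os-over) qxs′ rest′ (head-prod γx₁′)
            (backward qx₁′ qx₂ qy₁′ γx₂′ qz qw
              (exchange qx₁ qx₂ qy₁ γx₂ qz qw
                (gained qxs (cong₂ _∷_ qx₁ os-over) rest (≈-sym (head-prod γx₁))
                  (subst B (++-assoc xs [ y ] _) bal)))))
        where
        qy₁ = proj₁ (∷-injective qr)
        qy₁′ = proj₁ (∷-injective qr′)
        qw = proj₁ (∷-injective ql)
        rest = cong₂ _∷_ qy₁ (map-++-≡ p qz ql)
        rest′ = cong₂ _∷_ qy₁′ (map-++-≡ p qz ql)
        sol₁ = proj₂ bij (prod γ xs)
        sol₁′ = proj₂ bij (prod γ xs′)
        sol₂ = proj₂ bij (prod γ xs ∙ γᵣ y)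
        qx₁ = proj₁ (proj₂ sol₁)
        γx₁ = proj₂ (proj₂ sol₁)
        qx₁′ = proj₁ (proj₂ sol₁′)
        γx₁′ = proj₂ (proj₂ sol₁′)
        qx₂ = proj₁ (proj₂ sol₂)
        γx₂ : γ (proj₁ sol₂) ≈ γ (proj₁ sol₁) ∙ γᵣ y
        γx₂ = ≈-trans (proj₂ (proj₂ sol₂)) (∙-congʳ (≈-sym γx₁))
        γx₂′ : γ (proj₁ sol₂) ≈ γ (proj₁ sol₁′) ∙ γᵣ y′
        γx₂′ = ≈-trans (proj₂ (proj₂ sol₂)) (≈-trans (≈-sym (prod-γ′ qxs qy₁))
          (≈-trans g (≈-trans (prod-γ′ qxs′ qy₁′) (∙-congʳ (≈-sym γx₁′)))))
        head-prod : ∀ {x g} → γ x ≈ g → γ x ∙ prod γ os ≈ g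
        head-prod q = ≈-trans (∙-congˡ os-ε) (≈-trans (identityʳ _) q)

    module Close {γ : E → Carrier} {e₁ l : Fin m} {ks : List (Fin m)}
                 (C : CircList ((e₁ ∷ ks) ++ [ l ])) (bij : ∀ {f} → f ∈ e₁ ∷ ks → Bij γ f)
                 (gained : Gained γ (e₁ ∷ ks) [ l ]) where

      private
        nt = neutral γ ks (bij ∘ there)
        os = proj₁ nt
        os-over = proj₁ (proj₂ nt)
        os-ε = proj₂ (proj₂ nt)

        first : ∀ {w} → p w ≡ l → Σ E λ x → (p x ≡ e₁ × B (x ∷ os ++ [ w ])) ×
                (∀ y → p y ≡ e₁ → B (y ∷ os ++ [ w ]) → y ≡ x)
        first qw = solveFirst C (map-++-≡ p os-over (cong [_] qw))

      -- Exactly one `x` followed by the neutral `os` closes up with `w`, and the gain of `w` has to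
      -- invert that of `x`. Off the fibre of `l` the value is a default.
      γₗ : E → Carrier
      γₗ w with p w ≟ l
      ... | yes q = γ (proj₁ (first q)) ⁻¹
      ... | no _  = ε

      γₗ-value : ∀ {x w} → p x ≡ e₁ → p w ≡ l → B (x ∷ os ++ [ w ]) → γₗ w ≈ γ x ⁻¹
      γₗ-value {x} {w} qx qw bal with p w ≟ l
      ... | yes q = ⁻¹-cong (≈-reflexive (cong γ (sym (proj₂ (proj₂ (first q)) x qx bal))))
      ... | no ¬q = ⊥-elim (¬q qw)

      last : ∀ {x} → p x ≡ e₁ → Σ E λ w → (p w ≡ l × B (x ∷ os ++ [ w ])) ×
             (∀ y → p y ≡ l → B (x ∷ os ++ [ y ]) → y ≡ w)
      last qx = solveLast C (cong₂ _∷_ qx os-over)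

      γₗ-bij : Bij γₗ l
      γₗ-bij = inj , λ g →
        let (x , qx , r) = proj₂ (bij (here refl)) (g ⁻¹)
            (w , (qw , bal) , _) = last qx
        in w , qw , ≈-trans (γₗ-value qx qw bal) (≈-trans (⁻¹-cong r) (⁻¹-involutive g))
        where
        inj : Inj γₗ l
        inj {w} {w′} q q′ r with first q | first q′
        ... | x , (qx , bal) , _ | x′ , (qx′ , bal′) , _ =
          trans (proj₂ (proj₂ (last qx)) w q bal)
            (sym (proj₂ (proj₂ (last qx)) w′ q′ (subst (λ x → B (x ∷ os ++ [ w′ ])) (sym x≡x′) bal′)))
          where
          x≡x′ : x ≡ x′
          x≡x′ = proj₁ (bij (here refl)) qx qx′ (⁻¹-injective
            (≈-trans (≈-sym (γₗ-value qx q bal)) (≈-trans r (γₗ-value qx′ q′ bal′))))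

      closed : ∀ {xs w} → map p xs ≡ e₁ ∷ ks → p w ≡ l → B (xs ++ [ w ]) → prod γ xs ∙ γₗ w ≈ ε
      closed {xs} {w} q qw bal with proj₂ (bij (here refl)) (prod γ xs)
      ... | x , qx , r = ≈-trans (∙-congˡ (≈-trans
          (γₗ-value qx qw (gained q (cong₂ _∷_ qx os-over) (cong [_] qw)
            (≈-trans (≈-sym r) (≈-sym (≈-trans (∙-congˡ os-ε) (identityʳ _)))) bal)) (⁻¹-cong r)))
        (inverseʳ _)

    -- In the minor that keeps e₁, e₂, r and l, let A g be the value of α at the lift of e₁ of gain g.
    -- Since α x ∙ β y only depends on γ x ∙ γ y, we have A (g h) = A g ∙ (A ε)⁻¹ ∙ A h, so that moving the
    -- lift of r into e₁ multiplies gains by a factor that does not depend on the lift of e₁.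
    translate : ∀ {γ e₁ e₂ r l ks rs} → CircList ((e₁ ∷ e₂ ∷ ks) ++ r ∷ rs ++ [ l ]) →
                (∀ {f} → f ∈ e₁ ∷ e₂ ∷ ks → Bij γ f) →
                Gained γ (e₁ ∷ e₂ ∷ ks) (r ∷ rs ++ [ l ]) → Translation γ e₁ (e₂ ∷ ks) r l rs
    translate {γ} {e₁} {e₂} {r} {l} {ks} {rs} C bij gained = record
      { γᵣ = γᵣ ; γᵣ-bij = γᵣ-inj , γᵣ-onto ; o = oᵣ ; o-over = proj₂ τr ; os = o₂ ∷ os
      ; os-over = cong₂ _∷_ qo₂ os-over
      ; os-ε = ≈-trans (∙-cong γo₂ os-ε) (identityˡ ε)
      ; exchange = λ qx qx′ qy g qz → Exchange.changeAll (cong₂ _∷_ qo₂ os-over) qx qx′ qy (proj₂ τr) [] rs C refl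
          (map-τ₀ rs) qz (pair qx qx′ qy g) }
      where
      τr = IsBiasedExpansion.surj be r
      oᵣ = proj₁ τr
      z₀ = map τ₀ rs
      nt = neutral γ ks (bij ∘ there ∘ there)
      os = proj₁ nt
      os-over = proj₁ (proj₂ nt)
      os-ε = proj₂ (proj₂ nt)
      sol₁ = proj₂ (bij (here refl)) ε
      o₁ = proj₁ sol₁
      qo₁ = proj₁ (proj₂ sol₁)
      γo₁ = proj₂ (proj₂ sol₁)
      sol₂ = proj₂ (bij (there (here refl))) ε
      o₂ = proj₁ sol₂
      qo₂ = proj₁ (proj₂ sol₂)
      γo₂ = proj₂ (proj₂ sol₂)
      ft = fourTerms [] ks rs C refl os-over (map-τ₀ rs)
      module F = FourTerms ft
      open Balance C {v₁ = []} refl os-over (map-τ₀ rs) ft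
      A = F.α
      D = F.β
      Γ = F.γ

      -- The bridge from `G` to the group of the minor: pairs of equal product in `G` are
      -- interchangeable by `gained`, and interchangeable pairs have equal product in the minor.
      product-≈ : ∀ {x y x′ y′} → p x ≡ e₁ → p y ≡ e₂ → p x′ ≡ e₁ → p y′ ≡ e₂ →
                  γ x ∙ γ y ≈ γ x′ ∙ γ y′ → A x F.∙ D y F.≈ A x′ F.∙ D y′
      product-≈ {x} {y} {x′} {y′} qx qy qx′ qy′ g with solve₄ C {v₁ = []} refl os-over (map-τ₀ rs) qx qy (proj₂ τr)
      ... | w , (qw , bal) , _ = pair-≈ qx qy qx′ qy′ (proj₂ τr) qw bal
        (gained {x ∷ y ∷ os} {x′ ∷ y′ ∷ os} (cong₂ _∷_ qx (cong₂ _∷_ qy os-over)) (cong₂ _∷_ qx′ (cong₂ _∷_ qy′ os-over))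
          (cong₂ _∷_ (proj₂ τr) (map-++-≡ p (map-τ₀ rs) (cong [_] qw)))
          (≈-trans (≈-sym (assoc _ _ _)) (≈-trans (∙-congʳ g) (assoc _ _ _))) bal)

      -- The equation is solved for the lift of `e₁` that, followed by `o₂` and `oᵣ`, has in the
      -- minor the value of `o₁`, `o₂`, `y`. As `o₁` has gain `ε`, the gain of this lift in `G` is
      -- what `y` is worth.
      moved : ∀ y → Σ E λ x → p x ≡ e₁ × A x F.≈ (A o₁ F.∙ (D o₂ F.∙ Γ y)) F.∙ (D o₂ F.∙ Γ oᵣ) F.⁻¹
      moved y = proj₂ F.α-bij _

      γᵣ : E → Carrier
      γᵣ y = γ (proj₁ (moved y))

      moved-≈ : ∀ y → A (proj₁ (moved y)) F.∙ (D o₂ F.∙ Γ oᵣ) F.≈ A o₁ F.∙ (D o₂ F.∙ Γ y)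
      moved-≈ y = F.≈-trans (F.∙-congʳ (proj₂ (proj₂ (moved y))))
        (F.≈-trans (F.assoc _ _ _) (F.≈-trans (F.∙-congˡ (F.inverseˡ _)) (F.identityʳ _)))

      γᵣ-inj : Inj γᵣ r
      γᵣ-inj {y} {y′} q q′ g = proj₁ F.γ-bij q q′ (F.∙-cancelˡ _ _ _ (F.∙-cancelˡ _ _ _
        (F.≈-trans (F.≈-sym (moved-≈ y)) (F.≈-trans (F.∙-congʳ (F.≈-reflexive (cong A same))) (moved-≈ y′)))))
        where
        same = proj₁ (bij (here refl)) (proj₁ (proj₂ (moved y))) (proj₁ (proj₂ (moved y′))) g

      γᵣ-onto : Onto γᵣ r
      γᵣ-onto g with proj₂ (bij (here refl)) g
      ... | x , qx , gx with proj₂ F.γ-bij ((A o₁ F.∙ D o₂) F.⁻¹ F.∙ (A x F.∙ (D o₂ F.∙ Γ oᵣ)))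
      ... | y , qy , gy = y , qy , ≈-trans (≈-reflexive (cong γ same)) gx
        where
        same : proj₁ (moved y) ≡ x
        same = proj₁ F.α-bij (proj₁ (proj₂ (moved y))) qx (F.∙-cancelʳ _ _ _ (F.≈-trans (moved-≈ y)
          (F.≈-trans (F.≈-sym (F.assoc _ _ _)) (F.≈-trans (F.∙-congˡ gy)
            (F.≈-trans (F.≈-sym (F.assoc _ _ _)) (F.≈-trans (F.∙-congʳ (F.inverseʳ _)) (F.identityˡ _)))))))

      pair : ∀ {x x′ y} (qx : p x ≡ e₁) (qx′ : p x′ ≡ e₁) (qy : p y ≡ r) → γ x′ ≈ γ x ∙ γᵣ y →
             ∀ {w} → p w ≡ l → B (x ∷ (o₂ ∷ os) ++ y ∷ z₀ ++ [ w ]) → B (x′ ∷ (o₂ ∷ os) ++ oᵣ ∷ z₀ ++ [ w ])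
      pair {x} {x′} {y} qx qx′ qy g {w} qw bal = balance⁻ qx′ qo₂ (proj₂ τr) qw (begin
        A x′ F.∙ (D o₂ F.∙ (Γ oᵣ F.∙ δw))                        ≈⟨ out (A x′) (D o₂) (Γ oᵣ) δw ⟩
        ((A x′ F.∙ D o₂) F.∙ Γ oᵣ) F.∙ δw                        ≈⟨ F.∙-congʳ (F.∙-congʳ (product-≈ qx qk₂ qx′ qo₂ step₁)) ⟨
        ((A x F.∙ D k₂) F.∙ Γ oᵣ) F.∙ δw                         ≈⟨ F.∙-congʳ (F.assoc _ _ _) ⟩
        (A x F.∙ (D k₂ F.∙ Γ oᵣ)) F.∙ δw                         ≈⟨ F.∙-congʳ (F.∙-congˡ k₂-≈) ⟩
        (A x F.∙ (D o₂ F.∙ Γ y)) F.∙ δw                          ≈⟨ F.∙-congʳ (F.assoc _ _ _) ⟨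
        ((A x F.∙ D o₂) F.∙ Γ y) F.∙ δw                          ≈⟨ out (A x) (D o₂) (Γ y) δw ⟨
        A x F.∙ (D o₂ F.∙ (Γ y F.∙ δw))                          ≈⟨ F.balance qx qo₂ qy qw bal ⟩
        F.ε                                                      ∎)
        where
        open SetoidReasoning F.≈-setoid
        δw = F.δ w
        -- `k₂` parks the gain of `y` on `e₂`: in the minor `k₂ , oᵣ` is worth `o₂ , y`, while
        -- `x , k₂` has the product of `x′ , o₂` in `G`. Associativity in the minor joins the two.
        h = proj₂ (bij (there (here refl))) (γᵣ y)
        k₂ = proj₁ h
        qk₂ = proj₁ (proj₂ h)
        γk₂ = proj₂ (proj₂ h)
        out : ∀ a b c d → a F.∙ (b F.∙ (c F.∙ d)) F.≈ ((a F.∙ b) F.∙ c) F.∙ d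
        out a b c d = F.≈-trans (F.≈-sym (F.assoc _ _ _)) (F.≈-sym (F.assoc _ _ _))
        step₁ : γ x ∙ γ k₂ ≈ γ x′ ∙ γ o₂
        step₁ = ≈-trans (∙-congˡ γk₂) (≈-trans (≈-sym g) (≈-sym (≈-trans (∙-congˡ γo₂) (identityʳ _))))
        step₂ : γ o₁ ∙ γ k₂ ≈ γᵣ y ∙ γ o₂
        step₂ = ≈-trans (∙-cong γo₁ γk₂) (≈-trans (identityˡ _) (≈-sym (≈-trans (∙-congˡ γo₂) (identityʳ _))))
        k₂-≈ : D k₂ F.∙ Γ oᵣ F.≈ D o₂ F.∙ Γ y
        k₂-≈ = F.∙-cancelˡ _ _ _ (F.≈-trans (F.≈-sym (F.assoc _ _ _))
          (F.≈-trans (F.∙-congʳ (product-≈ qo₁ qk₂ (proj₁ (proj₂ (moved y))) qo₂ step₂))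
            (F.≈-trans (F.assoc _ _ _) (moved-≈ y))))

    Agrees : (E → Carrier) → (E → Carrier) → List (Fin m) → Set
    Agrees γ γ′ ks = ∀ {x} → p x ∈ ks → γ′ x ≡ γ x

    update-agrees : ∀ γ {r} δ {ks} → r ∉ ks → Agrees γ (update γ r δ) ks
    update-agrees γ δ r∉ i = update-≢ γ δ (λ { refl → r∉ i })

    update-bij : ∀ {γ r δ} ks → r ∉ ks → (∀ {f} → f ∈ ks → Bij γ f) → Bij δ r →
                 ∀ {f} → f ∈ ks ++ [ r ] → Bij (update γ r δ) f
    update-bij {γ} {r} {δ} ks r∉ b br i with ∈-++⁻ ks i
    ... | inj₁ k           = Bij-cong (λ { refl → ≈-reflexive (sym (update-agrees γ δ r∉ k)) }) (b k)
    ... | inj₂ (here refl) = Bij-cong (λ q → ≈-reflexive (sym (update-≡ γ δ q))) br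

    -- `agrees` matters for ears: the gains over `ks` are those of the subgraph built so far and
    -- must not change.
    record CircleGain (γ : E → Carrier) (ks rs : List (Fin m)) : Set where
      field
        γ′         : E → Carrier
        agrees     : Agrees γ γ′ ks
        bijective  : ∀ {f} → f ∈ ks ++ rs → Bij γ′ f
        determined : Determined γ′ (ks ++ rs)

    closeGain : ∀ {γ e₁ ks l} → CircList ((e₁ ∷ ks) ++ [ l ]) → (∀ {f} → f ∈ e₁ ∷ ks → Bij γ f) →
                Gained γ (e₁ ∷ ks) [ l ] → CircleGain γ (e₁ ∷ ks) [ l ]
    closeGain {γ} {e₁} {ks} {l} C bij gained = record
      { γ′ = γ′ ; agrees = update-agrees γ γₗ l∉
      ; bijective = update-bij (e₁ ∷ ks) l∉ bij γₗ-bij ; determined = det }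
      where
      open Close C bij gained
      γ′ = update γ l γₗ
      l∉ : l ∉ e₁ ∷ ks
      l∉ i = proj₂ (proj₂ (unique-++⁻ (e₁ ∷ ks) (circList-unique C))) i (here refl)
      det : Determined γ′ ((e₁ ∷ ks) ++ [ l ])
      det {xs} q bal with map-split p xs (e₁ ∷ ks) q
      ... | ys , (w ∷ []) , refl , qys , qw = ≈-trans (prod-++ γ′ ys [ w ])
        (≈-trans (∙-cong (prod-update γ γₗ qys l∉)
          (≈-trans (identityʳ _) (≈-reflexive (update-≡ γ γₗ (proj₁ (∷-injective qw))))))
          (closed qys (proj₁ (∷-injective qw)) bal))

    -- Two edges with gains are demanded at the outset because `translate` compares their products
    -- with a minor. The last edge needs no minor, since its gain is forced by closing the circle.
    gainRest : ∀ {γ} e₁ e₂ ks r rs → CircList ((e₁ ∷ e₂ ∷ ks) ++ r ∷ rs) →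
               (∀ {f} → f ∈ e₁ ∷ e₂ ∷ ks → Bij γ f) → Gained γ (e₁ ∷ e₂ ∷ ks) (r ∷ rs) →
               CircleGain γ (e₁ ∷ e₂ ∷ ks) (r ∷ rs)
    gainRest e₁ e₂ ks r [] C bij gained = closeGain C bij gained
    gainRest {γ} e₁ e₂ ks r (s ∷ rs) C bij gained with snocView s rs
    ... | zs , l , q = record
      { γ′ = R.γ′
      ; agrees = λ i → trans (R.agrees (∈-++⁺ˡ i)) (update-agrees γ γᵣ X.r∉ i)
      ; bijective = λ {f} i → R.bijective (subst (f ∈_) (sym (++-assoc (e₁ ∷ e₂ ∷ ks) [ r ] (s ∷ rs))) i)
      ; determined = subst (Determined R.γ′) (++-assoc (e₁ ∷ e₂ ∷ ks) [ r ] (s ∷ rs)) R.determined }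
      where
      C′ = subst (λ t → CircList ((e₁ ∷ e₂ ∷ ks) ++ r ∷ t)) q C
      gained′ : Gained γ (e₁ ∷ e₂ ∷ ks) (r ∷ zs ++ [ l ])
      gained′ = subst (λ t → Gained γ (e₁ ∷ e₂ ∷ ks) (r ∷ t)) q gained
      T = translate C′ bij gained′
      open Translation T using (γᵣ; γᵣ-bij)
      module X = Extend C′ (bij (here refl)) gained′ T
      module R = CircleGain (gainRest {X.γ′} e₁ e₂ (ks ++ [ r ]) s rs
        (subst CircList (sym (++-assoc (e₁ ∷ e₂ ∷ ks) [ r ] (s ∷ rs))) C)
        (update-bij (e₁ ∷ e₂ ∷ ks) X.r∉ bij γᵣ-bij)
        (λ {xs} {xs′} {ys} a b c → subst (Gained X.γ′ ((e₁ ∷ e₂ ∷ ks) ++ [ r ])) (sym q) X.extended {xs} {xs′} {ys} a b c))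

  record GainedCircle (fs : List (Fin m)) : Set₁ where
    field
      G : Group 0ℓ 0ℓ
    open Gain G
    field
      γ          : E → Carrier
      bijective  : ∀ {f} → f ∈ fs → Bij γ f
      determined : Determined G γ fs

  -- `G` is the group of the minor that keeps `e₁`, `e₂`, `e₃` and the last edge. Over `e₁` alone,
  -- equal gains mean equal lifts. The second edge is out of reach of `translate`, so its
  -- translation is read off from this minor directly.
  gainCircle : ∀ {e₁ e₂ e₃ e₄ fs} → CircList (e₁ ∷ e₂ ∷ e₃ ∷ e₄ ∷ fs) →
               GainedCircle (e₁ ∷ e₂ ∷ e₃ ∷ e₄ ∷ fs)
  gainCircle {e₁} {e₂} {e₃} {e₄} {fs} C with snocView e₄ fs
  ... | zs , l , q = record { G = G ; γ = R.γ′ ; bijective = R.bijective ; determined = R.determined }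
    where
    C′ : CircList (e₁ ∷ e₂ ∷ e₃ ∷ zs ++ [ l ])
    C′ = subst (λ t → CircList (e₁ ∷ e₂ ∷ e₃ ∷ t)) q C
    ft = fourTerms [] [] zs C′ refl refl (map-τ₀ zs)
    open FourTerms ft
    open Balance C′ {v₁ = []} {v₂ = []} refl refl (map-τ₀ zs) ft
    o : E
    o = τ₀ e₂
    qo : p o ≡ e₂
    qo = proj₂ (IsBiasedExpansion.surj be e₂)
    -- Normalised to `ε` at `o`, so that `α x′ ≈ α x ∙ βᵣ y` says `α x′ ∙ β o ≈ α x ∙ β y`.
    βᵣ : E → Carrier
    βᵣ y = β y ∙ β o ⁻¹
    cancel : ∀ g h → (g ∙ h ⁻¹) ∙ h ≈ g
    cancel g h = ≈-trans (assoc _ _ _) (≈-trans (∙-congˡ (inverseˡ h)) (identityʳ g))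
    βᵣ-onto : Onto βᵣ e₂
    βᵣ-onto g with proj₂ β-bij (g ∙ β o)
    ... | y , qy , r = y , qy , ≈-trans (∙-congʳ r)
      (≈-trans (assoc _ _ _) (≈-trans (∙-congˡ (inverseʳ _)) (identityʳ g)))
    T : Translation G α e₁ [] e₂ l (e₃ ∷ zs)
    T = record
      { γᵣ = βᵣ
      ; γᵣ-bij = (λ s t r → proj₁ β-bij s t (∙-cancelʳ _ _ _ r)) , βᵣ-onto
      ; o = o ; o-over = qo ; os = [] ; os-over = refl ; os-ε = ≈-refl
      ; exchange = λ {x} {x′} {y} qx qx′ qy g qz →
          Exchange.changeAll {os = []} refl qx qx′ qy qo [] (e₃ ∷ zs) C′
            {[]} {map τ₀ (e₃ ∷ zs)} refl (map-τ₀ (e₃ ∷ zs)) qz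
            (λ qw → pair-B qx qy qx′ qo (proj₂ (IsBiasedExpansion.surj be e₃)) qw
              (≈-sym (≈-trans (∙-congʳ g) (≈-trans (assoc _ _ _) (∙-congˡ (cancel _ _)))))) }
    gained₁ : Gained G α [ e₁ ] (e₂ ∷ (e₃ ∷ zs) ++ [ l ])
    gained₁ {x ∷ []} {x′ ∷ []} {ys} qx qx′ qy g = subst (λ x → B (x ∷ ys))
      (proj₁ α-bij (proj₁ (∷-injective qx)) (proj₁ (∷-injective qx′)) (∙-cancelʳ _ _ _ g))
    module X = Extend G {γ = α} {e₁} {e₂} {l} {[]} {e₃ ∷ zs} C′ α-bij gained₁ T
    gained₂ : Gained G X.γ′ (e₁ ∷ e₂ ∷ []) (e₃ ∷ e₄ ∷ fs)
    gained₂ = subst (λ t → Gained G X.γ′ (e₁ ∷ e₂ ∷ []) (e₃ ∷ t)) (sym q) X.extended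
    bij₁ : ∀ {f} → f ∈ [ e₁ ] → Bij α f
    bij₁ (here refl) = α-bij
    module R = CircleGain (gainRest G e₁ e₂ [] e₃ (e₄ ∷ fs) C
      (update-bij G [ e₁ ] X.r∉ bij₁ (Translation.γᵣ-bij T)) gained₂)

-- Two disjoint paths and ears

module Subgraphs {n m : ℕ} (Δ : Graph (Fin n) (Fin m)) where
  open Walks Δ
  open import Data.List.Membership.DecPropositional (_≟_ {n = n}) using (_∈?_)

  infix 4 _⊆ₑ_
  _⊆ₑ_ : ∀ {u v} → Walk Δ u v → List (Fin m) → Set
  W ⊆ₑ H = ∀ {f} → f ∈ ed W → f ∈ H

  ⊆ₑ-⋯ : ∀ {u v w H} (W : Walk Δ u v) (X : Walk Δ v w) → W ⊆ₑ H → X ⊆ₑ H → (W ⋯ X) ⊆ₑ H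
  ⊆ₑ-⋯ W X a b i with ∈ed-⋯⁻ W X i
  ... | inj₁ k = a k
  ... | inj₂ k = b k

  -- A single edge satisfies these conditions too, which allows the initial circle to be treated as
  -- an ear.
  record Sub (N : List (Fin n)) (H : List (Fin m)) : Set where
    field
      ends  : ∀ {f s t} → f ∈ H → Joins Δ f s t → s ∈ N × t ∈ N
      noCut : ∀ x {u v} → u ∈ N → v ∈ N → u ≢ x → v ≢ x →
              Σ (Walk Δ u v) λ W → W ⊆ₑ H × x ∉ vs W

    walk-nodes : ∀ {u v} (W : Walk Δ u v) → u ∈ N → W ⊆ₑ H → ∀ {x} → x ∈ vs W → x ∈ N
    walk-nodes []           u∈ s (here refl) = u∈
    walk-nodes (step e j W) u∈ s (here refl) = u∈
    walk-nodes (step e j W) u∈ s (there i)   = walk-nodes W (proj₂ (ends (s (here refl)) j)) (s ∘ there) i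

  record Three (N : List (Fin n)) : Set where
    field
      {a b c} : Fin n
      a∈ : a ∈ N
      b∈ : b ∈ N
      c∈ : c ∈ N
      a≢b : a ≢ b
      a≢c : a ≢ c
      b≢c : b ≢ c

    third : ∀ u v → Σ (Fin n) λ x → x ∈ N × x ≢ u × x ≢ v
    third u v with a ≟ u | a ≟ v | b ≟ u | b ≟ v
    ... | no p  | no q  | _     | _     = a , a∈ , p , q
    ... | yes _ | _     | no r  | no s  = b , b∈ , r , s
    ... | no _  | yes _ | no r  | no s  = b , b∈ , r , s
    ... | yes p | _     | yes r | _     = ⊥-elim (a≢b (trans p (sym r)))
    ... | _     | yes q | _     | yes s = ⊥-elim (a≢b (trans q (sym s)))
    ... | yes p | _     | no _  | yes s = c , c∈ , (λ r → a≢c (trans p (sym r))) , (λ r → b≢c (trans s (sym r)))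
    ... | no _  | yes q | yes r | no _  = c , c∈ , (λ p → b≢c (trans r (sym p))) , (λ p → a≢c (trans q (sym p)))

  -- The bound `long` keeps `P` and `Q` from sharing an edge, and it supplies the two edges with
  -- known gains from which `gainRest` starts.
  record Linked (H : List (Fin m)) (u v : Fin n) : Set where
    field
      P Q    : Walk Δ u v
      P-path : IsPath Δ P
      Q-path : IsPath Δ Q
      P⊆     : P ⊆ₑ H
      Q⊆     : Q ⊆ₑ H
      meet   : MeetAtEnds P Q
      long   : 2 ≤ length (ed P)

    edges-disjoint : u ≢ v → Disjoint (ed P) (ed Q)
    edges-disjoint u≢v i k with sharedEdge P Q u≢v P-path Q-path meet i k
    ... | q , _ with subst (λ l → 2 ≤ length l) q long
    ... | s≤s ()

  module _ {N H} (S : Sub N H) where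
    open Sub S

    -- `v` lies on the circle formed by `A` and `C`: one path runs back to `w` and along `C`, the
    -- other onward along `A`.
    reroute : ∀ {v w u} (A C : Walk Δ w u) → IsPath Δ A → IsPath Δ C → A ⊆ₑ H → C ⊆ₑ H →
              MeetAtEnds A C → w ≢ u → v ≢ w → v ≢ u → v ∈ vs A → Linked H v u
    reroute {v} {w} {u} A C pA pC A⊆ C⊆ meet w≢u v≢w v≢u v∈A with split A v∈A
    ... | A₁ , A₂ , refl with path-⋯⁻ A₁ A₂ pA
    ... | pA₁ , pA₂ , d = record
      { P = rev A₁ ⋯ C ; Q = A₂
      ; P-path = path-⋯⁺ (rev A₁) C (path-rev A₁ pA₁) pC meet₁
      ; Q-path = pA₂
      ; P⊆ = ⊆ₑ-⋯ (rev A₁) C (λ i → A⊆ (∈ed-⋯ˡ A₁ A₂ (∈ed-rev A₁ i))) C⊆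
      ; Q⊆ = λ i → A⊆ (∈ed-⋯ʳ A₁ A₂ i)
      ; meet = λ i k → meet₂ (∈vs-⋯⁻ (rev A₁) C i) k
      ; long = length-⋯ (rev A₁) C (nonempty-length (rev A₁) v≢w) (nonempty-length C w≢u) }
      where
      meet₁ : ∀ {x} → x ∈ vs (rev A₁) → x ∈ vs C → x ≡ w
      meet₁ i k with meet (∈vs-⋯ˡ A₁ A₂ (∈vs-rev A₁ i)) k
      ... | inj₁ q    = q
      ... | inj₂ refl = ⊥-elim (v≢u (sym (d (∈vs-rev A₁ i) (end∈ A₂))))
      meet₂ : ∀ {x} → x ∈ vs (rev A₁) ⊎ x ∈ vs C → x ∈ vs A₂ → x ≡ v ⊎ x ≡ u
      meet₂ (inj₁ i) k = inj₁ (d (∈vs-rev A₁ i) k)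
      meet₂ (inj₂ i) k with meet (∈vs-⋯ʳ A₁ A₂ k) i
      ... | inj₁ refl = ⊥-elim (v≢w (sym (d (start∈ A₁) k)))
      ... | inj₂ q    = inj₂ q

    -- `v` lies off the circle: one path takes the edge to `w` and then `C`, the other takes `R` and
    -- joins `A` beyond `w`.
    attach : ∀ {v w u z e} (j : Joins Δ e v w) (A C : Walk Δ w u) → e ∈ H → IsPath Δ A → IsPath Δ C →
             A ⊆ₑ H → C ⊆ₑ H → MeetAtEnds A C → w ≢ u → v ∉ vs C →
             (R : Walk Δ v z) → IsPath Δ R → R ⊆ₑ H → z ∈ vs A → z ≢ w →
             (∀ {x} → x ∈ verts Δ R → ¬ (x ∈ vs A ⊎ x ∈ vs C)) → Linked H v u
    attach {v} {w} {u} {z} {e} j A C e∈ pA pC A⊆ C⊆ meet w≢u v∉C R pR R⊆ z∈A z≢w avoid with split A z∈A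
    ... | A₁ , A₂ , refl with path-⋯⁻ A₁ A₂ pA
    ... | pA₁ , pA₂ , d = record
      { P = step e j C ; Q = R ⋯ A₂
      ; P-path = ∉⇒All≢ v∉C ∷ pC
      ; Q-path = path-⋯⁺ R A₂ pR pA₂ RA₂
      ; P⊆ = λ { (here refl) → e∈ ; (there i) → C⊆ i }
      ; Q⊆ = ⊆ₑ-⋯ R A₂ R⊆ (λ i → A⊆ (∈ed-⋯ʳ A₁ A₂ i))
      ; meet = λ { (here refl) k → inj₁ refl ; (there i) k → inj₂ (meet′ i (∈vs-⋯⁻ R A₂ k)) }
      ; long = s≤s (nonempty-length C w≢u) }
      where
      RA₂ : ∀ {x} → x ∈ vs R → x ∈ vs A₂ → x ≡ z
      RA₂ i k with vs⁻ R i
      ... | inj₁ l = ⊥-elim (avoid l (inj₁ (∈vs-⋯ʳ A₁ A₂ k)))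
      ... | inj₂ q = q
      meetA : ∀ {x} → x ∈ vs C → x ∈ vs A₂ → x ≡ u
      meetA i k with meet (∈vs-⋯ʳ A₁ A₂ k) i
      ... | inj₁ refl = ⊥-elim (z≢w (sym (d (start∈ A₁) k)))
      ... | inj₂ q    = q
      meet′ : ∀ {x} → x ∈ vs C → x ∈ vs R ⊎ x ∈ vs A₂ → x ≡ u
      meet′ i (inj₂ k) = meetA i k
      meet′ i (inj₁ k) with vs⁻ R k
      ... | inj₁ l    = ⊥-elim (avoid l (inj₂ i))
      ... | inj₂ refl = meetA i (start∈ A₂)

    flip : ∀ {u v} {P Q : Walk Δ u v} → MeetAtEnds P Q → MeetAtEnds Q P
    flip meet i k = meet k i

    extendLink : ∀ {v w u e} → Joins Δ e v w → e ∈ H → v ∈ N → u ∈ N → w ≢ u → v ≢ w → v ≢ u →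
                 Linked H w u → Linked H v u
    extendLink {v} {w} {u} {e} j e∈ v∈ u∈ w≢u v≢w v≢u L with v ∈? vs (Linked.P L) | v ∈? vs (Linked.Q L)
    ... | yes i | _ = reroute P Q P-path Q-path P⊆ Q⊆ meet w≢u v≢w v≢u i
      where open Linked L
    ... | no _ | yes i = reroute Q P Q-path P-path Q⊆ P⊆ (flip {P = P} {Q} meet) w≢u v≢w v≢u i
      where open Linked L
    ... | no v∉P | no v∉Q with noCut w v∈ u∈ v≢w (λ q → w≢u (sym q))
    ... | W , W⊆ , w∉ with toPath _≟_ W
    ... | R₀ , pR₀ , ed⊆ , vs⊆ with firstHit onCircle? R₀ (inj₁ (end∈ (Linked.P L)))
      where
      onCircle? : ∀ x → Dec (x ∈ vs (Linked.P L) ⊎ x ∈ vs (Linked.Q L))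
      onCircle? x with x ∈? vs (Linked.P L) | x ∈? vs (Linked.Q L)
      ... | yes i | _     = yes (inj₁ i)
      ... | no _  | yes i = yes (inj₂ i)
      ... | no a  | no b  = no λ { (inj₁ i) → a i ; (inj₂ i) → b i }
    ... | z , R , X , refl , hit , avoid = finish hit
      where
      open Linked L
      pR = proj₁ (path-⋯⁻ R X pR₀)
      R⊆ : R ⊆ₑ H
      R⊆ i = W⊆ (ed⊆ (∈ed-⋯ˡ R X i))
      z≢w : z ≢ w
      z≢w refl = w∉ (vs⊆ (∈vs-⋯ˡ R X (end∈ R)))
      finish : z ∈ vs P ⊎ z ∈ vs Q → Linked H v u
      finish (inj₁ i) = attach j P Q e∈ P-path Q-path P⊆ Q⊆ meet w≢u v∉Q R pR R⊆ i z≢w avoid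
      finish (inj₂ i) = attach j Q P e∈ Q-path P-path Q⊆ P⊆ (flip {P = P} {Q} meet) w≢u v∉P R pR R⊆ i z≢w
        (λ { l (inj₁ k) → avoid l (inj₂ k) ; l (inj₂ k) → avoid l (inj₁ k) })

    -- The second path is drawn from a walk through a third node. It cannot be a single edge, since
    -- `X` avoids `u` and `Y` avoids `v`.
    baseLink : Three N → ∀ {v u e} → Joins Δ e v u → e ∈ H → v ∈ N → u ∈ N → v ≢ u → Linked H v u
    baseLink T {v} {u} {e} j e∈ v∈ u∈ v≢u with Three.third T v u
    ... | x , x∈ , x≢v , x≢u with noCut u v∈ x∈ v≢u x≢u | noCut v x∈ u∈ x≢v (λ q → v≢u (sym q))
    ... | X , X⊆ , u∉X | Y , Y⊆ , v∉Y with toPath _≟_ (X ⋯ Y)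
    ... | P , pP , ed⊆ , _ = record
      { P = P ; Q = step e j [] ; P-path = pP ; Q-path = (v≢u ∷ []) ∷ [] ∷ []
      ; P⊆ = λ i → ⊆ₑ-⋯ X Y X⊆ Y⊆ (ed⊆ i)
      ; Q⊆ = λ { (here refl) → e∈ }
      ; meet = λ { _ (here q) → inj₁ q ; _ (there (here q)) → inj₂ q }
      ; long = long P ed⊆ }
      where
      long : (P : Walk Δ v u) → (∀ {f} → f ∈ ed P → f ∈ ed (X ⋯ Y)) → 2 ≤ length (ed P)
      long [] s = ⊥-elim (v≢u refl)
      long (step f k []) s with ∈ed-⋯⁻ X Y (s (here refl))
      ... | inj₁ i = ⊥-elim (u∉X (proj₂ (ends∈ X i k)))
      ... | inj₂ i = ⊥-elim (v∉Y (proj₁ (ends∈ Y i k)))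
      long (step f k (step g l W)) s = s≤s (s≤s z≤n)

    -- Menger's theorem for two paths, by induction along a walk between the given nodes.
    link-walk : Three N → ∀ {v u} (W : Walk Δ v u) → W ⊆ₑ H → v ∈ N → u ∈ N → v ≢ u → Linked H v u
    link-walk T [] s v∈ u∈ v≢u = ⊥-elim (v≢u refl)
    link-walk T {v} {u} (step {w = w} e j W) s v∈ u∈ v≢u with w ≟ u
    ... | yes refl = baseLink T j (s (here refl)) v∈ u∈ v≢u
    ... | no w≢u with v ≟ w
    ... | yes refl = link-walk T W (s ∘ there) v∈ u∈ v≢u
    ... | no v≢w = extendLink j (s (here refl)) v∈ u∈ w≢u v≢w v≢u
      (link-walk T W (s ∘ there) (proj₂ (ends (s (here refl)) j)) u∈ w≢u)

    link : Three N → ∀ {v u} → v ∈ N → u ∈ N → v ≢ u → Linked H v u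
    link T {v} {u} v∈ u∈ v≢u with Three.third T v u
    ... | x , _ , x≢v , x≢u with noCut x v∈ u∈ (λ q → x≢v (sym q)) (λ q → x≢u (sym q))
    ... | W , s , _ = link-walk T W s v∈ u∈ v≢u

    addEar : ∀ {a b} (P : Walk Δ a b) → IsPath Δ P → a ∈ N → b ∈ N → Sub (vs P ++ N) (ed P ++ H)
    addEar {a} {b} P pP a∈ b∈ = record { ends = ends′ ; noCut = noCut′ }
      where
      ends′ : ∀ {f s t} → f ∈ ed P ++ H → Joins Δ f s t → s ∈ vs P ++ N × t ∈ vs P ++ N
      ends′ i j with ∈-++⁻ (ed P) i
      ... | inj₁ k = ∈-++⁺ˡ (proj₁ (ends∈ P k j)) , ∈-++⁺ˡ (proj₂ (ends∈ P k j))
      ... | inj₂ k = ∈-++⁺ʳ (vs P) (proj₁ (ends k j)) , ∈-++⁺ʳ (vs P) (proj₂ (ends k j))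
      Anchor : Fin n → Fin n → Set
      Anchor x u = Σ (Fin n) λ c → c ∈ N × c ≢ x × Σ (Walk Δ u c) λ W → W ⊆ₑ ed P ++ H × x ∉ vs W
      -- On the ear, `x` lies on at most one side of `u`, so the other side leads to `a` or to `b`.
      anchor : ∀ x {u} → u ∈ vs P ++ N → u ≢ x → Anchor x u
      anchor x {u} i u≢x with ∈-++⁻ (vs P) i
      ... | inj₂ k = u , k , u≢x , [] , (λ ()) , λ { (here q) → u≢x (sym q) }
      ... | inj₁ k with split P k
      ... | P₁ , P₂ , refl with x ∈? vs P₁
      ... | no x∉ = a , a∈ , (λ { refl → x∉ (start∈ P₁) }) , rev P₁ ,
            (λ i → ∈-++⁺ˡ (∈ed-⋯ˡ P₁ P₂ (∈ed-rev P₁ i))) , (λ i → x∉ (∈vs-rev P₁ i))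
      ... | yes x∈₁ = b , b∈ , (λ { refl → x∉₂ (end∈ P₂) }) , P₂ , (λ i → ∈-++⁺ˡ (∈ed-⋯ʳ P₁ P₂ i)) , x∉₂
        where
        x∉₂ : x ∉ vs P₂
        x∉₂ x∈₂ = u≢x (sym (proj₂ (proj₂ (path-⋯⁻ P₁ P₂ pP)) x∈₁ x∈₂))
      noCut′ : ∀ x {u v} → u ∈ vs P ++ N → v ∈ vs P ++ N → u ≢ x → v ≢ x →
               Σ (Walk Δ u v) λ W → W ⊆ₑ ed P ++ H × x ∉ vs W
      noCut′ x u∈ v∈ u≢x v≢x with anchor x u∈ u≢x | anchor x v∈ v≢x
      ... | c , c∈ , c≢x , W , W⊆ , x∉W | d , d∈ , d≢x , X , X⊆ , x∉X with noCut x c∈ d∈ c≢x d≢x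
      ... | Y , Y⊆ , x∉Y = W ⋯ Y ⋯ rev X ,
        ⊆ₑ-⋯ W (Y ⋯ rev X) W⊆ (⊆ₑ-⋯ Y (rev X) (λ i → ∈-++⁺ʳ (ed P) (Y⊆ i)) (λ i → X⊆ (∈ed-rev X i))) ,
        λ i → avoid (∈vs-⋯⁻ W (Y ⋯ rev X) i)
        where
        avoid : x ∈ vs W ⊎ x ∈ vs (Y ⋯ rev X) → ⊥
        avoid (inj₁ i) = x∉W i
        avoid (inj₂ i) with ∈vs-⋯⁻ Y (rev X) i
        ... | inj₁ k = x∉Y k
        ... | inj₂ k = x∉X (∈vs-rev X k)

  singleEdge : ∀ {s t d} → Joins Δ d s t → Sub (s ∷ t ∷ []) [ d ]
  singleEdge {s} {t} {d} j = record { ends = λ { (here refl) k → both (joins-unique j k) } ; noCut = noCut }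
    where
    both : ∀ {x y} → (s ≡ x × t ≡ y) ⊎ (s ≡ y × t ≡ x) → x ∈ s ∷ t ∷ [] × y ∈ s ∷ t ∷ []
    both (inj₁ (refl , refl)) = here refl , there (here refl)
    both (inj₂ (refl , refl)) = there (here refl) , here refl
    noCut : ∀ x {u v} → u ∈ s ∷ t ∷ [] → v ∈ s ∷ t ∷ [] → u ≢ x → v ≢ x →
            Σ (Walk Δ u v) λ W → W ⊆ₑ [ d ] × x ∉ vs W
    noCut x (here refl) (here refl) a b = [] , (λ ()) , λ { (here q) → a (sym q) }
    noCut x (there (here refl)) (there (here refl)) a b = [] , (λ ()) , λ { (here q) → a (sym q) }
    noCut x (here refl) (there (here refl)) a b = step d j [] , id ,
      λ { (here q) → a (sym q) ; (there (here q)) → b (sym q) }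
    noCut x (there (here refl)) (here refl) a b = step d (swap j) [] , id ,
      λ { (here q) → a (sym q) ; (there (here q)) → b (sym q) }

-- Extending gains by one edge

module _ {V E : Set} {g : Graph V E} where
  open Walks g

  -- For a loop both constructors can apply, with opposite signs. Otherwise an edge and its two ends
  -- fix the sign of a step, and with it the gain.
  joins-irrelevant : ∀ {e u w} → u ≢ w → (j k : Joins g e u w) → j ≡ k
  joins-irrelevant u≢w (inj₁ q) (inj₁ r) = cong inj₁ (≡-irrelevant q r)
  joins-irrelevant u≢w (inj₁ q) (inj₂ r) = ⊥-elim (u≢w (cong proj₁ (trans (sym q) r)))
  joins-irrelevant u≢w (inj₂ q) (inj₁ r) = ⊥-elim (u≢w (cong proj₁ (trans (sym r) q)))
  joins-irrelevant u≢w (inj₂ q) (inj₂ r) = cong inj₂ (≡-irrelevant q r)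

  twoPaths-circ : ∀ {u t v h} {k : Joins g h u t} (P : Walk g t v) (Q : Walk g u v) →
                  IsPath g (step h k P) → IsPath g Q → MeetAtEnds (step h k P) Q →
                  Disjoint (ed (step h k P)) (ed Q) → IsCirc h k (P ⋯ rev Q)
  twoPaths-circ {u} {v = v} {h} {k} P Q (a ∷ pP) pQ meet d = isCirc
    (path-⋯⁺ P (rev Q) pP (path-rev Q pQ) (λ i l → ends i (meet (there i) (∈vs-rev Q l))))
    (λ i → new (∈ed-⋯⁻ P (rev Q) i))
    where
    ends : ∀ {x} → x ∈ vs P → x ≡ u ⊎ x ≡ v → x ≡ v
    ends i (inj₁ refl) = ⊥-elim (All≢⇒∉ a i)
    ends i (inj₂ q)    = q
    new : h ∈ ed P ⊎ h ∈ ed (rev Q) → ⊥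
    new (inj₁ i) = path-head∉ {j = k} {W = P} (a ∷ pP) i
    new (inj₂ i) = d (here refl) (∈ed-rev Q i)

module Balanced {n m : ℕ} {E : Set} {Δ : Graph (Fin n) (Fin m)} {p : E → Fin m} {B : List E → Set}
         (be : IsBiasedExpansion Δ p B) (G : Group 0ℓ 0ℓ) where
  open Expansion be
  open Subgraphs Δ
  open Gain G
  open import Data.List.Membership.DecPropositional (_≟_ {n = n}) using (_∈?_)
  open import Data.List.Membership.DecPropositional (_≟_ {n = m}) using () renaming (_∈?_ to _∈ₑ?_)

  -- The circles in question are lifts of circles of `Δ`, so digons inside a fibre are left aside.
  -- The converse of `bal` follows as `bal⁻`.
  record Good (H : List (Fin m)) (φ : E → Carrier) : Set where
    field
      bij : ∀ {f} → f ∈ H → Bij φ f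
      bal : ∀ {u w f} {j : Joins Δ f u w} {Q : Walk Δ w u} → IsCirc f j Q → f ∈ H → Q ⊆ₑ H →
            ∀ {x qs} → p x ≡ f → map p qs ≡ ed Q → B (x ∷ qs) → gL φ (step f j Q) (x ∷ qs) ≈ ε

    bal⁻ : ∀ {u w f} {j : Joins Δ f u w} {Q : Walk Δ w u} → IsCirc f j Q → f ∈ H → Q ⊆ₑ H →
           ∀ {x qs} → p x ≡ f → map p qs ≡ ed Q → gL φ (step f j Q) (x ∷ qs) ≈ ε → B (x ∷ qs)
    bal⁻ {j = j} c f∈ Q⊆ {x} {qs} qx q r with solveFirst (circList c refl) q
    ... | y , (qy , b) , _ = subst (λ y → B (y ∷ qs))
      (proj₁ (bij f∈) qy qx (act-injective (sign j)
        (∙-cancelʳ _ _ _ (≈-trans (bal c f∈ Q⊆ qy q b) (≈-sym r))))) b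

    balPaths : ∀ {u v} (P Q : Walk Δ u v) → u ≢ v → IsPath Δ P → IsPath Δ Q → MeetAtEnds P Q →
               Disjoint (ed P) (ed Q) → P ⊆ₑ H → Q ⊆ₑ H → ∀ {xs ys} → map p xs ≡ ed P → map p ys ≡ ed Q →
               gL φ P xs ≈ gL φ Q ys → B (xs ++ reverse ys)
    balPaths [] Q u≢v = ⊥-elim (u≢v refl)
    balPaths (step h k P) Q u≢v pP pQ meet d P⊆ Q⊆ {x ∷ xs} {ys} qx qy r with ∷-injective qx
    ... | refl , q = bal⁻ {j = k} (twoPaths-circ P Q pP pQ meet d) (P⊆ (here refl))
      (⊆ₑ-⋯ P (rev Q) (P⊆ ∘ there) (Q⊆ ∘ ∈ed-rev Q)) refl
      (trans (map-++-≡ p q q′) (sym (ed-⋯ P (rev Q))))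
      (≈-trans (gL-⋯ φ (step h k P) (rev Q) qx)
        (≈-trans (∙-cong r (gL-rev φ Q qy)) (inverseʳ _)))
      where
      q′ : map p (reverse ys) ≡ ed (rev Q)
      q′ = trans (map-reverse-≡ p qy) (sym (ed-rev Q))

  Good-cong : ∀ {H φ ψ} → (∀ {x} → p x ∈ H → ψ x ≈ φ x) → Good H φ → Good H ψ
  Good-cong {H} {φ} {ψ} e gd = record
    { bij = λ f∈ → Bij-cong (λ { refl → ≈-sym (e f∈) }) (bij f∈)
    ; bal = λ {u} {w} {f} {j} {Q} c f∈ Q⊆ qx q b →
        ≈-trans (gL-cong (step f j Q) _ (λ i → e (inH f∈ Q⊆ qx q i))) (bal c f∈ Q⊆ qx q b) }
    where
    open Good gd
    inH : ∀ {f u w} {Q : Walk Δ u w} → f ∈ H → Q ⊆ₑ H → ∀ {x qs} → p x ≡ f → map p qs ≡ ed Q →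
          ∀ {y} → y ∈ x ∷ qs → p y ∈ H
    inH f∈ Q⊆ refl q (here refl) = f∈
    inH f∈ Q⊆ qx   q (there i)   = Q⊆ (map-∈ p q i)

  -- A circle through `f` is rotated until `f` comes first; its gain is only conjugated, so being
  -- trivial is preserved.
  addEdge : ∀ {H φ f} → Good H φ → Bij φ f →
            (∀ {u w} {j : Joins Δ f u w} {Q : Walk Δ w u} → IsCirc f j Q → Q ⊆ₑ H → ∀ {x qs} →
              p x ≡ f → map p qs ≡ ed Q → B (x ∷ qs) → gL φ (step f j Q) (x ∷ qs) ≈ ε) →
            Good (f ∷ H) φ
  addEdge {H} {φ} {f} gd bf new = record
    { bij = λ { (here refl) → bf ; (there i) → bij i } ; bal = bal′ }
    where
    open Good gd
    drop-f : ∀ {u v} {Q : Walk Δ u v} → f ∉ ed Q → Q ⊆ₑ f ∷ H → Q ⊆ₑ H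
    drop-f f∉ s i with s i
    ... | here refl = ⊥-elim (f∉ i)
    ... | there k   = k
    bal′ : ∀ {u w h} {j : Joins Δ h u w} {Q : Walk Δ w u} → IsCirc h j Q → h ∈ f ∷ H → Q ⊆ₑ f ∷ H →
           ∀ {x qs} → p x ≡ h → map p qs ≡ ed Q → B (x ∷ qs) → gL φ (step h j Q) (x ∷ qs) ≈ ε
    bal′ {Q = Q} c (here refl) Q⊆ = new c (drop-f {Q = Q} (IsCirc.new c) Q⊆)
    bal′ {h = h} {j} {Q} c (there h∈) Q⊆ {x} {qs} qx q b with f ∈ₑ? ed Q
    ... | no f∉ = bal c h∈ (drop-f {Q = Q} f∉ Q⊆) qx q b
    ... | yes f∈ with splitEdge Q f∈
    ... | record { before = A ; joins = k ; after = X ; whole = refl }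
        with map-split p qs (ed A) (trans q (ed-⋯ A (step f k X)))
    ... | as , (y ∷ bs) , refl , qa , qb with ∷-injective qb
    ... | qy , qb′ = ≈-trans (gL-⋯ φ (step h j A) (step f k X) (cong₂ _∷_ qx qa))
      (ε-rotate (≈-trans (≈-sym (gL-⋯ φ (step f k X) (step h j A) {y ∷ bs} qb))
        (new c′ (drop-f {Q = X ⋯ step h j A} (IsCirc.new c′) sub) qy
          (trans (map-++-≡ p qb′ (cong₂ _∷_ qx qa)) (sym (ed-⋯ X (step h j A))))
          (B-rotate (circList c (cong (h ∷_) (ed-⋯ A (step f k X)))) (cong₂ _∷_ qx qa) qb b))))
      where
      c′ = rotate {A = A} {j′ = k} {B = X} c
      sub : (X ⋯ step h j A) ⊆ₑ f ∷ H
      sub i with ∈ed-⋯⁻ X (step h j A) i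
      ... | inj₁ l           = Q⊆ (∈ed-⋯ʳ A (step f k X) (there l))
      ... | inj₂ (here refl) = there h∈
      ... | inj₂ (there l)   = Q⊆ (∈ed-⋯ˡ A (step f k X) l)

  pendant : ∀ {H φ f u w} → Good H φ → Bij φ f → Joins Δ f u w → u ≢ w →
            (∀ {h s t} → h ∈ H → Joins Δ h s t → s ≢ u) → Good (f ∷ H) φ
  pendant {H} {φ} {f} {u} {w} gd bf j u≢w free = addEdge gd bf none
    where
    clash : ∀ {x y} (X : Walk Δ x y) → x ≡ u → x ≢ y → X ⊆ₑ H → ⊥
    clash X refl x≢y s with walk-firstEdge _≟_ X x≢y
    ... | h , _ , h∈ , l = free (s h∈) l refl
    none : ∀ {s t} {k : Joins Δ f s t} {Q : Walk Δ t s} → IsCirc f k Q → Q ⊆ₑ H → ∀ {x qs} →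
           p x ≡ f → map p qs ≡ ed Q → B (x ∷ qs) → gL φ (step f k Q) (x ∷ qs) ≈ ε
    none {k = k} {Q} c Q⊆ _ _ _ with joins-unique k j
    ... | inj₁ (refl , refl) = ⊥-elim (clash (rev Q) refl u≢w (Q⊆ ∘ ∈ed-rev Q))
    ... | inj₂ (refl , refl) = ⊥-elim (clash Q refl u≢w Q⊆)

  -- Edges are added from the end `b` backwards. Each brings a node that no earlier edge meets, so
  -- no new circle arises.
  addPath : ∀ {N H φ a b} → Sub N H → Good H φ → (R : Walk Δ a b) → IsPath Δ R →
            (∀ {x} → x ∈ verts Δ R → x ∉ N) → (∀ {f} → f ∈ ed R → Bij φ f) → Good (ed R ++ H) φ
  addPath S gd [] pR out bR = gd
  addPath {N} {H} {a = u} S gd (step f j R) (q ∷ pR) out bR =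
    pendant (addPath S gd R pR (out ∘ there) (bR ∘ there)) (bR (here refl)) j
      (λ { refl → All≢⇒∉ q (start∈ R) }) free
    where
    free : ∀ {h s t} → h ∈ ed R ++ H → Joins Δ h s t → s ≢ u
    free i k refl with ∈-++⁻ (ed R) i
    ... | inj₁ l = All≢⇒∉ q (proj₁ (ends∈ R l k))
    ... | inj₂ l = out (here refl) (proj₁ (Sub.ends S l k))

  -- Whether circles through f are balanced exactly by gain is independent of the path that closes f up:
  -- any path is turned into any other one by replacing a segment A₀₁ with a segment A₁ disjoint from
  -- the rest, and each replacement is a theta graph with A₁ ∪ A₀₁ inside H.
  module Reroute {H φ f u w} (gd : Good H φ) (f∉ : f ∉ H) (j : Joins Δ f u w) where
    open Good gd

    Inv : Walk Δ w u → Set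
    Inv Q = ∀ {x qs} → p x ≡ f → map p qs ≡ ed Q → B (x ∷ qs) → gL φ (step f j Q) (x ∷ qs) ≈ ε

    module Theta {a z} (Z : Walk Δ w a) (A₁ A₀₁ : Walk Δ a z) (A₀₂ : Walk Δ z u) (a≢z : a ≢ z)
                 (p₀ : IsPath Δ (Z ⋯ A₀₁ ⋯ A₀₂)) (p₁ : IsPath Δ (Z ⋯ A₁ ⋯ A₀₂))
                 (meet : MeetAtEnds A₁ A₀₁) (ed-disj : Disjoint (ed A₁) (ed A₀₁))
                 (Z⊆ : Z ⊆ₑ H) (A₁⊆ : A₁ ⊆ₑ H) (A₀₁⊆ : A₀₁ ⊆ₑ H) (A₀₂⊆ : A₀₂ ⊆ₑ H) where

      p₀′ = path-⋯⁻ Z (A₀₁ ⋯ A₀₂) p₀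
      p₁′ = path-⋯⁻ Z (A₁ ⋯ A₀₂) p₁
      p₀″ = path-⋯⁻ A₀₁ A₀₂ (proj₁ (proj₂ p₀′))
      p₁″ = path-⋯⁻ A₁ A₀₂ (proj₁ (proj₂ p₁′))

      Y : Walk Δ w z
      Y = step f (swap j) (rev A₀₂)

      X : Walk Δ a z
      X = rev Z ⋯ Y

      Z-A₀₂ : ∀ {x} → x ∈ vs Z → x ∈ vs A₀₂ → ⊥
      Z-A₀₂ i k with refl ← proj₂ (proj₂ p₀′) i (∈vs-⋯ʳ A₀₁ A₀₂ k) =
        a≢z (proj₂ (proj₂ p₀″) (start∈ A₀₁) k)

      X-path : IsPath Δ X
      X-path = path-⋯⁺ (rev Z) Y (path-rev Z (proj₁ p₀′))
        (∉⇒All≢ (λ i → Z-A₀₂ (start∈ Z) (∈vs-rev A₀₂ i)) ∷ path-rev A₀₂ (proj₁ (proj₂ p₀″)))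
        (λ { _ (here q) → q ; i (there k) → ⊥-elim (Z-A₀₂ (∈vs-rev Z i) (∈vs-rev A₀₂ k)) })

      X⁻ : ∀ {x} → x ∈ vs X → x ∈ vs Z ⊎ x ∈ vs A₀₂
      X⁻ i with ∈vs-⋯⁻ (rev Z) Y i
      ... | inj₁ k           = inj₁ (∈vs-rev Z k)
      ... | inj₂ (here refl) = inj₁ (start∈ Z)
      ... | inj₂ (there k)   = inj₂ (∈vs-rev A₀₂ k)

      X-ed⁻ : ∀ {h} → h ∈ ed X → h ∈ ed Z ⊎ h ≡ f ⊎ h ∈ ed A₀₂
      X-ed⁻ i with ∈ed-⋯⁻ (rev Z) Y i
      ... | inj₁ k         = inj₁ (∈ed-rev Z k)
      ... | inj₂ (here q)  = inj₂ (inj₁ q)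
      ... | inj₂ (there k) = inj₂ (inj₂ (∈ed-rev A₀₂ k))

      meet-X : (A : Walk Δ a z) → (∀ {x} → x ∈ vs Z → x ∈ vs A → x ≡ a) →
               (∀ {x} → x ∈ vs A → x ∈ vs A₀₂ → x ≡ z) → MeetAtEnds A X
      meet-X A dZ d₂ i k with X⁻ k
      ... | inj₁ l = inj₁ (dZ l i)
      ... | inj₂ l = inj₂ (d₂ i l)

      disj-X : (A : Walk Δ a z) → IsPath Δ (Z ⋯ A ⋯ A₀₂) → A ⊆ₑ H → Disjoint (ed A) (ed X)
      disj-X A pA A⊆ i k with X-ed⁻ k
      ... | inj₁ l           = path-ed-disjoint Z (A ⋯ A₀₂) pA l (∈ed-⋯ˡ A A₀₂ i)
      ... | inj₂ (inj₁ refl) = f∉ (A⊆ i)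
      ... | inj₂ (inj₂ l)    = path-ed-disjoint A A₀₂ (proj₁ (proj₂ (path-⋯⁻ Z (A ⋯ A₀₂) pA))) i l

      circ : (A : Walk Δ a z) → IsPath Δ (Z ⋯ A ⋯ A₀₂) → A ⊆ₑ H →
             CircList ((f ∷ ed Z) ++ (ed A ++ ed A₀₂))
      circ A pA A⊆ = circList {j = j} (isCirc pA (λ i → f∉ (⊆ₑ-⋯ Z (A ⋯ A₀₂) Z⊆ (⊆ₑ-⋯ A A₀₂ A⊆ A₀₂⊆) i)))
        (cong (f ∷_) (trans (ed-⋯ Z (A ⋯ A₀₂)) (cong (ed Z ++_) (ed-⋯ A A₀₂))))

      reverse-X : ∀ {x : E} zs as → reverse (reverse zs ++ x ∷ reverse as) ≡ as ++ x ∷ zs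
      reverse-X {x} zs as = begin
        reverse (reverse zs ++ x ∷ reverse as)              ≡⟨ reverse-++ (reverse zs) (x ∷ reverse as) ⟩
        reverse (x ∷ reverse as) ++ reverse (reverse zs)    ≡⟨ cong₂ _++_ (unfold-reverse x (reverse as)) (reverse-involutive zs) ⟩
        (reverse (reverse as) ++ [ x ]) ++ zs               ≡⟨ cong (λ l → (l ++ [ x ]) ++ zs) (reverse-involutive as) ⟩
        (as ++ [ x ]) ++ zs                                 ≡⟨ ++-assoc as [ x ] zs ⟩
        as ++ x ∷ zs                                        ∎
        where open ≡-Reasoning

      gain-split : (A : Walk Δ a z) → ∀ {x zs as bs} → map p zs ≡ ed Z → map p as ≡ ed A →
                   gL φ (step f j (Z ⋯ A ⋯ A₀₂)) (x ∷ zs ++ as ++ bs) ≈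
                   act (sign j) (φ x) ∙ (gL φ Z zs ∙ (gL φ A as ∙ gL φ A₀₂ bs))
      gain-split A qz qa = ∙-congˡ (≈-trans (gL-⋯ φ Z (A ⋯ A₀₂) qz) (∙-congˡ (gL-⋯ φ A A₀₂ qa)))

      -- The lift of `A₁` is traded for a lift of `A₀₁` with the same gain. Together they form a
      -- circle within `H` that is balanced by `balPaths`, and the theta property with `X` carries
      -- balance over to the circle where `inv` applies.
      theta-move : Inv (Z ⋯ A₀₁ ⋯ A₀₂) → Inv (Z ⋯ A₁ ⋯ A₀₂)
      theta-move inv {x} {qs} qx q b
        with map-split p qs (ed Z) (trans q (ed-⋯ Z (A₁ ⋯ A₀₂)))
      ... | zs , rs , refl , qz , qr with map-split p rs (ed A₁) (trans qr (ed-⋯ A₁ A₀₂))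
      ... | as , bs , refl , qa , qb with liftOfGain φ A₀₁ a≢z (λ i → proj₂ (bij (A₀₁⊆ i))) (gL φ A₁ as)
      ... | cs , qc , gc = ≈-trans (gain-split A₁ qz qa)
          (≈-trans (∙-congˡ (∙-congˡ (∙-congʳ (≈-sym gc))))
            (≈-trans (≈-sym (gain-split A₀₁ qz qc))
              (inv qx (trans (map-++-≡ p qz (map-++-≡ p qc qb))
                        (sym (trans (ed-⋯ Z (A₀₁ ⋯ A₀₂)) (cong (ed Z ++_) (ed-⋯ A₀₁ A₀₂))))) b₀)))
        where
        qX : map p (reverse zs ++ x ∷ reverse bs) ≡ ed X
        qX = trans (map-++-≡ p (map-reverse-≡ p qz) (cong₂ _∷_ qx (map-reverse-≡ p qb)))
          (sym (trans (ed-⋯ (rev Z) Y) (cong₂ _++_ (ed-rev Z) (cong (f ∷_) (ed-rev A₀₂)))))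
        toTheta : ∀ as → as ++ reverse (reverse zs ++ x ∷ reverse bs) ≡ (as ++ bs) ++ x ∷ zs
        toTheta as = trans (cong (as ++_) (reverse-X zs bs)) (sym (++-assoc as bs (x ∷ zs)))
        b₁ : B ((as ++ bs) ++ x ∷ zs)
        b₁ = B-rotate (circ A₁ p₁ A₁⊆) (cong₂ _∷_ qx qz) (map-++-≡ p qa qb) b
        b₂ : B (cs ++ reverse (reverse zs ++ x ∷ reverse bs))
        b₂ = theta-lifts a≢z A₁ A₀₁ X (proj₁ p₁″) (proj₁ p₀″) X-path meet
          (λ {x} → meet-X A₁ (λ i k → proj₂ (proj₂ p₁′) i (∈vs-⋯ˡ A₁ A₀₂ k)) (proj₂ (proj₂ p₁″)))
          (λ {x} → meet-X A₀₁ (λ i k → proj₂ (proj₂ p₀′) i (∈vs-⋯ˡ A₀₁ A₀₂ k)) (proj₂ (proj₂ p₀″)))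
          ed-disj (disj-X A₁ p₁ A₁⊆) (disj-X A₀₁ p₀ A₀₁⊆) qa qc qX
          (balPaths A₁ A₀₁ a≢z (proj₁ p₁″) (proj₁ p₀″) meet ed-disj A₁⊆ A₀₁⊆ qa qc (≈-sym gc))
          (subst B (sym (toTheta as)) b₁)
        b₀ : B (x ∷ zs ++ cs ++ bs)
        b₀ = B-rotate {ed A₀₁ ++ ed A₀₂} (circList-rotate (f ∷ ed Z) (circ A₀₁ p₀ A₀₁⊆))
          (map-++-≡ p qc qb) (cong₂ _∷_ qx qz) (subst B (toTheta cs) b₂)

    -- Old and new segment meet only at their ends, so they could share an edge only if both were
    -- the single edge `e`; the hypothesis `ed A₀₁ ≢ [ e ]` excludes this and leaves room for
    -- parallel edges.
    moveSegment : ∀ {a b z e} (Z : Walk Δ w a) (A₀₁ : Walk Δ a z) (A₀₂ : Walk Δ z u)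
                  (k : Joins Δ e a b) (A : Walk Δ b z) (A₂ : Walk Δ z u) →
                  IsPath Δ (Z ⋯ A₀₁ ⋯ A₀₂) → IsPath Δ ((Z ⋯ step e k A) ⋯ A₂) →
                  (∀ {x} → x ∈ verts Δ A → x ∉ vs (A₀₁ ⋯ A₀₂)) → ed A₀₁ ≢ [ e ] →
                  Z ⊆ₑ H → A₀₁ ⊆ₑ H → A₀₂ ⊆ₑ H → step e k A ⊆ₑ H →
                  Inv (Z ⋯ A₀₁ ⋯ A₀₂) →
                  Inv ((Z ⋯ step e k A) ⋯ A₀₂) × IsPath Δ ((Z ⋯ step e k A) ⋯ A₀₂)
    moveSegment {a} {z = z} {e} Z A₀₁ A₀₂ k A A₂ p₀ p₁ avoid ne Z⊆ A₀₁⊆ A₀₂⊆ A₁⊆ inv =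
      subst Inv (sym (⋯-assoc Z A₁ A₀₂)) (theta-move inv) , subst (IsPath Δ) (sym (⋯-assoc Z A₁ A₀₂)) pZA₁A₀₂
      where
      A₁ = step e k A
      pZA₁ = proj₁ (path-⋯⁻ (Z ⋯ A₁) A₂ p₁)
      pA₁ = proj₁ (proj₂ (path-⋯⁻ Z A₁ pZA₁))
      ZA₁ = proj₂ (proj₂ (path-⋯⁻ Z A₁ pZA₁))
      pA₀ = proj₁ (proj₂ (path-⋯⁻ Z (A₀₁ ⋯ A₀₂) p₀))
      ZA₀ = proj₂ (proj₂ (path-⋯⁻ Z (A₀₁ ⋯ A₀₂) p₀))
      pA₀₁ = proj₁ (path-⋯⁻ A₀₁ A₀₂ pA₀)
      pA₀₂ = proj₁ (proj₂ (path-⋯⁻ A₀₁ A₀₂ pA₀))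
      A₀₁A₀₂ = proj₂ (proj₂ (path-⋯⁻ A₀₁ A₀₂ pA₀))
      a≢z : a ≢ z
      a≢z refl with () ← path-closed A₁ pA₁
      a∉A₀₂ : a ∉ vs A₀₂
      a∉A₀₂ i = a≢z (A₀₁A₀₂ (start∈ A₀₁) i)
      A₁A₀₂ : ∀ {x} → x ∈ vs A₁ → x ∈ vs A₀₂ → x ≡ z
      A₁A₀₂ (here refl) l = ⊥-elim (a∉A₀₂ l)
      A₁A₀₂ (there i) l with vs⁻ A i
      ... | inj₁ i′ = ⊥-elim (avoid i′ (∈vs-⋯ʳ A₀₁ A₀₂ l))
      ... | inj₂ q  = q
      pZA₁A₀₂ : IsPath Δ (Z ⋯ A₁ ⋯ A₀₂)
      pZA₁A₀₂ = path-⋯⁺ Z (A₁ ⋯ A₀₂) (proj₁ (path-⋯⁻ Z A₁ pZA₁)) (path-⋯⁺ A₁ A₀₂ pA₁ pA₀₂ A₁A₀₂)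
        (λ i l → at-a i (∈vs-⋯⁻ A₁ A₀₂ l))
        where
        at-a : ∀ {x} → x ∈ vs Z → x ∈ vs A₁ ⊎ x ∈ vs A₀₂ → x ≡ a
        at-a i (inj₁ l) = ZA₁ i l
        at-a i (inj₂ l) = ZA₀ i (∈vs-⋯ʳ A₀₁ A₀₂ l)
      meet : MeetAtEnds A₁ A₀₁
      meet (here q)  l = inj₁ q
      meet (there i) l with vs⁻ A i
      ... | inj₁ i′ = ⊥-elim (avoid i′ (∈vs-⋯ˡ A₀₁ A₀₂ l))
      ... | inj₂ q  = inj₂ q
      ed-disj : Disjoint (ed A₁) (ed A₀₁)
      ed-disj i l with sharedEdge A₁ A₀₁ a≢z pA₁ pA₀₁ meet i l
      ... | q , r = ne (trans r (cong [_] (sym (proj₁ (∷-injective q)))))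
      open Theta Z A₁ A₀₁ A₀₂ a≢z p₀ pZA₁A₀₂ meet ed-disj Z⊆ A₁⊆ A₀₁⊆ A₀₂⊆ using (theta-move)

    -- Induction on the part `A` of the target not yet matched, with `Z` the part already common. A
    -- common first edge joins `Z`; otherwise the target is followed to its first return to the old
    -- path, and that segment is exchanged.
    move : ∀ i {a} (Z : Walk Δ w a) (A₀ A : Walk Δ a u) → length (ed A) ≤ i →
           IsPath Δ (Z ⋯ A₀) → IsPath Δ (Z ⋯ A) → Z ⊆ₑ H → A₀ ⊆ₑ H → A ⊆ₑ H →
           Inv (Z ⋯ A₀) → Inv (Z ⋯ A)
    move i Z A₀ [] _ p₀ p₁ _ _ _ inv =
      subst (λ A → Inv (Z ⋯ A)) (path-closed A₀ (proj₁ (proj₂ (path-⋯⁻ Z A₀ p₀)))) inv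
    move i Z [] (step e k A) _ p₀ p₁ _ _ _ inv
      with () ← path-closed (step e k A) (proj₁ (proj₂ (path-⋯⁻ Z (step e k A) p₁)))
    move (suc i) {a} Z (step e₀ k₀ A₀) (step e k A) (s≤s le) p₀ p₁ Z⊆ A₀⊆ A⊆ inv with e ≟ e₀
    ... | yes refl with joins-unique k k₀ | proj₁ (proj₂ (path-⋯⁻ Z (step e k A) p₁))
    ...   | inj₂ (refl , refl) | pA = ⊥-elim (path-step-≢ {j = k} {W = A} pA refl)
    ...   | inj₁ (refl , refl) | pA
            with refl ← joins-irrelevant {g = Δ} {e} {a} (path-step-≢ {j = k} {W = A} pA) k k₀ =
      subst Inv (⋯-assoc Z S A) (move i (Z ⋯ S) A₀ A le
        (subst (IsPath Δ) (sym (⋯-assoc Z S A₀)) p₀) (subst (IsPath Δ) (sym (⋯-assoc Z S A)) p₁)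
        (⊆ₑ-⋯ Z S Z⊆ (λ { (here refl) → A⊆ (here refl) })) (A₀⊆ ∘ there) (A⊆ ∘ there)
        (subst Inv (sym (⋯-assoc Z S A₀)) inv))
      where
      S = step e k []
    move (suc i) {a} Z (step e₀ k₀ A₀) (step e k A) (s≤s le) p₀ p₁ Z⊆ A₀⊆ A⊆ inv | no e≢e₀
      with firstHit (λ x → x ∈? vs (step e₀ k₀ A₀)) A (end∈ (step e₀ k₀ A₀))
    ... | z , A₁ , A₂ , refl , z∈ , avoid with split (step e₀ k₀ A₀) z∈
    ... | A₀₁ , A₀₂ , r = subst Inv (⋯-assoc Z S A₂)
      (move i (Z ⋯ S) A₀₂ A₂ (≤-trans (subst (length (ed A₂) ≤_) (sym lengths) (m≤n+m _ _)) le)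
        (proj₂ next) p₁′ (⊆ₑ-⋯ Z S Z⊆ S⊆) A₀₂⊆ (λ l → A⊆ (there (∈ed-⋯ʳ A₁ A₂ l))) (proj₁ next))
      where
      S = step e k A₁
      lengths : length (ed (A₁ ⋯ A₂)) ≡ length (ed A₁) + length (ed A₂)
      lengths = trans (cong length (ed-⋯ A₁ A₂)) (length-++ (ed A₁))
      p₁′ : IsPath Δ ((Z ⋯ S) ⋯ A₂)
      p₁′ = subst (IsPath Δ) (sym (⋯-assoc Z S A₂)) p₁
      S⊆ : S ⊆ₑ H
      S⊆ (here refl) = A⊆ (here refl)
      S⊆ (there l)   = A⊆ (there (∈ed-⋯ˡ A₁ A₂ l))
      A₀₂⊆ : A₀₂ ⊆ₑ H
      A₀₂⊆ {h} l = A₀⊆ (subst (λ W → h ∈ ed W) (sym r) (∈ed-⋯ʳ A₀₁ A₀₂ l))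
      ne : ed A₀₁ ≢ [ e ]
      ne q = e≢e₀ (sym (proj₁ (∷-injective (trans (cong ed r) (trans (ed-⋯ A₀₁ A₀₂) (cong (_++ ed A₀₂) q))))))
      next = moveSegment Z A₀₁ A₀₂ k A₁ A₂ (subst (λ W → IsPath Δ (Z ⋯ W)) r p₀) p₁′
        (λ {x} i l → avoid i (subst (λ W → x ∈ vs W) (sym r) l)) ne Z⊆
        (λ {h} l → A₀⊆ (subst (λ W → h ∈ ed W) (sym r) (∈ed-⋯ˡ A₀₁ A₀₂ l))) A₀₂⊆ S⊆
        (subst (λ W → Inv (Z ⋯ W)) r inv)

    close : u ≢ w → (Q : Walk Δ w u) → IsPath Δ Q → Q ⊆ₑ H → Bij φ f → Inv Q → Good (f ∷ H) φ
    close u≢w Q pQ Q⊆ bf inv = addEdge gd bf all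
      where
      inv-all : (X : Walk Δ w u) → IsPath Δ X → X ⊆ₑ H → Inv X
      inv-all X pX X⊆ = move (length (ed X)) [] Q X ≤-refl pQ pX (λ ()) Q⊆ X⊆ inv
      all : ∀ {s t} {k : Joins Δ f s t} {X : Walk Δ t s} → IsCirc f k X → X ⊆ₑ H → ∀ {x qs} →
            p x ≡ f → map p qs ≡ ed X → B (x ∷ qs) → gL φ (step f k X) (x ∷ qs) ≈ ε
      all {k = k} {X} c X⊆ {x} {qs} qx q b with joins-unique k j
      ... | inj₁ (refl , refl) with refl ← joins-irrelevant {g = Δ} {f} u≢w k j = inv-all X (IsCirc.path c) X⊆ qx q b
      -- A circle that traverses `f` against `j` is reversed, which inverts its gain and preserves
      -- balance.
      ... | inj₂ (refl , refl) with refl ← joins-irrelevant {g = Δ} {f} (λ r → u≢w (sym r)) k (swap j) =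
        ≈-trans (∙-congʳ (≈-trans (≈-reflexive (cong (λ b → act b (φ x)) (sign-swap j))) (act-not (sign j) (φ x))))
          (≈-trans (∙-congʳ (⁻¹-cong gx≈gX)) (inverseˡ _))
        where
        q′ : map p (reverse qs) ≡ ed (rev X)
        q′ = trans (map-reverse-≡ p q) (sym (ed-rev X))
        b′ : B (x ∷ reverse qs)
        b′ = B-perm (circList c refl) (circList (reverseCirc c) refl) (cong₂ _∷_ qx q) (cong₂ _∷_ qx q′)
          (prep x (↭-sym (↭-reverse qs))) b
        gx≈gX : act (sign j) (φ x) ≈ gL φ X qs
        gx≈gX = ≈-trans (inverseˡ-unique _ _ (≈-trans (∙-congˡ (≈-sym (gL-rev φ X q)))
          (inv-all (rev X) (path-rev X (IsCirc.path c)) (X⊆ ∘ ∈ed-rev X) qx q′ b′))) (⁻¹-involutive _)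

-- Extending gains along ears

module EarGains {n m : ℕ} {E : Set} {Δ : Graph (Fin n) (Fin m)} {p : E → Fin m} {B : List E → Set}
         (be : IsBiasedExpansion Δ p B) (order4 : Order4 be) (G : Group 0ℓ 0ℓ) where
  open Expansion be
  open Subgraphs Δ
  open Gain G
  open Balanced be G
  open CircleGains be order4
  open import Data.List.Membership.DecPropositional (_≟_ {n = m}) using (_∈?_)

  -- `R` is added as a chain of pendant edges and `e₁` closes it up, hence the split. As `verts`
  -- omits the last node, a chord is the ear with `R` empty.
  record Ear (N : List (Fin n)) (H : List (Fin m)) (a b : Fin n) : Set where
    field
      {w}  : Fin n
      {e₁} : Fin m
      {j}  : Joins Δ e₁ a w
      {R}  : Walk Δ w b
      path : IsPath Δ (step e₁ j R)
      newNodes : ∀ {x} → x ∈ verts Δ R → x ∉ N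
      newEdges : ∀ {f} → f ∈ e₁ ∷ ed R → f ∉ H

    P : Walk Δ a b
    P = step e₁ j R

    a≢w : a ≢ w
    a≢w = path-step-≢ {j = j} {W = R} path

    R-path : IsPath Δ R
    R-path with _ ∷ pR ← path = pR

    e₁∉ : e₁ ∉ ed R ++ H
    e₁∉ i with ∈-++⁻ (ed R) i
    ... | inj₁ k = path-head∉ {j = j} {W = R} path k
    ... | inj₂ k = newEdges (here refl) k

  module _ {N H a b} (S : Sub N H) (a∈ : a ∈ N) (b∈ : b ∈ N) (ear : Ear N H a b) where
    open Ear ear

    back-path : (Q₀ : Walk Δ b a) → IsPath Δ Q₀ → Q₀ ⊆ₑ H → IsPath Δ (R ⋯ Q₀)
    back-path Q₀ pQ Q⊆ = path-⋯⁺ R Q₀ R-path pQ meet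
      where
      meet : ∀ {x} → x ∈ vs R → x ∈ vs Q₀ → x ≡ b
      meet i k with vs⁻ R i
      ... | inj₁ l = ⊥-elim (newNodes l (Sub.walk-nodes S Q₀ b∈ Q⊆ k))
      ... | inj₂ q = q

    ear-circ : (Q₀ : Walk Δ b a) → IsPath Δ Q₀ → Q₀ ⊆ₑ H → IsCirc e₁ j (R ⋯ Q₀)
    ear-circ Q₀ pQ Q⊆ = isCirc (back-path Q₀ pQ Q⊆)
      (λ i → e₁∉ (⊆ₑ-⋯ R Q₀ ∈-++⁺ˡ (λ k → ∈-++⁺ʳ (ed R) (Q⊆ k)) i))

    ear-circList : (Q₀ : Walk Δ b a) → IsPath Δ Q₀ → Q₀ ⊆ₑ H → CircList (ed P ++ ed Q₀)
    ear-circList Q₀ pQ Q⊆ = circList (ear-circ Q₀ pQ Q⊆) (cong (e₁ ∷_) (ed-⋯ R Q₀))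

    closeEar : ∀ {φ} → Good H φ → (Q₀ : Walk Δ b a) → IsPath Δ Q₀ → Q₀ ⊆ₑ H →
               (∀ {f} → f ∈ ed P → Bij φ f) →
               (∀ {xs} → map p xs ≡ ed P ++ ed Q₀ → B xs → gL φ (P ⋯ Q₀) xs ≈ ε) →
               Good (ed P ++ H) φ
    closeEar gd Q₀ pQ Q⊆ bP det =
      Reroute.close (addPath S gd R R-path newNodes (bP ∘ there)) e₁∉ j a≢w (R ⋯ Q₀) (back-path Q₀ pQ Q⊆)
        (⊆ₑ-⋯ R Q₀ ∈-++⁺ˡ (λ k → ∈-++⁺ʳ (ed R) (Q⊆ k))) (bP (here refl))
        (λ qx q bal → det (cong₂ _∷_ qx (trans q (ed-⋯ R Q₀))) bal)

    module _ (Q₀ : Walk Δ b a) (pQ : IsPath Δ Q₀) (Q⊆ : Q₀ ⊆ₑ H) where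

      sg : Fin m → Bool
      sg = signs _≟_ (P ⋯ Q₀)

      sg-signed : SignedBy sg (P ⋯ Q₀)
      sg-signed = signs-signed _≟_ (P ⋯ Q₀) (Circle.uniqE (circle (ear-circ Q₀ pQ Q⊆)))

      -- Gains on a circle are plain products, whereas gains on edges refer to the orientation in
      -- `Δ`. The direction around the circle converts either kind into the other, since `act` with
      -- a fixed sign is an involution.
      signed : (E → Carrier) → E → Carrier
      signed φ x = act (sg (p x)) (φ x)

      signed-bij : ∀ {φ f} → Bij φ f → Bij (signed φ) f
      signed-bij {f = f} b = Bij-cong (λ { refl → ≈-refl }) (Bij-act (sg f) b)

      extendBy : (E → Carrier) → (E → Carrier) → E → Carrier
      extendBy φ γ x with p x ∈? ed P
      ... | yes _ = signed γ x
      ... | no _  = φ x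

      extendBy-new : ∀ φ γ {x} → p x ∈ ed P → extendBy φ γ x ≡ signed γ x
      extendBy-new φ γ {x} i with p x ∈? ed P
      ... | yes _ = refl
      ... | no ¬i = ⊥-elim (¬i i)

      extendBy-old : ∀ φ γ {x} → p x ∈ H → extendBy φ γ x ≡ φ x
      extendBy-old φ γ {x} i with p x ∈? ed P
      ... | yes k = ⊥-elim (newEdges k i)
      ... | no _  = refl

      extendGood : ∀ {φ γ} → Good H φ → (∀ {x} → p x ∈ ed Q₀ → γ x ≈ signed φ x) →
                   (∀ {f} → f ∈ ed P → Bij γ f) → Determined G γ (ed P ++ ed Q₀) →
                   Good (ed P ++ H) (extendBy φ γ)
      extendGood {φ} {γ} gd agree bγ det = closeEar
        (Good-cong (λ i → ≈-reflexive (extendBy-old φ γ i)) gd) Q₀ pQ Q⊆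
        (λ i → Bij-cong (λ { refl → ≈-reflexive (sym (extendBy-new φ γ i)) }) (signed-bij (bγ i)))
        (λ {xs} q bal → ≈-trans (gL-prod (P ⋯ Q₀) sg-signed (trans q (sym (ed-⋯ P Q₀))))
          (≈-trans (prod-cong xs (λ i → value (∈-++⁻ (ed P) (map-∈ p q i)))) (det q bal)))
        where
        value : ∀ {x} → p x ∈ ed P ⊎ p x ∈ ed Q₀ → signed (extendBy φ γ) x ≈ γ x
        value {x} (inj₁ i) = ≈-trans (act-cong (sg (p x)) (≈-reflexive (extendBy-new φ γ i))) (act-involutive (sg (p x)) _)
        value {x} (inj₂ i) = ≈-trans (act-cong (sg (p x)) (≈-reflexive (extendBy-old φ γ (Q⊆ i)))) (≈-sym (agree i))

    gainList : ∀ {γ} ks → 2 ≤ length ks → ∀ r rs → CircList (ks ++ r ∷ rs) → (∀ {f} → f ∈ ks → Bij γ f) →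
               Gained G γ ks (r ∷ rs) → CircleGain G γ ks (r ∷ rs)
    gainList (e ∷ f ∷ ks) _          r rs C b gd = gainRest G e f ks r rs C b gd
    gainList (e ∷ [])     (s≤s ())

    module _ {φ} (gd : Good H φ) (b≢a : b ≢ a) (L : Linked H b a) where
      open Linked L using () renaming (P to Q₀; Q to Q₁; P-path to Q₀-path; Q-path to Q₁-path; P⊆ to Q₀⊆; Q⊆ to Q₁⊆)

      γ₀ : E → Carrier
      γ₀ = signed Q₀ Q₀-path Q₀⊆ φ

      gained-prod : ∀ {xs} → map p xs ≡ ed Q₀ → gL φ Q₀ xs ≈ prod γ₀ xs
      gained-prod = gL-prod Q₀ (proj₂ (SignedBy-⋯⁻ P (sg-signed Q₀ Q₀-path Q₀⊆)))

      meet-P : (Q : Walk Δ b a) → Q ⊆ₑ H → MeetAtEnds Q (rev P)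
      meet-P Q Q⊆ i k with ∈vs-rev P k
      ... | here q  = inj₂ q
      ... | there l with vs⁻ R l
      ...   | inj₁ l′ = ⊥-elim (newNodes l′ (Sub.walk-nodes S Q b∈ Q⊆ i))
      ...   | inj₂ q  = inj₁ q

      disj-P : (Q : Walk Δ b a) → Q ⊆ₑ H → Disjoint (ed Q) (ed (rev P))
      disj-P Q Q⊆ i k = newEdges (∈ed-rev P k) (Q⊆ i)

      meet₁₀ : MeetAtEnds Q₁ Q₀
      meet₁₀ i k = Linked.meet L k i

      d₀₁ : Disjoint (ed Q₀) (ed Q₁)
      d₀₁ = Linked.edges-disjoint L b≢a

      d₁₀ : Disjoint (ed Q₁) (ed Q₀)
      d₁₀ i k = d₀₁ k i

      -- The theta property is applied twice: from `xs` to a lift `zs` of `Q₁` with the same gain,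
      -- and from `zs` back to `xs′`.
      gained₀ : Gained G γ₀ (ed Q₀) (ed P)
      gained₀ {xs} {xs′} {ys} qx qx′ qy g bal
        with liftOfGain φ Q₁ b≢a (λ i → proj₂ (Good.bij gd (Q₁⊆ i))) (gL φ Q₀ xs)
      ... | zs , qz , gz = subst (λ l → B (xs′ ++ l)) (reverse-involutive ys)
        (theta-lifts b≢a Q₁ Q₀ (rev P) Q₁-path Q₀-path (path-rev P path) meet₁₀ (meet-P Q₁ Q₁⊆) (meet-P Q₀ Q₀⊆)
          d₁₀ (disj-P Q₁ Q₁⊆) (disj-P Q₀ Q₀⊆) qz qx′ qP
          (Good.balPaths gd Q₁ Q₀ b≢a Q₁-path Q₀-path meet₁₀ d₁₀ Q₁⊆ Q₀⊆ qz qx′ (≈-trans gz same))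
          (theta-lifts b≢a Q₀ Q₁ (rev P) Q₀-path Q₁-path (path-rev P path) (Linked.meet L) (meet-P Q₀ Q₀⊆)
            (meet-P Q₁ Q₁⊆) d₀₁ (disj-P Q₀ Q₀⊆) (disj-P Q₁ Q₁⊆) qx qz qP
            (Good.balPaths gd Q₀ Q₁ b≢a Q₀-path Q₁-path (Linked.meet L) d₀₁ Q₀⊆ Q₁⊆ qx qz (≈-sym gz))
            (subst (λ l → B (xs ++ l)) (sym (reverse-involutive ys)) bal)))
        where
        qP : map p (reverse ys) ≡ ed (rev P)
        qP = trans (map-reverse-≡ p qy) (sym (ed-rev P))
        same : gL φ Q₀ xs ≈ gL φ Q₀ xs′
        same = ≈-trans (gained-prod qx) (≈-trans g (≈-sym (gained-prod qx′)))

      extendByCircle : CircleGain G γ₀ (ed Q₀) (ed P) → Σ (E → Carrier) (Good (ed P ++ H))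
      extendByCircle CG = extendBy Q₀ Q₀-path Q₀⊆ φ γ′ , extendGood Q₀ Q₀-path Q₀⊆ gd
        (λ i → ≈-reflexive (agrees i)) (λ i → bijective (∈-++⁺ʳ (ed Q₀) i)) det
        where
        open CircleGain CG
        det : Determined G γ′ (ed P ++ ed Q₀)
        det {xs} q bal with map-split p xs (ed P) q
        ... | ps , qs , refl , qp , qq = ≈-trans (prod-++ γ′ ps qs) (ε-rotate
          (≈-trans (≈-sym (prod-++ γ′ qs ps)) (determined (map-++-≡ p qq qp)
            (B-rotate (ear-circList Q₀ Q₀-path Q₀⊆) qp qq bal))))

      addLinkedEar : Σ (E → Carrier) (Good (ed P ++ H))
      addLinkedEar = extendByCircle (gainList (ed Q₀) (Linked.long L) e₁ (ed R)
        (circList-rotate (ed P) (ear-circList Q₀ Q₀-path Q₀⊆))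
        (λ i → signed-bij Q₀ Q₀-path Q₀⊆ (Good.bij gd (Q₀⊆ i))) gained₀)

    addEarGood : ∀ {φ} → Three N → a ≢ b → Good H φ → Σ (E → Carrier) (Good (ed P ++ H))
    addEarGood three a≢b gd = addLinkedEar gd b≢a (link S three b∈ a∈ b≢a)
      where
      b≢a : b ≢ a
      b≢a q = a≢b (sym q)

  record State (N : List (Fin n)) (H : List (Fin m)) : Set where
    field
      sub   : Sub N H
      three : Three N
      φ     : E → Carrier
      good  : Good H φ

  addEarState : ∀ {N H a b} → State N H → a ∈ N → b ∈ N → a ≢ b → (ear : Ear N H a b) →
                State (vs (Ear.P ear) ++ N) (ed (Ear.P ear) ++ H)
  addEarState {N} st a∈ b∈ a≢b ear = record
    { sub = addEar sub P path a∈ b∈ ; three = wider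
    ; φ = proj₁ extended ; good = proj₂ extended }
    where
    open State st
    open Ear ear
    extended = addEarGood sub a∈ b∈ ear three a≢b good
    wider : Three (vs P ++ N)
    wider = record
      { a∈ = ∈-++⁺ʳ (vs P) (Three.a∈ three) ; b∈ = ∈-++⁺ʳ (vs P) (Three.b∈ three)
      ; c∈ = ∈-++⁺ʳ (vs P) (Three.c∈ three)
      ; a≢b = Three.a≢b three ; a≢c = Three.a≢c three ; b≢c = Three.b≢c three }

  record Larger (N : List (Fin n)) (H : List (Fin m)) : Set where
    constructor larger
    field
      {N′}  : List (Fin n)
      {H′}  : List (Fin m)
      state : State N′ H′
      N⊆    : ∀ {x} → x ∈ N → x ∈ N′
      H⊆    : ∀ {f} → f ∈ H → f ∈ H′

  module _ (tc : TwoConnected Δ) where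
    open import Data.List.Membership.DecPropositional (_≟_ {n = n}) using () renaming (_∈?_ to _∈ᵥ?_)

    -- A path from `y` back to `N` that avoids `a` completes the edge from `a` to `y` to an ear with
    -- distinct ends.
    absorbNeighbour : ∀ {N H y a e} → State N H → Joins Δ e y a → a ∈ N →
                      Σ (Larger N H) λ L → y ∈ Larger.N′ L
    absorbNeighbour {N} {H} {y} {a} {e} st j a∈ with y ∈ᵥ? N
    ... | yes y∈ = larger st id id , y∈
    ... | no y∉ with Three.third (State.three st) a a
    ... | c , c∈ , c≢a , _ with TwoConnected.noCut tc a y c (λ { refl → y∉ a∈ }) c≢a
    ... | W , a∉W with toPath _≟_ W
    ... | X , pX , _ , X⊆ with firstHit (_∈ᵥ? N) X c∈
    ... | b , R , Y , refl , b∈ , out =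
      larger (addEarState st a∈ b∈ a≢b ear) (∈-++⁺ʳ (a ∷ vs R)) (∈-++⁺ʳ (e ∷ ed R)) ,
      there (∈-++⁺ˡ (start∈ R))
      where
      a∉R : a ∉ vs R
      a∉R i = a∉W (X⊆ (∈vs-⋯ˡ R Y i))
      a≢b : a ≢ b
      a≢b refl = a∉R (end∈ R)
      new : ∀ {f} → f ∈ e ∷ ed R → f ∉ H
      new (here refl) k = y∉ (proj₁ (Sub.ends (State.sub st) k j))
      new (there i)   k with edgeFrom R i
      ... | s , t , s∈ , l = out s∈ (proj₁ (Sub.ends (State.sub st) k l))
      ear : Ear N H a b
      ear = record { j = swap j ; R = R ; path = ∉⇒All≢ a∉R ∷ proj₁ (path-⋯⁻ R Y pX)
                   ; newNodes = out ; newEdges = new }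

    absorbWalk : ∀ {N H y a} → State N H → Walk Δ y a → a ∈ N → Σ (Larger N H) λ L → y ∈ Larger.N′ L
    absorbWalk st []           a∈ = larger st id id , a∈
    absorbWalk st (step e j W) a∈ with absorbWalk st W a∈
    ... | larger st₁ N⊆ H⊆ , w∈ with absorbNeighbour st₁ j w∈
    ... | larger st₂ N⊆′ H⊆′ , y∈ = larger st₂ (N⊆′ ∘ N⊆) (H⊆′ ∘ H⊆) , y∈

    absorbNodes : ∀ {N H} → State N H → ∀ ys → Σ (Larger N H) λ L → ∀ {y} → y ∈ ys → y ∈ Larger.N′ L
    absorbNodes st []       = larger st id id , λ ()
    absorbNodes st (y ∷ ys) with absorbNodes st ys
    ... | larger st₁ N⊆ H⊆ , ys⊆
        with absorbWalk st₁ (TwoConnected.connected tc y (Three.a (State.three st₁))) (Three.a∈ (State.three st₁))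
    ... | larger st₂ N⊆′ H⊆′ , y∈ = larger st₂ (N⊆′ ∘ N⊆) (H⊆′ ∘ H⊆) ,
      λ { (here refl) → y∈ ; (there i) → N⊆′ (ys⊆ i) }

  module _ (loopBij : ∀ {φ f g v a b} → Joins Δ f v v → Joins Δ g a b → a ≢ b → Bij φ g →
                      Σ (E → Carrier) λ χ → Bij χ f) where

    -- A loop is a circle of length one, so exactly one edge `x₀` of its fibre is balanced. Any
    -- bijection of the fibre with the group will do once it is shifted to take `x₀` to `ε`.
    addLoop : ∀ {N H f v} → State N H → (∀ x → x ∈ N) → f ∉ H → Joins Δ f v v → State N (f ∷ H)
    addLoop {N} {H} {f} {v} st all f∉ j = record
      { sub = record
        { ends = λ _ _ → all _ , all _
        ; noCut = λ x u∈ v∈ p q → let (W , W⊆ , x∉) = Sub.noCut sub x u∈ v∈ p q in W , there ∘ W⊆ , x∉ }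
      ; three = three ; φ = ψ
      ; good = addEdge (Good-cong (λ i → ≈-reflexive (update-agrees G φ χ₀ f∉ i)) good)
          (Bij-cong (λ q → ≈-reflexive (sym (update-≡ G φ χ₀ q))) χ₀-bij) loopBal }
      where
      open State st
      L = link sub three (Three.a∈ three) (Three.b∈ three) (Three.a≢b three)
      fromLink : ∀ {a b} → a ≢ b → (P : Walk Δ a b) → IsPath Δ P → P ⊆ₑ H → Σ (E → Carrier) λ χ → Bij χ f
      fromLink a≢b []           _   _  = ⊥-elim (a≢b refl)
      fromLink a≢b (step g k P) pth P⊆ = loopBij j k (path-step-≢ {j = k} {W = P} pth) (Good.bij good (P⊆ (here refl)))
      linked = fromLink (Three.a≢b three) (Linked.P L) (Linked.P-path L) (Linked.P⊆ L)
      χ = proj₁ linked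
      χ-bij = proj₂ linked
      loop : CircList [ f ]
      loop = circList {j = j} {Q = []} (isCirc ([] ∷ []) (λ ())) refl
      sol = solveLast {[]} {f} {[]} loop refl
      x₀ = proj₁ sol
      χ₀ : E → Carrier
      χ₀ x = χ x ∙ χ x₀ ⁻¹
      χ₀-bij : Bij χ₀ f
      χ₀-bij = (λ q r s → proj₁ χ-bij q r (∙-cancelʳ _ _ _ s)) ,
        λ g → let (x , q , r) = proj₂ χ-bij (g ∙ χ x₀) in x , q ,
          ≈-trans (∙-congʳ r) (≈-trans (assoc _ _ _) (≈-trans (∙-congˡ (inverseʳ _)) (identityʳ g)))
      ψ : E → Carrier
      ψ = update G φ f χ₀
      act-ε : ∀ b {g} → g ≈ ε → act b g ≈ ε
      act-ε true  q = q
      act-ε false q = ≈-trans (⁻¹-cong q) ε⁻¹≈ε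
      loopBal′ : ∀ {s t} (k : Joins Δ f s t) (Q : Walk Δ t s) → s ≡ t → IsPath Δ Q → ∀ {x qs} → p x ≡ f →
                 map p qs ≡ ed Q → B (x ∷ qs) → gL ψ (step f k Q) (x ∷ qs) ≈ ε
      loopBal′ k Q refl pQ {x} {qs} qx q bal with path-closed Q pQ
      ... | refl with qs
      ... | [] = ≈-trans (identityʳ _) (act-ε (sign k) (≈-trans (≈-reflexive (update-≡ G φ χ₀ qx))
        (≈-trans (∙-congʳ (≈-reflexive (cong χ (proj₂ (proj₂ sol) x qx bal)))) (inverseʳ _))))
      loopBal : ∀ {s t} {k : Joins Δ f s t} {Q : Walk Δ t s} → IsCirc f k Q → Q ⊆ₑ H → ∀ {x qs} → p x ≡ f →
                map p qs ≡ ed Q → B (x ∷ qs) → gL ψ (step f k Q) (x ∷ qs) ≈ ε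
      loopBal {k = k} {Q} c _ with joins-unique j k
      ... | inj₁ (refl , refl) = loopBal′ k Q refl (IsCirc.path c)
      ... | inj₂ (refl , refl) = loopBal′ k Q refl (IsCirc.path c)

    addEdgeState : ∀ {N H} → State N H → (∀ x → x ∈ N) → ∀ f → Σ (Larger N H) λ L → f ∈ Larger.H′ L
    addEdgeState {N} {H} st all f with f ∈? H
    ... | yes f∈ = larger st id id , f∈
    ... | no f∉ with proj₁ (Δ f) ≟ proj₂ (Δ f)
    ... | yes q = larger (addLoop st all f∉ (inj₁ (cong (_, proj₂ (Δ f)) q))) id there , here refl
    ... | no u≢w = larger (addEarState st (all _) (all _) u≢w ear) (∈-++⁺ʳ (vs (Ear.P ear))) there , here refl
      where
      ear : Ear N H (proj₁ (Δ f)) (proj₂ (Δ f))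
      ear = record { j = inj₁ refl ; R = [] ; path = (u≢w ∷ []) ∷ [] ∷ [] ; newNodes = λ ()
                   ; newEdges = λ { (here refl) → f∉ } }

    addEdges : ∀ {N H} → State N H → (∀ x → x ∈ N) → ∀ fs →
               Σ (Larger N H) λ L → ∀ {f} → f ∈ fs → f ∈ Larger.H′ L
    addEdges st all []       = larger st id id , λ ()
    addEdges st all (f ∷ fs) with addEdges st all fs
    ... | larger st₁ N⊆ H⊆ , fs⊆ with addEdgeState st₁ (λ x → N⊆ (all x)) f
    ... | larger st₂ N⊆′ H⊆′ , f∈ = larger st₂ (N⊆′ ∘ N⊆) (H⊆′ ∘ H⊆) ,
      λ { (here refl) → f∈ ; (there i) → H⊆′ (fs⊆ i) }

  -- The circle is an ear attached to its own edge `d`. That subgraph lacks the third node needed by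
  -- `addEarGood`, but the gains on the whole circle are at hand, so `extendGood` applies directly.
  startState : ∀ {s t d} (jd : Joins Δ d s t) (P : Walk Δ s t) → IsPath Δ P → 3 ≤ length (ed P) →
               (γ : E → Carrier) → (∀ {f} → f ∈ ed P ++ [ d ] → Bij γ f) → Determined G γ (ed P ++ [ d ]) →
               Σ (List (Fin n)) λ N → Σ (List (Fin m)) λ H → State N H
  startState jd [] pP ()
  startState jd (step _ _ []) pP (s≤s ())
  startState {s} {t} {d} jd (step e₁ j R@(step {w = v} e₂ k R′)) pP@(qs ∷ (qw ∷ pR′)) le γ bγ det =
    _ , _ , record
      { sub = addEar S P pP (here refl) (there (here refl))
      ; three = record
        { a∈ = here refl ; b∈ = there (here refl) ; c∈ = ∈-++⁺ˡ {xs = vs P} (end∈ P)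
        ; a≢b = λ { refl → All≢⇒∉ qs (here refl) }
        ; a≢c = s≢t
        ; b≢c = λ { refl → All≢⇒∉ qw (end∈ R′) } }
      ; φ = _
      ; good = extendGood S (here refl) (there (here refl)) ear Q₀ pQ₀ id {φ = φ} {γ} goodEdge
          (λ {x} i → ≈-sym (act-involutive (σ (p x)) (γ x))) (λ i → bγ (∈-++⁺ˡ i)) det }
    where
    P = step e₁ j R
    S = singleEdge jd
    s≢t : s ≢ t
    s≢t refl = All≢⇒∉ qs (end∈ R)
    Q₀ : Walk Δ t s
    Q₀ = step d (swap jd) []
    pQ₀ : IsPath Δ Q₀
    pQ₀ = ((λ q → s≢t (sym q)) ∷ []) ∷ [] ∷ []
    d∉ : d ∉ ed P
    d∉ i with path-chord P pP s≢t i jd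
    ... | ()
    ear : Ear (s ∷ t ∷ []) [ d ] s t
    ear = record { j = j ; R = R ; path = pP
      ; newNodes = λ { i (here refl) → All≢⇒∉ qs (verts⊆vs R i)
                     ; i (there (here refl)) → path-∉verts R (qw ∷ pR′) i }
      ; newEdges = λ { i (here refl) → d∉ i } }
    σ : Fin m → Bool
    σ = sg S (here refl) (there (here refl)) ear Q₀ pQ₀ id
    φ : E → Carrier
    φ = signed S (here refl) (there (here refl)) ear Q₀ pQ₀ id γ
    goodEdge : Good [ d ] φ
    goodEdge = record
      { bij = λ { (here refl) → signed-bij S (here refl) (there (here refl)) ear Q₀ pQ₀ id (bγ (∈-++⁺ʳ (ed P) (here refl))) }
      ; bal = λ {_} {_} {f} {j′} {Q} c f∈ Q⊆ → ⊥-elim (path-acyclic _≟_ Q₀ pQ₀ (circList c refl)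
          (λ { (here refl) → f∈ ; (there i) → Q⊆ i })) }

-- A circle of length at least four

module _ {n : ℕ} where
  open import Data.List.Membership.DecPropositional (_≟_ {n = n}) using (_∈?_)

  fresh : (xs : List (Fin n)) → length xs < n → Σ (Fin n) λ x → x ∉ xs
  fresh xs lt with any? (λ x → ¬? (x ∈? xs))
  ... | yes r = r
  ... | no ¬r = ⊥-elim (<⇒≱ lt (injective⇒≤ {f = λ x → Any.index (all x)} inj))
    where
    all : ∀ x → x ∈ xs
    all x with x ∈? xs
    ... | yes i = i
    ... | no ¬i = ⊥-elim (¬r (x , ¬i))
    inj : ∀ {x y} → Any.index (all x) ≡ Any.index (all y) → x ≡ y
    inj {x} {y} q = trans (lookup-index (all x)) (trans (cong (lookup xs) q) (sym (lookup-index (all y))))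

  padTo : ∀ k (xs : List (Fin n)) → Unique xs → k + length xs ≤ n →
          Σ (List (Fin n)) λ ys → Unique ys × length ys ≡ k + length xs × (∀ {x} → x ∈ xs → x ∈ ys)
  padTo zero    xs u le = xs , u , refl , id
  padTo (suc k) xs u le with fresh xs (≤-trans (s≤s (m≤n+m _ k)) le)
  ... | x , x∉ with padTo k (x ∷ xs) (∉⇒All≢ x∉ ∷ u) (subst (_≤ n) (sym (+-suc k (length xs))) le)
  ... | ys , uy , len , sub = ys , uy , trans len (+-suc k (length xs)) , sub ∘ there

module Start {n m : ℕ} (Δ : Graph (Fin n) (Fin m)) (tc : TwoConnected Δ) where
  open Walks Δ
  open Subgraphs Δ

  record StartCircle : Set where
    constructor startCircle
    field
      {s t} : Fin n
      {d}   : Fin m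
      jd    : Joins Δ d s t
      s≢t   : s ≢ t
      P     : Walk Δ s t
      path  : IsPath Δ P
      long  : 3 ≤ length (ed P)

  adjacent? : ∀ u v → Dec (Σ (Fin m) λ f → Joins Δ f u v)
  adjacent? u v = any? (λ f → (Δ f ≟ₑ (u , v)) ⊎-dec (Δ f ≟ₑ (v , u)))
    where
    _≟ₑ_ = Productₚ.≡-dec _≟_ _≟_

  whole : Sub (allFin n) (allFin m)
  whole = record
    { ends = λ _ _ → ∈-allFin _ , ∈-allFin _
    ; noCut = λ x {u} {v} _ _ u≢x v≢x → let (W , x∉) = TwoConnected.noCut tc x u v u≢x v≢x in
        W , (λ _ → ∈-allFin _) , x∉ }

  -- `P` has two edges in any case, and `Q` has two because `u` and `v` are not adjacent. The first
  -- edge of `Q` is set apart as the closing edge.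
  nonadjacent : Three (allFin n) → ∀ {u v} → u ≢ v → ¬ (Σ (Fin m) λ f → Joins Δ f u v) → StartCircle
  nonadjacent T {u} {v} u≢v ¬adj = go (Linked.Q L) (Linked.Q-path L) (Linked.meet L)
    where
    L = link whole T (∈-allFin u) (∈-allFin v) u≢v
    open Linked L using (P; P-path; long)
    go : (Q : Walk Δ u v) → IsPath Δ Q → MeetAtEnds P Q → StartCircle
    go [] _ _ = ⊥-elim (u≢v refl)
    go (step e j []) _ _ = ⊥-elim (¬adj (e , j))
    go (step e j Q@(step _ _ _)) (q ∷ pQ) meet =
      startCircle j (λ { refl → All≢⇒∉ q (start∈ Q) }) (P ⋯ rev Q)
        (path-⋯⁺ P (rev Q) P-path (path-rev Q pQ) (λ i k → atEnd (∈vs-rev Q k) (meet i (there (∈vs-rev Q k)))))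
        (length-⋯ P (rev Q) long (nonempty-length (rev Q) λ { refl → path-∉verts Q pQ (here refl) }))
      where
      atEnd : ∀ {x} → x ∈ vs Q → x ≡ u ⊎ x ≡ v → x ≡ v
      atEnd i (inj₁ refl) = ⊥-elim (All≢⇒∉ q i)
      atEnd i (inj₂ r)    = r

  three : ∀ {a b c : Fin n} → a ≢ b → a ≢ c → b ≢ c → Three (allFin n)
  three a≢b a≢c b≢c = record { a∈ = ∈-allFin _ ; b∈ = ∈-allFin _ ; c∈ = ∈-allFin _
                             ; a≢b = a≢b ; a≢c = a≢c ; b≢c = b≢c }

  -- Either two of four given nodes are not adjacent, and then no path between them is a single edge,
  -- or the four nodes carry a circle of length four.
  start : 4 ≤ n → StartCircle
  start le with padTo 4 [] [] le
  ... | a ∷ b ∷ c ∷ d ∷ [] , (ab ∷ ac ∷ ad ∷ []) ∷ (bc ∷ bd ∷ []) ∷ (cd ∷ []) ∷ [] ∷ [] , refl , _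
    with adjacent? a b | adjacent? b c | adjacent? c d | adjacent? a d
  ... | no ¬p | _ | _ | _ = nonadjacent (three ab ac bc) ab ¬p
  ... | yes _ | no ¬p | _ | _ = nonadjacent (three ab ac bc) bc ¬p
  ... | yes _ | yes _ | no ¬p | _ = nonadjacent (three ab ac bc) cd ¬p
  ... | yes _ | yes _ | yes _ | no ¬p = nonadjacent (three ab ac bc) ad ¬p
  ... | yes (e , j) | yes (f , k) | yes (g , l) | yes (h , i) =
    startCircle i ad (step e j (step f k (step g l [])))
      ((ab ∷ ac ∷ ad ∷ []) ∷ (bc ∷ bd ∷ []) ∷ (cd ∷ []) ∷ [] ∷ []) ≤-refl

-- Loops, digons inside a fibre, and the conclusion

module Final {n m : ℕ} {E : Set} {Δ : Graph (Fin n) (Fin m)} {p : E → Fin m} {B : List E → Set}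
         (be : IsBiasedExpansion Δ p B) (order4 : Order4 be) (tc : TwoConnected Δ) (4≤n : 4 ≤ n) where
  open Expansion be
  open Subgraphs Δ
  open CircleGains be order4
  open import Data.List.Membership.DecPropositional (_≟_ {n = m}) using () renaming (_∈?_ to _∈ₑ?_)
  open import Data.List.Membership.DecPropositional (_≟_ {n = n}) using (_∈?_)

  private
    Ω = liftG Δ p
    module W = Walks Ω

  covering : ∀ v {a b : Fin n} → a ≢ b →
             Σ (List (Fin n)) λ K → Unique K × length K ≡ 4 × v ∈ K × a ∈ K × b ∈ K
  covering v {a} {b} a≢b with v ∈? (a ∷ b ∷ [])
  ... | yes i with padTo 2 (a ∷ b ∷ []) ((a≢b ∷ []) ∷ [] ∷ []) 4≤n
  ...   | K , u , l , s = K , u , l , s i , s (here refl) , s (there (here refl))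
  covering v {a} {b} a≢b | no v∉ with padTo 1 (v ∷ a ∷ b ∷ []) (∉⇒All≢ v∉ ∷ (a≢b ∷ []) ∷ [] ∷ []) 4≤n
  ...   | K , u , l , s = K , u , l , s (here refl) , s (there (here refl)) , s (there (there (here refl)))

  -- The fibre of a loop is compared with that of another edge in a minor that contracts nothing.
  loopMinor : ∀ {f g v a b} → Joins Δ f v v → Joins Δ g a b → a ≢ b → MinorData be
  loopMinor {f} {g} {v} {a} {b} jf jg a≢b = record
    { Ts = [] ; Ss = f ∷ g ∷ [] ; zs = [] ; zs-over = refl ; Ts-unique = [] ; Ts-Ss = λ ()
    ; rep = id ; rep-T = λ () ; toRep = λ u → [] , λ ()
    ; acyclic = λ { (circList c refl) s → none (s (here refl)) }
    ; kept = K ; four = four ; distinct = subst Unique (sym (map-id K)) unique ; S-kept = S-kept }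
    where
    none : ∀ {h} → h ∉ ([] {A = Fin m})
    none ()
    K = proj₁ (covering v a≢b)
    unique = proj₁ (proj₂ (covering v a≢b))
    four = proj₁ (proj₂ (proj₂ (covering v a≢b)))
    members = proj₂ (proj₂ (proj₂ (covering v a≢b)))
    kept-ends : ∀ {h s t} → Joins Δ h s t → s ∈ K → t ∈ K → proj₁ (Δ h) ∈ map id K × proj₂ (Δ h) ∈ map id K
    kept-ends (inj₁ r) i k rewrite r | map-id K = i , k
    kept-ends (inj₂ r) i k rewrite r | map-id K = k , i
    S-kept : ∀ {h} → h ∈ f ∷ g ∷ [] → proj₁ (Δ h) ∈ map id K × proj₂ (Δ h) ∈ map id K
    S-kept (here refl)         = kept-ends jf (proj₁ members) (proj₁ members)
    S-kept (there (here refl)) = kept-ends jg (proj₁ (proj₂ members)) (proj₂ (proj₂ members))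

  module _ (G : Group 0ℓ 0ℓ) where
    open Gain G
    open Balanced be G
    open EarGains be order4 G

    -- The fibres of `f` and `g` are both in bijection with the group of the minor. Matching equal
    -- gains there identifies the two fibres, and `φ` on `g` leads on to `G`, so the two groups need
    -- not be compared.
    loopBij : ∀ {φ f g v a b} → Joins Δ f v v → Joins Δ g a b → a ≢ b → Bij φ g →
              Σ (E → Carrier) λ χ → Bij χ f
    loopBij {φ} {f} {g} jf jg a≢b (φ-inj , φ-onto) = χ , inj , onto
      where
      module M = FromMinor be order4 (loopMinor jf jg a≢b)
      module G′ = Gain M.G
      f-bij : G′.Bij M.φ f
      f-bij = M.φ-bij (here refl)
      g-bij : G′.Bij M.φ g
      g-bij = M.φ-bij (there (here refl))
      σ : ∀ x → Σ E λ y → p y ≡ g × M.φ y G′.≈ M.φ x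
      σ x = proj₂ g-bij (M.φ x)
      χ : E → Carrier
      χ x = φ (proj₁ (σ x))
      inj : Inj χ f
      inj {x} {y} q r s = proj₁ f-bij q r (G′.≈-trans (G′.≈-sym (proj₂ (proj₂ (σ x))))
        (G′.≈-trans (G′.≈-reflexive (cong M.φ (φ-inj (proj₁ (proj₂ (σ x))) (proj₁ (proj₂ (σ y))) s))) (proj₂ (proj₂ (σ y)))))
      onto : Onto χ f
      onto h with φ-onto h
      ... | y , qy , r with proj₂ f-bij (M.φ y)
      ... | x , qx , s = x , qx , ≈-trans (≈-reflexive (cong φ
        (proj₁ g-bij (proj₁ (proj₂ (σ x))) qy (G′.≈-trans (proj₂ (proj₂ (σ x))) s)))) r

    module _ {H φ} (gd : Good H φ) (all : ∀ f → f ∈ H) where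
      open Good gd

      act-swap : ∀ {f g u w} (j : Joins Δ f u w) (k : Joins Δ g w u) → g ≡ f → u ≢ w →
                 ∀ {x y} → act (sign j) x ∙ (act (sign k) y ∙ ε) ≈ ε → x ≈ y
      act-swap {f} {u = u} {w} j k refl u≢w {x} {y} r
        with refl ← joins-irrelevant {g = Δ} {f} (λ q → u≢w (sym q)) k (swap j) =
        act-injective (sign j) (≈-trans (inverseˡ-unique _ _ r) (≈-trans (⁻¹-cong
          (≈-trans (identityʳ _) (≈-trans (≈-reflexive (cong (λ b → act b y) (sign-swap j))) (act-not (sign j) y))))
          (⁻¹-involutive _)))

      -- If the image of the first edge recurs, it is a chord of the projected path, and the circle
      -- is a digon inside one fibre. Such a digon is unbalanced by `noDigon`, and trivial gain
      -- would make its two edges equal. Every other circle projects to a circle of `Δ`.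
      balance : (C : Circle Ω) → B (circEdges Ω C) ⇔ (gain Ω G φ (Circle.walk C) ≈ ε)
      balance record { walk = [] ; nonempty = () }
      balance C@record { walk = W₀@(step {u} {w} x j Q) ; uniqV = uV ; uniqE = uE } with p x ∈ₑ? ed (proj Q)
      ... | no p∉ = mk⇔
        (λ b → ≈-trans (≈-reflexive (gL-proj φ W₀)) (bal c (all _) (λ _ → all _) refl (proj-ed Q) b))
        (λ r → bal⁻ c (all _) (λ _ → all _) refl (proj-ed Q) (≈-trans (≈-reflexive (sym (gL-proj φ W₀))) r))
        where
        cΩ = W.uncircle {j = j} {Q = Q} uV uE
        c : IsCirc (p x) j (proj Q)
        c = isCirc (subst (λ l → Unique (l ∷ʳ u)) (sym (proj-verts Q)) (W.IsCirc.path cΩ)) p∉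
      ... | yes p∈ = digon Q uV uE (path-chord (proj Q) pQ (λ { refl → notLoop refl }) p∈ (swap j))
        where
        cΩ = W.uncircle {j = j} {Q = Q} uV uE
        pQ : IsPath Δ (proj Q)
        pQ = subst (λ l → Unique (l ∷ʳ u)) (sym (proj-verts Q)) (W.IsCirc.path cΩ)
        notLoop : w ≢ u
        notLoop refl = path-noLoop (proj Q) pQ p∈ j
        digon : (Q : Walk Ω w u) → Unique (verts Ω (step x j Q)) → Unique (edges Ω (step x j Q)) →
                ed (proj Q) ≡ [ p x ] →
                B (edges Ω (step x j Q)) ⇔ (gain Ω G φ (step x j Q) ≈ ε)
        digon (step y k []) uV uE@((x≢y ∷ []) ∷ _) q = mk⇔
          (λ b → ⊥-elim (IsBiasedExpansion.noDigon be
            (record { walk = step x j (step y k []) ; nonempty = s≤s z≤n ; uniqV = uV ; uniqE = uE }) x y refl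
            (sym py≡px) b))
          (λ r → ⊥-elim (x≢y (proj₁ (bij (all (p x))) refl py≡px
            (act-swap j k py≡px (λ e → notLoop (sym e)) (≈-trans (≈-reflexive (sym (gL-proj φ (step x j (step y k []))))) r)))))
          where
          py≡px : p y ≡ p x
          py≡px = proj₁ (∷-injective q)

      groupExpansion : GroupExpansionVia Δ p B G φ
      groupExpansion = record
        { inj = λ e e′ q r → proj₁ (bij (all (p e′))) q refl r
        ; onto = λ x f → proj₂ (bij (all f)) x
        ; balance = balance }

    fromStart : ∀ {N H} → State N H → Σ (E → Carrier) λ φ → GroupExpansionVia Δ p B G φ
    fromStart st with absorbNodes tc st (allFin n)
    ... | larger st₁ _ _ , nodes with addEdges loopBij st₁ (λ x → nodes (∈-allFin x)) (allFin m)
    ... | larger st₂ _ _ , edges⊆ = State.φ st₂ , groupExpansion (State.good st₂) (λ f → edges⊆ (∈-allFin f))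

  gainLong : ∀ fs → 4 ≤ length fs → CircList fs → GainedCircle fs
  gainLong (_ ∷ _ ∷ _ ∷ _ ∷ _) _ C = gainCircle C
  gainLong (_ ∷ _ ∷ _ ∷ []) (s≤s (s≤s (s≤s ())))
  gainLong (_ ∷ _ ∷ [])     (s≤s (s≤s ()))
  gainLong (_ ∷ [])         (s≤s ())

  closedPath : ∀ {s t d} → Joins Δ d s t → s ≢ t → (P : Walk Δ s t) → IsPath Δ P → 3 ≤ length (ed P) →
               CircList (ed P ++ [ d ])
  closedPath {d = d} jd s≢t P pP long = circList-rotate [ d ] (circList {j = swap jd} {Q = P} (isCirc pP d∉) refl)
    where
    d∉ : d ∉ ed P
    d∉ i with subst (λ l → 3 ≤ length l) (path-chord P pP s≢t i jd) long
    ... | s≤s ()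

  fromGainedCircle : ∀ {s t d} → Joins Δ d s t → (P : Walk Δ s t) → IsPath Δ P → 3 ≤ length (ed P) →
                     GainedCircle (ed P ++ [ d ]) → IsGroupExpansion Δ p B
  fromGainedCircle jd P path long C =
    G , fromStart G (proj₂ (proj₂ (EarGains.startState be order4 G jd P path long γ bijective determined)))
    where open GainedCircle C

  fromStartCircle : Start.StartCircle Δ tc → IsGroupExpansion Δ p B
  fromStartCircle (Start.startCircle {d = d} jd s≢t P path long) = fromGainedCircle jd P path long
    (gainLong (ed P ++ [ d ]) (subst (4 ≤_) (sym (length-++ (ed P))) (+-mono-≤ long (≤-refl {1})))
      (closedPath jd s≢t P path long))

theorem7p2 : {n m : ℕ} (Δ : Graph (Fin n) (Fin m)) → TwoConnected Δ → 4 ≤ n →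
    {E : Set} (p : E → Fin m) (B : List E → Set) →
    IsBiasedExpansion Δ p B →
    ((M : ExpMinor Δ p B) → ExpMinor.order M ≡ 4 →
    IsGroupExpansion (ExpMinor.mBase M) (ExpMinor.mProj M) (ExpMinor.mBal M)) →
    IsGroupExpansion Δ p B
theorem7p2 Δ tc 4≤n p B be order4 = Final.fromStartCircle be order4 tc 4≤n (Start.start Δ tc 4≤n)
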